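{- Let $k > 0$ and $d>0$ be integers and let $\eta, \varepsilon, \alpha, \rho > 0$ be real numbers. Then there exists a constant $C$, depending only on $k,\eta,\varepsilon,\alpha,\rho$, such that for every positive integer $N$ and every $(k,\eta,\varepsilon,\rho)$-regular set $S \subseteq [N]^d$ occupying fewer than $\alpha p^k$ residue classes modulo $p$ for every prime $p$, there exists a polynomial $f \in \mathbb{Z}[x_1,\ldots,x_d]$ of degree at most $C$ and with all coefficients bounded in absolute value by $N^C$ which vanishes at more than $(1-\eta)|S|$ points of $S$.
   Context: $[N] = \{0,1,\ldots,N\}$; $\pi_i : \mathbb{Z}^d \to \mathbb{Z}$ is the projection to the $i$-th coordinate. A set $S \subseteq \mathbb{Z}^d$ occupies $m$ residue classes mod $p$ if its image in $(\mathbb{Z}/p\mathbb{Z})^d$ has $m$ elements. Regularity is defined recursively in $k$ (relative to the ambient parameter $N$): a set $S \subseteq [N]^d$ is $(1,\eta,\varepsilon,\rho)$-regular if $|S| \ge N^{\varepsilon}$. For $k \ge 2$, $S \subseteq [N]^d$ is $(k,\eta,\varepsilon,\rho)$-regular if for every $S' \subseteq S$ with $|S'| \ge \eta|S|$ there exist a subset $S'' \subseteq S'$ with $|S''| \ge \rho|S|$ and an index $1 \le i \le d$ such that $|\pi_i(A)| \ge N^{\varepsilon}$ for every $A \subseteq S''$ with $|A| \ge |S''|/2$, and such that for every $x \in [N]$ the set $S'' \cap \pi_i^{ -1}(x)$ is either empty or $(k-1,1,\varepsilon,\rho)$-regular.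
   Formalization: The polynomial is required to be nonzero exactly when k ≠ d; for k = d the zero polynomial is allowed, since e.g. S = [N] with k = d = 1, α = 2, η = 1/2 admits no nonzero f of bounded degree. -}

module Defs where

import Algebra.Properties.Group as GroupProperties
open import Data.Fin using (Fin; toℕ)
import Data.Fin.Properties as Fin
open import Data.Integer as ℤ using (ℤ; +_; 0ℤ; 1ℤ)
import Data.Integer.Properties as ℤ
open import Data.List as List using (List; length; filter; deduplicate)
open import Data.List.Membership.Propositional using (_∈_)
import Data.List.Relation.Binary.Subset.Propositional as Sublist
import Data.List.Relation.Unary.Unique.DecPropositional.Properties as UniqueDec
open import Data.List.Relation.Unary.Unique.Propositional using (Unique)
import Data.List.Relation.Unary.Unique.Propositional.Properties as Unique
open import Data.Nat as ℕ using (ℕ; suc; NonZero; _≤_; _^_)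
open import Data.Nat.DivMod using (_mod_)
open import Data.Product using (Σ-syntax; ∃-syntax; _×_; _,_)
open import Data.Rational as ℚ using (ℚ; 0ℚ; 1ℚ; _/_)
import Data.Rational.Properties as ℚ
open import Data.Sum using (_⊎_; inj₁; inj₂; swap)
open import Data.Vec as Vec using (Vec; lookup)
import Data.Vec.Properties as Vec
open import Relation.Binary.Definitions using (DecidableEquality; tri<; tri≈; tri>)
open import Relation.Binary.PropositionalEquality
  using (_≡_; _≢_; sym; trans; cong; subst)
open import Relation.Nullary using (¬_)
open import Relation.Unary using (Decidable)

-- Two-sided Dedekind cuts: Lower q means q < x, and Upper q means x < q.
record ℝ : Set₁ where
  field
    Lower Upper     : ℚ → Set
    lower-inhabited : ∃[ q ] Lower q
    upper-inhabited : ∃[ q ] Upper q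
    lower-closed    : ∀ {p q} → p ℚ.< q → Lower q → Lower p
    upper-closed    : ∀ {p q} → p ℚ.< q → Upper p → Upper q
    lower-open      : ∀ {p} → Lower p → ∃[ q ] (p ℚ.< q × Lower q)
    upper-open      : ∀ {q} → Upper q → ∃[ p ] (p ℚ.< q × Upper p)
    disjoint        : ∀ {q} → Lower q → ¬ Upper q
    located         : ∀ {p q} → p ℚ.< q → Lower p ⊎ Upper q

open ℝ public

private
  module Group = GroupProperties ℚ.+-0-group

  q-1<q : ∀ q → q ℚ.- 1ℚ ℚ.< q
  q-1<q q = subst (q ℚ.- 1ℚ ℚ.<_) (ℚ.+-identityʳ q)
    (ℚ.+-monoʳ-< q {ℚ.- 1ℚ} {0ℚ} (ℚ.negative⁻¹ (ℚ.- 1ℚ)))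

  q<q+1 : ∀ q → q ℚ.< q ℚ.+ 1ℚ
  q<q+1 q = subst (ℚ._< q ℚ.+ 1ℚ) (ℚ.+-identityʳ q)
    (ℚ.+-monoʳ-< q {0ℚ} {1ℚ} (ℚ.positive⁻¹ 1ℚ))

  reflect-< : ∀ c {p q} → p ℚ.< q → c ℚ.- q ℚ.< c ℚ.- p
  reflect-< c p<q = ℚ.+-monoʳ-< c (ℚ.neg-antimono-< p<q)

  reflect-involutive : ∀ c q → c ℚ.- (c ℚ.- q) ≡ q
  reflect-involutive c q =
    trans (cong (c ℚ.+_) (ℚ.neg-distrib-+ c (ℚ.- q)))
    (trans (sym (ℚ.+-assoc c (ℚ.- c) (ℚ.- (ℚ.- q))))
    (trans (cong (ℚ._+ ℚ.- (ℚ.- q)) (ℚ.+-inverseʳ c))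
    (trans (ℚ.+-identityˡ _) (Group.⁻¹-involutive q))))

fromℚ : ℚ → ℝ
fromℚ c = record
  { Lower           = ℚ._< c
  ; Upper           = c ℚ.<_
  ; lower-inhabited = c ℚ.- 1ℚ , q-1<q c
  ; upper-inhabited = c ℚ.+ 1ℚ , q<q+1 c
  ; lower-closed    = ℚ.<-trans
  ; upper-closed    = λ p<q c<p → ℚ.<-trans c<p p<q
  ; lower-open      = ℚ.<-dense
  ; upper-open      = λ c<q → let (m , c<m , m<q) = ℚ.<-dense c<q in m , m<q , c<m
  ; disjoint        = ℚ.<-asym
  ; located         = located′
  }
  where
  located′ : ∀ {p q} → p ℚ.< q → p ℚ.< c ⊎ c ℚ.< q
  located′ {p} p<q with ℚ.<-cmp p c
  ... | tri< p<c _ _ = inj₁ p<c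
  ... | tri≈ _ p≡c _ = inj₂ (subst (ℚ._< _) p≡c p<q)
  ... | tri> _ _ c<p = inj₂ (ℚ.<-trans c<p p<q)

1ℝ : ℝ
1ℝ = fromℚ 1ℚ

-- The real number c - x.
_⊖_ : ℚ → ℝ → ℝ
c ⊖ x = record
  { Lower           = λ q → Upper x (c ℚ.- q)
  ; Upper           = λ q → Lower x (c ℚ.- q)
  ; lower-inhabited = let (q , u) = upper-inhabited x in
                      c ℚ.- q , subst (Upper x) (sym (reflect-involutive c q)) u
  ; upper-inhabited = let (q , l) = lower-inhabited x in
                      c ℚ.- q , subst (Lower x) (sym (reflect-involutive c q)) l
  ; lower-closed    = λ p<q → upper-closed x (reflect-< c p<q)
  ; upper-closed    = λ p<q → lower-closed x (reflect-< c p<q)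
  ; lower-open      = λ {p} u → let (r , r<c-p , u′) = upper-open x u in
                      c ℚ.- r
                      , subst (ℚ._< c ℚ.- r) (reflect-involutive c p) (reflect-< c r<c-p)
                      , subst (Upper x) (sym (reflect-involutive c r)) u′
  ; upper-open      = λ {q} l → let (r , c-q<r , l′) = lower-open x l in
                      c ℚ.- r
                      , subst (c ℚ.- r ℚ.<_) (reflect-involutive c q) (reflect-< c c-q<r)
                      , subst (Lower x) (sym (reflect-involutive c r)) l′
  ; disjoint        = λ u l → disjoint x l u
  ; located         = λ p<q → swap (located x (reflect-< c p<q))
  }

Positive : ℝ → Set
Positive x = Lower x 0ℚ

ℕ→ℚ : ℕ → ℚ
ℕ→ℚ n = + n / 1

-- Comparisons of a natural number m with the real number x · n, for n : ℕ.
-- As n ≥ 0, x · n is the supremum of the q · n with q < x and the infimum of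
-- those with x < q.  When n = 0 the product is 0 and the clauses still agree.

_≥[_·_] : ℕ → ℝ → ℕ → Set
m ≥[ x · n ] = ∀ q → Lower x q → q ℚ.* ℕ→ℚ n ℚ.≤ ℕ→ℚ m

_<[_·_] : ℕ → ℝ → ℕ → Set
m <[ x · n ] = ∃[ q ] (Lower x q × ℕ→ℚ m ℚ.< q ℚ.* ℕ→ℚ n)

_>[_·_] : ℕ → ℝ → ℕ → Set
m >[ x · n ] = ∃[ q ] (Upper x q × q ℚ.* ℕ→ℚ n ℚ.< ℕ→ℚ m)

-- m ≥ N ^ ε for a real ε > 0 and N ≥ 1, where N ^ ε is the supremum of the
-- N ^ (a / b) over rationals 0 ≤ a / b < ε.
_≥[_^_] : ℕ → ℕ → ℝ → Set
m ≥[ N ^ ε ] = ∀ a b .{{_ : NonZero b}} → Lower ε (+ a / b) → N ^ a ≤ m ^ b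

record FinSet (A : Set) : Set where
  field
    elements : List A
    unique   : Unique elements

open FinSet public

∣_∣ : {A : Set} → FinSet A → ℕ
∣ S ∣ = length (elements S)

_⊆_ : {A : Set} → FinSet A → FinSet A → Set
S ⊆ T = elements S Sublist.⊆ elements T

image : {A B : Set} → DecidableEquality B → (A → B) → FinSet A → FinSet B
image _≟_ f S = record
  { elements = deduplicate _≟_ (List.map f (elements S))
  ; unique   = UniqueDec.deduplicate-! _≟_ (List.map f (elements S))
  }

separate : {A : Set} {P : A → Set} → Decidable P → FinSet A → FinSet A
separate P? S = record
  { elements = filter P? (elements S)
  ; unique   = Unique.filter⁺ P? (unique S)
  }

-- The interval {0, 1, …, N}.
[_] : ℕ → Set
[ N ] = Fin (suc N)

Point : ℕ → ℕ → Set
Point N d = Vec [ N ] d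

module _ {N d : ℕ} where

  π : Fin d → FinSet (Point N d) → FinSet [ N ]
  π i = image Fin._≟_ (λ v → lookup v i)

  fibre : Fin d → [ N ] → FinSet (Point N d) → FinSet (Point N d)
  fibre i x = separate (λ v → lookup v i Fin.≟ x)

  residues : (p : ℕ) .{{_ : NonZero p}} → FinSet (Point N d) → FinSet (Vec (Fin p) d)
  residues p = image (Vec.≡-dec Fin._≟_) (Vec.map (λ a → toℕ a mod p))

  Regular : (k : ℕ) .{{_ : NonZero k}} (η ε ρ : ℝ) → FinSet (Point N d) → Set
  Regular 1             η ε ρ S = ∣ S ∣ ≥[ N ^ ε ]
  Regular (suc (suc k)) η ε ρ S =
    ∀ S′ → S′ ⊆ S → ∣ S′ ∣ ≥[ η · ∣ S ∣ ] →
    ∃[ S″ ] (S″ ⊆ S′ × ∣ S″ ∣ ≥[ ρ · ∣ S ∣ ] ×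
      Σ[ i ∈ Fin d ]
        ((∀ A → A ⊆ S″ → ∣ S″ ∣ ≤ 2 ℕ.* ∣ A ∣ → ∣ π i A ∣ ≥[ N ^ ε ]) ×
         (∀ x → ∣ fibre i x S″ ∣ ≡ 0 ⊎ Regular (suc k) 1ℝ ε ρ (fibre i x S″))))

-- Elements of ℤ[x₁, …, x_d] as finitely supported functions on exponent vectors.
record Polynomial (d : ℕ) : Set where
  field
    coeff     : Vec ℕ d → ℤ
    support   : FinSet (Vec ℕ d)
    supported : ∀ m → coeff m ≢ 0ℤ → m ∈ elements support

open Polynomial public

module _ {d : ℕ} where

  Nonzero : Polynomial d → Set
  Nonzero f = ∃[ m ] coeff f m ≢ 0ℤ

  DegreeAtMost : ℕ → Polynomial d → Set
  DegreeAtMost D f = ∀ m → coeff f m ≢ 0ℤ → Vec.sum m ≤ D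

  CoefficientsAtMost : ℕ → Polynomial d → Set
  CoefficientsAtMost B f = ∀ m → ℤ.∣ coeff f m ∣ ≤ B

  monomial : Vec ℕ d → Vec ℤ d → ℤ
  monomial m x = Vec.foldr′ ℤ._*_ 1ℤ (Vec.zipWith ℤ._^_ x m)

  eval : Polynomial d → Vec ℤ d → ℤ
  eval f x = List.foldr ℤ._+_ 0ℤ
    (List.map (λ m → coeff f m ℤ.* monomial m x) (elements (support f)))

  zerosIn : {N : ℕ} → FinSet (Point N d) → Polynomial d → FinSet (Point N d)
  zerosIn S f = separate (λ v → eval f (Vec.map (λ a → + toℕ a) v) ℤ.≟ 0ℤ) S

  -- "A polynomial" is meant to be a nonzero one, since 0 vanishes on all of S.
  -- For k = d and large α this cannot be asked: S = [N]^d is then allowed, and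
  -- for large N no nonzero f of bounded degree vanishes on a fixed positive
  -- proportion of it.
  Nontrivial : ℕ → Polynomial d → Set
  Nontrivial k f = k ≢ d → Nonzero f

{-# OPTIONS --safe #-}

-- Pruning the heavy fibres turns a regular set into a tree of height k in which every branching spreads over at
-- least K ~ N ^ ε' labels. By the larger sieve such a tree is spread evenly over residue classes modulo most primes
-- p < K: at most (λ / p) ^ k of it lies in one class. As only α p ^ k classes are met, most classes that occur are
-- popular, so that a fibre meets the class of a given point modulo p with frequency about 1 / p.
--
-- Induction on k then yields O(M ^ k) points of the tree that capture a fixed proportion of it: choosing O(M) fibres
-- greedily, most points agree with captured points of the chosen fibres modulo primes with product above N ^ M, since
-- the sum of log p / p is of order log N. A polynomial whose values are integers below N ^ M and which vanishes at
-- the chosen points is then divisible at every captured point by more than its size, hence vanishes there.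
--
-- Repeating this inside what is left of S, which is possible as long as that contains a regular set, exhausts S in
-- boundedly many rounds. A polynomial of degree D in k + 1 variables has order D ^ (k + 1) coefficients, more than the
-- O(D ^ k) points it has to kill for M ~ D, so it is found by the pigeonhole principle. For k > d no large regular sets
-- exist, and bounded N are dealt with in one variable.

module Submission where

open import Data.Bool using (Bool; true; false; T?; _∧_; _∨_; not; if_then_else_)
open import Data.Empty using (⊥-elim)
open import Data.Fin as Fin using (Fin; toℕ; finToFun; funToFin; fromℕ<)
import Data.Fin.Properties as Fin
open import Data.Integer as ℤ using (0ℤ)
import Data.Integer.Properties as ℤ
open import Data.List as List
  using (List; []; _∷_; _++_; length; map; filter; filterᵇ; deduplicate; concatMap; cartesianProductWith; applyUpTo; upTo; allFin)
import Data.List.Membership.DecPropositional as DecMembership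
open import Data.List.Membership.Propositional using (_∈_; _∉_)
open import Data.List.Membership.Propositional.Properties
open import Data.List.Membership.Propositional.Properties.WithK using (unique∧set⇒bag; unique⇒irrelevant)
open import Data.List.Properties using (length-++; length-map; length-filter; length-tabulate; length-upTo)
open import Data.List.Relation.Binary.BagAndSetEquality using (∼bag⇒↭)
open import Data.List.Relation.Binary.Permutation.Propositional using (_↭_; ↭-sym)
open import Data.List.Relation.Binary.Permutation.Propositional.Properties
  using (↭-length; filter-↭; ↭-empty-inv; ↭-singleton-inv)
open import Data.List.Relation.Unary.All as All using (All; []; _∷_)
open import Data.List.Relation.Unary.AllPairs using ([]; _∷_)
open import Data.List.Relation.Unary.Any as Any using (here; there)
open import Data.List.Relation.Unary.Any.Properties using (lookup-index)
import Data.List.Relation.Unary.Unique.DecPropositional.Properties as UniqueDec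
open import Data.List.Relation.Unary.Unique.Propositional using (Unique)
import Data.List.Relation.Unary.Unique.Propositional.Properties as Unique
open import Data.Nat
open import Data.Nat.DivMod using (_mod_; m≡m%n+[m/n]*n; m%n<n; m*[n/m]≡n; m/n*n≤m; %-distribˡ-+; %-distribˡ-*)
open import Data.Nat.Divisibility
  using (_∣_; _∣?_; divides; ∣-refl; ∣-trans; ∣⇒≤; ∣1⇒≡1; 1∣_; m∣m*n; n∣m*n; ∣m⇒∣m*n; *-monoʳ-∣; m≤n⇒m!∣n!)
open import Data.Nat.ListAction using (product)
open import Data.Nat.Primality
  using (Prime; prime?; prime⇒nonZero; prime⇒nonTrivial; prime⇒irreducible; euclidsLemma; ¬prime[1])
open import Data.Nat.Primality.Factorisation using (factorise; PrimeFactorisation)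
open import Data.Nat.Properties hiding (_≟_)
open import Data.Nat.Tactic.RingSolver using (solve-∀)
open import Data.Product using (∃-syntax; Σ-syntax; _×_; _,_; proj₁; proj₂)
open import Data.Rational as ℚ using (ℚ; 0ℚ; 1ℚ; mkℚ)
import Data.Rational.Properties as ℚ
open import Data.Rational.Unnormalised as ℚᵘ using (mkℚᵘ)
import Data.Rational.Unnormalised.Properties as ℚᵘ
open import Data.Sum as Sum using (_⊎_; inj₁; inj₂; [_,_]′)
open import Data.Vec as Vec using (Vec; []; _∷_; lookup; replicate)
import Data.Vec.Properties as Vec
open import Defs
open import Function using (_∘_; id; mk⇔)
open import Relation.Binary.Definitions using (DecidableEquality; Tri; tri<; tri≈; tri>)
open import Relation.Binary.PropositionalEquality hiding (J; [_])
open import Relation.Nullary using (Dec; yes; no; does; ¬_; contradiction)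
open import Relation.Nullary.Decidable using (dec-true; dec-false; toWitness)

-- Sums over lists

-- The induction cannot run over trees alone. A fibre meets few residue classes only modulo primes
-- that depend on the fibre, and even spreading holds at a point only modulo primes that depend on
-- the point. The inductive statement therefore carries a relation `E` between points and the primes
-- still usable at them, and the weight of these primes may shrink by a factor 3 per level.
-- Capturing is stated for all `Closed` sets at once, so that the points are chosen before the
-- polynomial that has to vanish at them.
--
-- The constants seem to form a circle, since M is about 2 (k + 1) D and the number of points is of
-- order M ^ k. It is broken because the implied constant does not depend on M: D is chosen after
-- it, and the threshold for N after D. Only the first k + 1 variables occur in the polynomial, so
-- nothing depends on d.
--
-- Real numbers are cuts, so a comparison of a cardinality with η times another is decided only up
-- to one point. This is why a single point `s₀` is carried along when regularity is applied again
-- and again.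

≡-≤ : ∀ {l m n} → l ≡ m → m ≤ n → l ≤ n
≡-≤ refl m≤n = m≤n

≤-≡ : ∀ {l m n} → l ≤ m → m ≡ n → l ≤ n
≤-≡ l≤m refl = l≤m

∑ : {A : Set} → List A → (A → ℕ) → ℕ
∑ [] f = 0
∑ (x ∷ xs) f = f x + ∑ xs f

infix 8 _⊙_

-- The Iverson bracket, used as a factor.
_⊙_ : Bool → ℕ → ℕ
true ⊙ n = n
false ⊙ n = 0

count : {A : Set} → List A → (A → Bool) → ℕ
count xs q = ∑ xs (λ x → q x ⊙ 1)

holds : {P : Set} (P? : Dec P) → does P? ≡ true → P
holds (yes p) _ = p

fails : {P : Set} (P? : Dec P) → does P? ≡ false → ¬ P
fails (no ¬p) _ = ¬p

not-true : ∀ {b} → not b ≡ true → b ≡ false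
not-true {false} _ = refl

not-false : ∀ {b} → not b ≡ false → b ≡ true
not-false {true} _ = refl

∧-true : ∀ a {b} → b ≡ true → a ∧ b ≡ a
∧-true true refl = refl
∧-true false refl = refl

∧-intro : ∀ {a b} → a ≡ true → b ≡ true → a ∧ b ≡ true
∧-intro refl refl = refl

∧-left : ∀ a {b} → a ∧ b ≡ true → a ≡ true
∧-left true _ = refl

∧-right : ∀ a {b} → a ∧ b ≡ true → b ≡ true
∧-right true eq = eq

⊙-monoʳ : ∀ b {m n} → m ≤ n → b ⊙ m ≤ b ⊙ n
⊙-monoʳ true m≤n = m≤n
⊙-monoʳ false _ = z≤n

⊙-mono : ∀ b c {m} → (b ≡ true → c ≡ true) → b ⊙ m ≤ c ⊙ m
⊙-mono false c imp = z≤n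
⊙-mono true c imp rewrite imp refl = ≤-refl

⊙-≤ : ∀ b {m} → b ⊙ m ≤ m
⊙-≤ true = ≤-refl
⊙-≤ false = z≤n

⊙-bound : ∀ b {m n} → (b ≡ true → m ≤ n) → b ⊙ m ≤ n
⊙-bound true h = h refl
⊙-bound false h = z≤n

⊙-*ˡ : ∀ b k m → k * b ⊙ m ≡ b ⊙ (k * m)
⊙-*ˡ true k m = refl
⊙-*ˡ false k m = *-zeroʳ k

⊙-∧ : ∀ a b m → (a ∧ b) ⊙ m ≡ a ⊙ (b ⊙ m)
⊙-∧ true b m = refl
⊙-∧ false b m = refl

⊙-split : ∀ a b m → a ⊙ m ≡ (a ∧ b) ⊙ m + (a ∧ not b) ⊙ m
⊙-split true true m = sym (+-identityʳ m)
⊙-split true false m = refl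
⊙-split false b m = refl

*-swap : ∀ a b c → a * (b * c) ≡ b * (a * c)
*-swap = solve-∀

*-swap-assoc : ∀ a b c → a * (b * c) ≡ b * a * c
*-swap-assoc = solve-∀

*-assoc-swap : ∀ a b c → a * b * c ≡ b * (a * c)
*-assoc-swap = solve-∀

*-interchange : ∀ a b c d → a * b * (c * d) ≡ a * c * (b * d)
*-interchange = solve-∀

*0≤ : ∀ m {n} → m * 0 ≤ n
*0≤ m = ≡-≤ (*-zeroʳ m) z≤n

n<2^n : ∀ n → n < 2 ^ n
n<2^n zero = z<s
n<2^n (suc n) = ≤-trans (+-mono-≤ (m^n>0 2 n) (n<2^n n)) (+-monoʳ-≤ (2 ^ n) (≤-reflexive (sym (+-identityʳ _))))

positiveʳ : ∀ m {n k} → k < m * n → 0 < n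
positiveʳ m {zero} lt = contradiction (≤-≡ lt (*-zeroʳ m)) (λ ())
positiveʳ m {suc n} lt = z<s

∈⇒nonZero : ∀ {A : Set} {xs : List A} {x} → x ∈ xs → NonZero (length xs)
∈⇒nonZero (here _) = _
∈⇒nonZero (there _) = _

∑-empty : ∀ {A : Set} {xs : List A} f → xs ≡ [] → ∑ xs f ≡ 0
∑-empty f refl = refl

∑-mono : ∀ {A : Set} (xs : List A) {f g} → (∀ {x} → x ∈ xs → f x ≤ g x) → ∑ xs f ≤ ∑ xs g
∑-mono [] h = z≤n
∑-mono (x ∷ xs) h = +-mono-≤ (h (here refl)) (∑-mono xs (h ∘ there))

∑-cong : ∀ {A : Set} (xs : List A) {f g} → (∀ {x} → x ∈ xs → f x ≡ g x) → ∑ xs f ≡ ∑ xs g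
∑-cong [] h = refl
∑-cong (x ∷ xs) h = cong₂ _+_ (h (here refl)) (∑-cong xs (h ∘ there))

∑-+ : ∀ {A : Set} (xs : List A) f g → ∑ xs (λ x → f x + g x) ≡ ∑ xs f + ∑ xs g
∑-+ [] f g = refl
∑-+ (x ∷ xs) f g = trans (cong (f x + g x +_) (∑-+ xs f g)) (lemma (f x) (g x) (∑ xs f) (∑ xs g))
  where
  lemma : ∀ a b c d → a + b + (c + d) ≡ a + c + (b + d)
  lemma = solve-∀

∑-*ˡ : ∀ {A : Set} (xs : List A) k f → k * ∑ xs f ≡ ∑ xs (λ x → k * f x)
∑-*ˡ [] k f = *-zeroʳ k
∑-*ˡ (x ∷ xs) k f = trans (*-distribˡ-+ k (f x) _) (cong (k * f x +_) (∑-*ˡ xs k f))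

∑-*ʳ : ∀ {A : Set} (xs : List A) k f → ∑ xs f * k ≡ ∑ xs (λ x → f x * k)
∑-*ʳ [] k f = refl
∑-*ʳ (x ∷ xs) k f = trans (*-distribʳ-+ k (f x) _) (cong (f x * k +_) (∑-*ʳ xs k f))

∑-zero : ∀ {A : Set} (xs : List A) → ∑ xs (λ _ → 0) ≡ 0
∑-zero [] = refl
∑-zero (x ∷ xs) = ∑-zero xs

∑-const : ∀ {A : Set} (xs : List A) k → ∑ xs (λ _ → k) ≡ length xs * k
∑-const [] k = refl
∑-const (x ∷ xs) k = cong (k +_) (∑-const xs k)

∑-≤-const : ∀ {A : Set} (xs : List A) {f} k → (∀ {x} → x ∈ xs → f x ≤ k) → ∑ xs f ≤ length xs * k
∑-≤-const xs k h = ≤-≡ (∑-mono xs h) (∑-const xs k)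

∑-swap : ∀ {A B : Set} (xs : List A) (ys : List B) (f : A → B → ℕ) →
    ∑ xs (λ x → ∑ ys (f x)) ≡ ∑ ys (λ y → ∑ xs (λ x → f x y))
∑-swap [] ys f = sym (∑-zero ys)
∑-swap (x ∷ xs) ys f =
  trans (cong (∑ ys (f x) +_) (∑-swap xs ys f)) (sym (∑-+ ys (f x) _))

∑-⊙ : ∀ {A : Set} (xs : List A) b f → ∑ xs (λ x → b ⊙ f x) ≡ b ⊙ ∑ xs f
∑-⊙ xs true f = refl
∑-⊙ xs false f = ∑-zero xs

∑-filter? : ∀ {A : Set} {P : A → Set} (P? : ∀ x → Dec (P x)) (xs : List A) f → ∑ (filter P? xs) f ≡ ∑ xs (λ x → does (P? x) ⊙ f x)
∑-filter? P? [] f = refl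
∑-filter? P? (x ∷ xs) f with does (P? x)
... | true = cong (f x +_) (∑-filter? P? xs f)
... | false = ∑-filter? P? xs f

∑-filter : ∀ {A : Set} (xs : List A) (q : A → Bool) f → ∑ (filterᵇ q xs) f ≡ ∑ xs (λ x → q x ⊙ f x)
∑-filter xs q f = ∑-filter? (λ x → T? (q x)) xs f

length-∑ : ∀ {A : Set} (xs : List A) → length xs ≡ ∑ xs (λ _ → 1)
length-∑ xs = sym (trans (∑-const xs 1) (*-identityʳ _))

length-filter? : ∀ {A : Set} {P : A → Set} (P? : ∀ x → Dec (P x)) (xs : List A) → length (filter P? xs) ≡ count xs (λ x → does (P? x))
length-filter? P? xs = trans (length-∑ (filter P? xs)) (∑-filter? P? xs (λ _ → 1))

length-filterᵇ : ∀ {A : Set} (xs : List A) (q : A → Bool) → length (filterᵇ q xs) ≡ count xs q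
length-filterᵇ xs q = trans (length-∑ (filterᵇ q xs)) (∑-filter xs q (λ _ → 1))

∑-member : ∀ {A : Set} {xs : List A} {x} f → x ∈ xs → f x ≤ ∑ xs f
∑-member f (here refl) = m≤m+n _ _
∑-member f (there {x} x∈xs) = ≤-trans (∑-member f x∈xs) (m≤n+m _ (f x))

count≤length : ∀ {A : Set} (xs : List A) q → count xs q ≤ length xs
count≤length xs q = ≤-≡ (∑-mono xs (λ {x} _ → ⊙-≤ (q x))) (sym (length-∑ xs))

∈-filterᵇ⁺ : ∀ {A : Set} (q : A → Bool) {xs x} → x ∈ xs → q x ≡ true → x ∈ filterᵇ q xs
∈-filterᵇ⁺ q {x ∷ xs} (here refl) eq with q x
... | true = here refl
∈-filterᵇ⁺ q {y ∷ xs} (there x∈) eq with q y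
... | true = there (∈-filterᵇ⁺ q x∈ eq)
... | false = ∈-filterᵇ⁺ q x∈ eq

∈-filterᵇ⁻ : ∀ {A : Set} (q : A → Bool) {xs x} → x ∈ filterᵇ q xs → x ∈ xs × q x ≡ true
∈-filterᵇ⁻ q {y ∷ xs} x∈ with q y in eq
∈-filterᵇ⁻ q {y ∷ xs} (here refl) | true = here refl , eq
∈-filterᵇ⁻ q {y ∷ xs} (there x∈) | true = let (a , b) = ∈-filterᵇ⁻ q x∈ in there a , b
... | false = let (a , b) = ∈-filterᵇ⁻ q x∈ in there a , b

filterᵇ-unique : ∀ {A : Set} (q : A → Bool) {xs} → Unique xs → Unique (filterᵇ q xs)
filterᵇ-unique q = Unique.filter⁺ (λ x → T? (q x))

someᵇ : {A : Set} → (A → Bool) → List A → Bool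
someᵇ q [] = false
someᵇ q (x ∷ xs) = q x ∨ someᵇ q xs

someᵇ⁺ : ∀ {A : Set} (q : A → Bool) {xs x} → x ∈ xs → q x ≡ true → someᵇ q xs ≡ true
someᵇ⁺ q {x ∷ xs} (here refl) eq rewrite eq = refl
someᵇ⁺ q {y ∷ xs} (there x∈) eq with q y
... | true = refl
... | false = someᵇ⁺ q x∈ eq

someᵇ⁻ : ∀ {A : Set} (q : A → Bool) {xs} → someᵇ q xs ≡ true → ∃[ x ] (x ∈ xs × q x ≡ true)
someᵇ⁻ q {y ∷ xs} eq with q y in eqy
... | true = y , here refl , eqy
... | false = let (x , x∈ , qx) = someᵇ⁻ q eq in x , there x∈ , qx

count-positive : ∀ {A : Set} (xs : List A) q → 0 < count xs q → ∃[ x ] (x ∈ xs × q x ≡ true)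
count-positive (x ∷ xs) q pos with q x in eq
... | true = x , here refl , eq
... | false = let (y , y∈ , qy) = count-positive xs q pos in y , there y∈ , qy

∑-average : ∀ {A : Set} (xs : List A) f m → 0 < length xs → length xs * m ≤ ∑ xs f → ∃[ x ] (x ∈ xs × m ≤ f x)
∑-average (x ∷ xs) f m _ h = go x xs h
  where
  go : ∀ x xs → length (x ∷ xs) * m ≤ ∑ (x ∷ xs) f → ∃[ z ] (z ∈ x ∷ xs × m ≤ f z)
  go x xs h with m ≤? f x
  go x xs h | yes m≤fx = x , here refl , m≤fx
  go x [] h | no m≰fx =
    contradiction (subst₂ _≤_ (+-identityʳ m) (+-identityʳ (f x)) h) m≰fx
  go x (y ∷ xs) h | no m≰fx =
    let (z , z∈ , le) = go y xs (+-cancelˡ-≤ m _ _ (≤-trans h (+-monoˡ-≤ _ (<⇒≤ (≰⇒> m≰fx)))))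
    in z , there z∈ , le

module Fibres {A : Set} (_≟_ : DecidableEquality A) where

  infix 9 _==_
  _==_ : A → A → Bool
  x == y = does (x ≟ y)

  ==-refl : ∀ x → (x == x) ≡ true
  ==-refl x = dec-true (x ≟ x) refl

  -- Labels have the type of points, so that residue classes and the separation of distinct elements
  -- make sense for them too.
  fib : (A → A) → A → List A → List A
  fib ψ y = filterᵇ (λ s → ψ s == y)

  ∈-fibre⁺ : ∀ ψ {S s} → s ∈ S → s ∈ fib ψ (ψ s) S
  ∈-fibre⁺ ψ {s = s} s∈S = ∈-filterᵇ⁺ _ s∈S (==-refl (ψ s))

  ∈-fibre⁻ : ∀ ψ {y S s} → s ∈ fib ψ y S → s ∈ S × ψ s ≡ y
  ∈-fibre⁻ ψ {y} s∈ = let (a , b) = ∈-filterᵇ⁻ _ s∈ in a , holds (_ ≟ y) b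

  ∑-absent : ∀ {ys} x n → All (x ≢_) ys → ∑ ys (λ y → (x == y) ⊙ n) ≡ 0
  ∑-absent x n [] = refl
  ∑-absent {y ∷ ys} x n (x≢ ∷ p) rewrite dec-false (x ≟ y) x≢ = ∑-absent x n p

  ∑-delta : ∀ {ys x} n → Unique ys → x ∈ ys → ∑ ys (λ y → (x == y) ⊙ n) ≡ n
  ∑-delta {y ∷ ys} n (y≢ ∷ _) (here refl) rewrite ==-refl y =
    trans (cong (n +_) (∑-absent y n y≢)) (+-identityʳ n)
  ∑-delta {y ∷ ys} {x} n (y≢ ∷ uniq) (there x∈)
    rewrite dec-false (x ≟ y) (λ eq → All.lookup y≢ x∈ (sym eq)) = ∑-delta n uniq x∈

  ∑-by-fibres : ∀ (ψ : A → A) S f →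
    ∑ S f ≡ ∑ (deduplicate _≟_ (map ψ S)) (λ y → ∑ (fib ψ y S) f)
  ∑-by-fibres ψ S f = sym (begin
    ∑ Y (λ y → ∑ (fib ψ y S) f) ≡⟨ ∑-cong Y (λ {y} _ → ∑-filter S _ f) ⟩
    ∑ Y (λ y → ∑ S (λ s → (ψ s == y) ⊙ f s)) ≡⟨ ∑-swap Y S _ ⟩
    ∑ S (λ s → ∑ Y (λ y → (ψ s == y) ⊙ f s)) ≡⟨ ∑-cong S (λ {s} s∈S → ∑-delta (f s)
                                                 (UniqueDec.deduplicate-! _≟_ (map ψ S))
                                                 (∈-deduplicate⁺ _≟_ (∈-map⁺ ψ s∈S))) ⟩
    ∑ S f ∎)
    where
    open ≡-Reasoning
    Y = deduplicate _≟_ (map ψ S)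

  -- This is how bounds for the fibres of a node become a bound for the node.
  ∑-fibrewise : ∀ (ψ : A → A) S {f g} →
    (∀ y → ∑ (fib ψ y S) f ≤ ∑ (fib ψ y S) g) → ∑ S f ≤ ∑ S g
  ∑-fibrewise ψ S {f} {g} h rewrite ∑-by-fibres ψ S f | ∑-by-fibres ψ S g =
    ∑-mono (deduplicate _≟_ (map ψ S)) (λ {y} _ → h y)

-- Trees and the points they are captured by

-- Stands for the zero set of a polynomial: a value divisible by too many primes is zero.
Closed : {A R : Set} → (ℕ → A → R) → List ℕ → (ℕ → ℕ) → ℕ → (A → Set) → Set
Closed class 𝒫 w bound V = ∀ {s} (e : ℕ → Bool) →
  (∀ {p} → p ∈ 𝒫 → e p ≡ true → ∃[ t ] (V t × class p t ≡ class p s)) →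
  bound ≤ ∑ 𝒫 (λ p → e p ⊙ w p) → V s

-- β α bounds the classes met by a fibre when the whole set meets α p ^ suc k, a class is popular if it holds
-- a proportion 1 / (Θ α p ^ suc k), and about Q k α (M + 1) fibres are chosen.
module Constants (z σ δ Λ : ℕ) where

  Θ β : ℕ → ℕ
  Θ α = z * σ * α
  β α = z * σ * (Λ * α)

  -- Modulo a usable p, at least a proportion 1 / (γ p) of the tree lies in fibres that hit a given
  -- popular class. One greedily chosen fibre raises a bounded potential by at least 1 / Q of a
  -- fixed unit. `cst` multiplies up the number of generators over the levels.
  γ Q cst : ℕ → ℕ → ℕ
  γ k α = 2 * (Θ α * Λ ^ k)
  Q k α = 2 * γ k α * δ * z
  cst zero α = 1
  cst (suc k) α = (Q k α + 1) * cst k (β α)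

  cst-positive : ∀ k α → 0 < cst k α
  cst-positive zero α = z<s
  cst-positive (suc k) α = *-mono-< (m≤n+m 1 (Q k α)) (cst-positive k (β α))

module Trees {A R : Set} (_≟_ : DecidableEquality A) (_≟ᴿ_ : DecidableEquality R)
  (class : ℕ → A → R) (K : ℕ) where

  open Fibres _≟_ public

  infix 9 _≈[_]_
  _≈[_]_ : A → ℕ → A → Bool
  s ≈[ p ] t = does (class p s ≟ᴿ class p t)

  ≈⁺ : ∀ {p s t} → class p s ≡ class p t → s ≈[ p ] t ≡ true
  ≈⁺ {p} {s} {t} = dec-true (class p s ≟ᴿ class p t)

  ≈⁻ : ∀ {p s t} → s ≈[ p ] t ≡ true → class p s ≡ class p t
  ≈⁻ {p} {s} {t} = holds (class p s ≟ᴿ class p t)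

  ≈-sym : ∀ p s t → s ≈[ p ] t ≡ true → t ≈[ p ] s ≡ true
  ≈-sym p s t e = ≈⁺ {p} {t} {s} (sym (≈⁻ {p} {s} {t} e))

  ≈-trans : ∀ p s t r → s ≈[ p ] t ≡ true → t ≈[ p ] r ≡ true → s ≈[ p ] r ≡ true
  ≈-trans p s t r e e′ = ≈⁺ {p} {s} {r} (trans (≈⁻ {p} {s} {t} e) (≈⁻ {p} {t} {r} e′))

  Compatible : (A → A) → Set
  Compatible ψ = ∀ {p s t} → class p s ≡ class p t → class p (ψ s) ≡ class p (ψ t)

  -- The label ψ is a coordinate or, on the lowest level, the point itself.
  data Branching : ℕ → List A → Set where
    leaf : ∀ s → Branching 0 (s ∷ [])
    node : ∀ {k S} (ψ : A → A) → Compatible ψ →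
        (∀ y → K * length (fib ψ y S) ≤ length S) →
        (∀ y → fib ψ y S ≡ [] ⊎ Branching k (fib ψ y S)) →
        Branching (suc k) S

  -- A fibre of a pruned set agrees with the subtree it came from only up to the order of the list.
  Branching-resp-↭ : ∀ {k S S′} → S ↭ S′ → Branching k S → Branching k S′
  Branching-resp-↭ S↭S′ (leaf s) with ↭-singleton-inv (↭-sym S↭S′)
  ... | refl = leaf s
  Branching-resp-↭ {S = S} {S′} S↭S′ (node {k} ψ compat light children) = node ψ compat
    (λ y → subst₂ _≤_ (cong (K *_) (↭-length (fibre↭ y))) (↭-length S↭S′) (light y))
    (λ y → child y (children y))
    where
    fibre↭ : ∀ y → fib ψ y S ↭ fib ψ y S′
    fibre↭ y = filter-↭ _ S↭S′
    child : ∀ y → fib ψ y S ≡ [] ⊎ Branching k (fib ψ y S) →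
        fib ψ y S′ ≡ [] ⊎ Branching k (fib ψ y S′)
    child y (inj₁ none) = inj₁ (↭-empty-inv (subst (fib ψ y S′ ↭_) none (↭-sym (fibre↭ y))))
    child y (inj₂ br) = inj₂ (Branching-resp-↭ (fibre↭ y) br)

-- The larger sieve on trees and the capture of points

module Sieve
  {A R : Set} (_≟_ : DecidableEquality A) (_≟ᴿ_ : DecidableEquality R)
  (class : ℕ → A → R) (𝒫 : List ℕ) (w u : ℕ → ℕ) (Π ℓ K : ℕ)
  (𝒫-positive : ∀ {p} → p ∈ 𝒫 → 0 < p)
  -- `w p` plays the role of log p and ℓ that of log N. The factor `Π` clears denominators, so that
  -- `u p` is `Π` log p / p.
  (scale : ∀ {p} → p ∈ 𝒫 → p * u p ≡ Π * w p)
  (separation : ∀ {s t} → s ≢ t → ∑ 𝒫 (λ p → does (class p s ≟ᴿ class p t) ⊙ w p) ≤ ℓ)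
  (W≤Kℓ : ∑ 𝒫 w ≤ K * ℓ) (Λ : ℕ)
  where
  open Trees _≟_ _≟ᴿ_ class K public

  level : (A → A) → List A → A → ℕ → Bool
  level ψ S y p = does (p * count S (λ t → ψ t ≈[ p ] y) ≤? Λ * length S)

  -- The test is passed at every node on the path from the root to s. Along the path the proportions
  -- multiply to (Λ / p) ^ k, while the weights of the lost primes only add up.
  good : ∀ {k S} → Branching k S → A → ℕ → Bool
  goodᶜ : ∀ {k S} → S ≡ [] ⊎ Branching k S → A → ℕ → Bool
  good (leaf _) s p = true
  good (node {S = S} ψ _ _ children) s p = level ψ S (ψ s) p ∧ goodᶜ (children (ψ s)) s p
  goodᶜ (inj₁ _) s p = true
  goodᶜ (inj₂ b) s p = good b s p

  -- If any point is counted at all, its own test bounds the whole label class, which is the label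
  -- class of y.
  level-mass : ∀ ψ S p y →
    p * count S (λ s → level ψ S (ψ s) p ∧ ψ s ≈[ p ] y) ≤ Λ * length S
  level-mass ψ S p y with 0 <? count S (λ s → level ψ S (ψ s) p ∧ ψ s ≈[ p ] y)
  ... | no ¬pos = ≡-≤ (trans (cong (p *_) (n≤0⇒n≡0 (≮⇒≥ ¬pos))) (*-zeroʳ p)) z≤n
  ... | yes pos with count-positive S _ pos
  ... | (s₀ , _ , both) = ≤-trans
    (*-monoʳ-≤ p (∑-mono S (λ {s} _ → ⊙-mono _ _ (λ e →
      ≈-trans p (ψ s) y (ψ s₀) (∧-right (level ψ S (ψ s) p) e)
        (≈-sym p (ψ s₀) y (∧-right (level ψ S (ψ s₀) p) both))))))
    (holds (_ ≤? _) (∧-left _ both))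

  -- By compatibility the class of t lies over the label class of `ψ t`. Fibres over other labels
  -- contribute nothing. The remaining ones hold at most a proportion Λ / p of S by `level-mass`,
  -- and inside each of them induction gives (Λ / p) ^ k.
  good-mass : ∀ {k S} (br : Branching k S) p t →
    p ^ k * count S (λ s → good br s p ∧ s ≈[ p ] t) ≤ Λ ^ k * length S
  good-mass (leaf s) p t = +-monoˡ-≤ 0 (+-monoˡ-≤ 0 (⊙-≤ (s ≈[ p ] t)))
  good-mass {suc k} {S} br@(node ψ compat light children) p t = begin
    p * p ^ k * count S F ≡⟨ *-assoc p _ _ ⟩
    p * (p ^ k * count S F) ≤⟨ *-monoʳ-≤ p step ⟩
    p * (Λ ^ k * count S G) ≡⟨ *-swap p (Λ ^ k) _ ⟩
    Λ ^ k * (p * count S G) ≤⟨ *-monoʳ-≤ (Λ ^ k) (level-mass ψ S p (ψ t)) ⟩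
    Λ ^ k * (Λ * length S) ≡⟨ *-swap-assoc (Λ ^ k) Λ (length S) ⟩
    Λ * Λ ^ k * length S ∎
    where
    open ≤-Reasoning
    F G : A → Bool
    F s = good br s p ∧ s ≈[ p ] t
    G s = level ψ S (ψ s) p ∧ ψ s ≈[ p ] ψ t
    F⇒G : ∀ s → F s ≡ true → G s ≡ true
    F⇒G s e = ∧-intro (∧-left (level ψ S (ψ s) p) (∧-left (good br s p) e))
        (≈⁺ (compat (≈⁻ {p} {s} {t} (∧-right (good br s p) e))))
    fibre-step : ∀ y → ∑ (fib ψ y S) (λ s → p ^ k * F s ⊙ 1)
        ≤ ∑ (fib ψ y S) (λ s → Λ ^ k * G s ⊙ 1)
    fibre-step y with children y in eq
    ... | inj₁ none = ≡-≤ (∑-empty _ none) z≤n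
    ... | inj₂ b with level ψ S y p ∧ y ≈[ p ] ψ t in gy
    ... | false = ∑-mono (fib ψ y S) λ {s} s∈ →
            ≡-≤ (⊙-*ˡ (F s) (p ^ k) 1) (⊙-bound (F s) λ e →
              contradiction (trans (sym (F⇒G s e))
                (trans (cong (λ z → level ψ S z p ∧ z ≈[ p ] ψ t) (proj₂ (∈-fibre⁻ ψ {y} {S} s∈))) gy))
                (λ ()))
    ... | true = begin
        ∑ T (λ s → p ^ k * F s ⊙ 1) ≡⟨ ∑-*ˡ T (p ^ k) _ ⟨
        p ^ k * count T F ≤⟨ *-monoʳ-≤ (p ^ k) (∑-mono T (λ {s} s∈ → ⊙-mono (F s) _ (F⇒ s s∈))) ⟩
        p ^ k * count T (λ s → good b s p ∧ s ≈[ p ] t) ≤⟨ good-mass b p t ⟩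
        Λ ^ k * length T ≡⟨ cong (Λ ^ k *_) (length-∑ T) ⟩
        Λ ^ k * ∑ T (λ _ → 1) ≡⟨ cong (Λ ^ k *_) (∑-cong T (λ s∈ → cong (_⊙ 1) (sym (G≡ s∈)))) ⟩
        Λ ^ k * count T G ≡⟨ ∑-*ˡ T (Λ ^ k) _ ⟩
        ∑ T (λ s → Λ ^ k * G s ⊙ 1) ∎
      where
      T = fib ψ y S
      G≡ : ∀ {s} → s ∈ T → G s ≡ true
      G≡ s∈ = trans (cong (λ z → level ψ S z p ∧ z ≈[ p ] ψ t) (proj₂ (∈-fibre⁻ ψ {y} {S} s∈))) gy
      F⇒ : ∀ s → s ∈ T → F s ≡ true → good b s p ∧ s ≈[ p ] t ≡ true
      F⇒ s s∈ e = ∧-intro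
        (trans (cong (λ c → goodᶜ c s p) (sym eq)) (
         trans (child≡ (proj₂ (∈-fibre⁻ ψ {y} {S} s∈)))
        (∧-right (level ψ S (ψ s) p) (∧-left (good br s p) e)))) (∧-right (good br s p) e)
        where
        child≡ : ∀ {z} → z ≡ y → goodᶜ (children y) s p ≡ goodᶜ (children z) s p
        child≡ refl = refl
    step : p ^ k * count S F ≤ Λ ^ k * count S G
    step = subst₂ _≤_ (sym (∑-*ˡ S (p ^ k) _)) (sym (∑-*ˡ S (Λ ^ k) _)) (∑-fibrewise ψ S fibre-step)

  not-∧ : ∀ a b m → not (a ∧ b) ⊙ m ≤ not a ⊙ m + not b ⊙ m
  not-∧ true b m = ≤-refl
  not-∧ false b m = m≤m+n m _

  -- Larger sieve: distinct labels agree modulo few primes, and few points share a label.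
  level-loss : ∀ {S} ψ → (∀ y → K * length (fib ψ y S) ≤ length S) → ∀ {s} → s ∈ S →
    Λ * ∑ 𝒫 (λ p → not (level ψ S (ψ s) p) ⊙ u p) ≤ 2 * (Π * ℓ)
  level-loss {S} ψ light {s} s∈S = *-cancelˡ-≤ n {{∈⇒nonZero s∈S}} (begin
    n * (Λ * ∑ 𝒫 (λ p → L p ⊙ u p)) ≡⟨ *-swap-assoc n Λ _ ⟩
    Λ * n * ∑ 𝒫 (λ p → L p ⊙ u p) ≡⟨ ∑-*ˡ 𝒫 (Λ * n) _ ⟩
    ∑ 𝒫 (λ p → Λ * n * L p ⊙ u p) ≤⟨ ∑-mono 𝒫 (λ {p} p∈ → pointwise p p∈) ⟩
    ∑ 𝒫 (λ p → Π * (w p * c p)) ≡⟨ ∑-*ˡ 𝒫 Π _ ⟨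
    Π * ∑ 𝒫 (λ p → w p * c p) ≡⟨ cong (Π *_) (∑-cong 𝒫 (λ {p} _ → ∑-*ˡ S (w p) _)) ⟩
    Π * ∑ 𝒫 (λ p → ∑ S (λ t → w p * (ψ t ≈[ p ] ψ s) ⊙ 1))
        ≡⟨ cong (Π *_) (∑-swap 𝒫 S _) ⟩
    Π * ∑ S (λ t → ∑ 𝒫 (λ p → w p * (ψ t ≈[ p ] ψ s) ⊙ 1))
        ≤⟨ *-monoʳ-≤ Π (∑-mono S (λ {t} _ → per-point t)) ⟩
    Π * ∑ S (λ t → (ψ t == ψ s) ⊙ 1 * W + ℓ) ≡⟨ cong (Π *_) (∑-+ S _ _) ⟩
    Π * (∑ S (λ t → (ψ t == ψ s) ⊙ 1 * W) + ∑ S (λ _ → ℓ))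
        ≡⟨ cong (Π *_) (cong₂ _+_ (∑-*ʳ S W _) (sym (∑-const S ℓ))) ⟨
    Π * (count S (λ t → ψ t == ψ s) * W + n * ℓ)
        ≡⟨ cong (λ z → Π * (z * W + n * ℓ)) (length-filterᵇ S _) ⟨
    Π * (f * W + n * ℓ) ≤⟨ *-monoʳ-≤ Π (+-monoˡ-≤ (n * ℓ) fibre-bound) ⟩
    Π * (n * ℓ + n * ℓ) ≡⟨ lemma₂ Π n ℓ ⟩
    n * (2 * (Π * ℓ)) ∎)
    where
    open ≤-Reasoning
    n f W : ℕ
    n = length S
    f = length (fib ψ (ψ s) S)
    W = ∑ 𝒫 w
    L : ℕ → Bool
    L p = not (level ψ S (ψ s) p)
    c : ℕ → ℕ
    c p = count S (λ t → ψ t ≈[ p ] ψ s)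
    lemma₂ : ∀ a b d → a * (b * d + b * d) ≡ b * (2 * (a * d))
    lemma₂ = solve-∀
    lemma₃ : ∀ a b d → a * b * d ≡ a * d * b
    lemma₃ = solve-∀
    pointwise : ∀ p → p ∈ 𝒫 → Λ * n * L p ⊙ u p ≤ Π * (w p * c p)
    pointwise p p∈ with level ψ S (ψ s) p in eq
    ... | true = *0≤ (Λ * n)
    ... | false = begin
      Λ * n * u p ≤⟨ *-monoˡ-≤ (u p) (<⇒≤ (≰⇒> (fails (p * c p ≤? Λ * n) eq))) ⟩
      p * c p * u p ≡⟨ lemma₃ p (c p) (u p) ⟩
      p * u p * c p ≡⟨ cong (_* c p) (scale p∈) ⟩
      Π * w p * c p ≡⟨ *-assoc Π (w p) (c p) ⟩
      Π * (w p * c p) ∎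
    -- Equal labels agree modulo every prime and may cost the full weight `W`. Distinct labels cost
    -- at most ℓ by `separation`. The first kind is rare enough because the fibre of s holds at most
    -- a proportion 1 / K of S.
    per-point : ∀ t → ∑ 𝒫 (λ p → w p * (ψ t ≈[ p ] ψ s) ⊙ 1) ≤ (ψ t == ψ s) ⊙ 1 * W + ℓ
    per-point t with ψ t ≟ ψ s
    ... | yes _ = ≤-trans (∑-mono 𝒫 (λ {p} _ → ≤-≡ (*-monoʳ-≤ (w p) (⊙-≤ (ψ t ≈[ p ] ψ s))) (*-identityʳ (w p))))
                     (≡-≤ (sym (+-identityʳ W)) (m≤m+n (W + 0) ℓ))
    ... | no ψt≢ψs = ≡-≤ (∑-cong 𝒫 (λ {p} _ →
                       trans (⊙-*ˡ (ψ t ≈[ p ] ψ s) (w p) 1) (cong ((ψ t ≈[ p ] ψ s) ⊙_) (*-identityʳ (w p)))))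
                       (separation ψt≢ψs)
    fibre-bound : f * W ≤ n * ℓ
    fibre-bound = begin
      f * W ≤⟨ *-monoʳ-≤ f W≤Kℓ ⟩
      f * (K * ℓ) ≡⟨ *-swap-assoc f K ℓ ⟩
      K * f * ℓ ≤⟨ *-monoˡ-≤ ℓ (light (ψ s)) ⟩
      n * ℓ ∎

  -- A union bound over the k nodes on the path of s.
  good-loss : ∀ {k S} (br : Branching k S) {s} → s ∈ S →
    Λ * ∑ 𝒫 (λ p → not (good br s p) ⊙ u p) ≤ k * (2 * (Π * ℓ))
  good-loss (leaf _) _ = ≤-reflexive (trans (cong (Λ *_) (∑-zero 𝒫)) (*-zeroʳ Λ))
  good-loss {suc k} {S} br@(node ψ compat light children) {s} s∈S = begin
    Λ * ∑ 𝒫 (λ p → not (good br s p) ⊙ u p)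
      ≤⟨ *-monoʳ-≤ Λ (≤-≡ (∑-mono 𝒫 (λ {p} _ → not-∧ (level ψ S (ψ s) p) (goodᶜ (children (ψ s)) s p) (u p)))
           (∑-+ 𝒫 _ _)) ⟩
    Λ * (∑ 𝒫 (λ p → not (level ψ S (ψ s) p) ⊙ u p) + ∑ 𝒫 (λ p → not (goodᶜ (children (ψ s)) s p) ⊙ u p))
      ≡⟨ *-distribˡ-+ Λ _ _ ⟩
    Λ * ∑ 𝒫 (λ p → not (level ψ S (ψ s) p) ⊙ u p) + Λ * ∑ 𝒫 (λ p → not (goodᶜ (children (ψ s)) s p) ⊙ u p)
      ≤⟨ +-mono-≤ (level-loss ψ light s∈S) (child (children (ψ s))) ⟩
    2 * (Π * ℓ) + k * (2 * (Π * ℓ)) ∎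
    where
    open ≤-Reasoning
    child : ∀ (c : fib ψ (ψ s) S ≡ [] ⊎ Branching k (fib ψ (ψ s) S)) →
        Λ * ∑ 𝒫 (λ p → not (goodᶜ c s p) ⊙ u p) ≤ k * (2 * (Π * ℓ))
    child (inj₂ b) = good-loss b (∈-fibre⁺ ψ s∈S)
    child (inj₁ none) with subst (s ∈_) none (∈-fibre⁺ ψ s∈S)
    ... | ()

  weight : (ℕ → Bool) → ℕ
  weight e = ∑ 𝒫 (λ p → e p ⊙ u p)

  weight-split : ∀ (e d : ℕ → Bool) → weight e ≡ weight (λ p → e p ∧ d p) + weight (λ p → e p ∧ not (d p))
  weight-split e d = trans (∑-cong 𝒫 (λ {p} _ → ⊙-split (e p) (d p) (u p))) (∑-+ 𝒫 _ _)

  -- `τ₀` is the unit of prime weight: all primes together weigh at most σ units, and Π ℓ is at most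
  -- δ units. Each kind of exceptional point that is new on a level is kept below a proportion 1 /
  -- z. Agreement of weight M ℓ forces membership in a closed set.
  module Capture (z σ δ M τ₀ : ℕ)
    (z-positive : 0 < z) (σ-positive : 0 < σ) (δ-positive : 0 < δ) (M-positive : 0 < M)
    (τ₀-positive : 0 < τ₀) (Λ-positive : 0 < Λ) (ℓ-positive : 0 < ℓ) (Π-positive : 0 < Π)
    (total≤στ₀ : ∑ 𝒫 u ≤ σ * τ₀) (Πℓ≤δτ₀ : Π * ℓ ≤ δ * τ₀)
    (𝒫-large : ∀ {p} → p ∈ 𝒫 → 2 * (M * δ) ≤ p)
    where
    open Constants z σ δ Λ

    -- `E s` is the set of primes still usable at s. Only points whose usable primes weigh at least
    -- τ count as lost; that few points fall below τ is left to the level above. One list of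
    -- generators must serve every closed set V.
    record Captured (g κ τ : ℕ) (S : List A) (E : A → ℕ → Bool) : Set₁ where
      field
        generators : List A
        kept : A → Bool
        generators-few : length generators ≤ g
        forced : ∀ {V} → Closed class 𝒫 w (M * ℓ) V → (∀ {x} → x ∈ generators → V x) →
            ∀ {x} → x ∈ S → kept x ≡ true → V x
        few-lost : z * count S (λ s → not (kept s) ∧ does (τ ≤? weight (E s))) ≤ κ * length S

    open Captured

    module Step {k : ℕ} {S : List A} (ψ : A → A) (compat : Compatible ψ)
      (light : ∀ y → K * length (fib ψ y S) ≤ length S)
      (children : ∀ y → fib ψ y S ≡ [] ⊎ Branching k (fib ψ y S))
      (α : ℕ) (α-positive : 0 < α) (E : A → ℕ → Bool) (Ω : ℕ → List A)
      (E⇒good : ∀ {s p} → s ∈ S → E s p ≡ true → good (node {S = S} ψ compat light children) s p ≡ true)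
      (Ω-few : ∀ {p} → p ∈ 𝒫 → length (Ω p) ≤ α * p ^ suc k)
      (Ω-covers : ∀ {p s} → p ∈ 𝒫 → s ∈ S → E s p ≡ true → ∃[ t ] (t ∈ Ω p × t ≈[ p ] s ≡ true))
      (K-large : ∀ {p} → p ∈ 𝒫 → cst (suc k) α * p ≤ K)
      where
      n τ b θ c : ℕ
      n = length S
      -- A point of the node starts with weight 3 τ. It may lose τ to labels with too many classes
      -- and τ to unpopular classes, and τ remains.
      τ = 3 ^ k * τ₀
      b = β α
      θ = Θ α
      c = γ k α

      τ₀≤τ : τ₀ ≤ τ
      τ₀≤τ = subst (_≤ τ) (*-identityˡ τ₀) (*-monoˡ-≤ τ₀ (m^n>0 3 k))

      labelClasses : A → ℕ → List A
      labelClasses y p = filterᵇ (λ t → ψ t ≈[ p ] y) (Ω p)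

      okay : A → ℕ → Bool
      okay y p = does (length (labelClasses y p) ≤? b * p ^ k)

      E′ : A → ℕ → Bool
      E′ s p = E s p ∧ okay (ψ s) p

      -- Emptied where the label has too many classes, so that the bound on the length holds for
      -- every prime. Covering is required only where `E′` holds, and there the list is intact.
      Ω′ : A → ℕ → List A
      Ω′ y p = if okay y p then labelClasses y p else []

      E′⇒good : ∀ y {s p} → s ∈ fib ψ y S → E′ s p ≡ true → goodᶜ (children y) s p ≡ true
      E′⇒good y {s} {p} s∈ e with ∈-fibre⁻ ψ {y} {S} s∈
      ... | s∈S , refl = ∧-right (level ψ S (ψ s) p) (E⇒good s∈S (∧-left (E s p) e))

      Ω′-few : ∀ y {p} → p ∈ 𝒫 → length (Ω′ y p) ≤ b * p ^ k
      Ω′-few y {p} _ with okay y p in eq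
      ... | true = holds (_ ≤? _) eq
      ... | false = z≤n

      Ω′-covers : ∀ y {p s} → p ∈ 𝒫 → s ∈ fib ψ y S → E′ s p ≡ true →
          ∃[ t ] (t ∈ Ω′ y p × t ≈[ p ] s ≡ true)
      Ω′-covers y {p} {s} p∈ s∈ e with ∈-fibre⁻ ψ {y} {S} s∈
      ... | s∈S , refl rewrite ∧-right (E s p) e =
        let (t , t∈ , t≈s) = Ω-covers p∈ s∈S (∧-left (E s p) e)
        in t , ∈-filterᵇ⁺ _ t∈ (≈⁺ (compat (≈⁻ {p} {t} {s} t≈s))) , t≈s

      cst-child : ∀ {p} → p ∈ 𝒫 → cst k b * p ≤ K
      cst-child {p} p∈ = ≤-trans (*-monoˡ-≤ p (≡-≤ (sym (*-identityˡ _))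
        (*-monoˡ-≤ (cst k b) (m≤n+m 1 (Q k α))))) (K-large p∈)

      γp≤K : ∀ {p} → p ∈ 𝒫 → c * p ≤ K
      γp≤K {p} p∈ = ≤-trans (*-monoˡ-≤ p (begin
        c ≤⟨ m≤n*m c 2 ⟩
        2 * c ≤⟨ m≤m*n (2 * c) δ {{>-nonZero δ-positive}} ⟩
        2 * c * δ ≤⟨ m≤m*n (2 * c * δ) z {{>-nonZero z-positive}} ⟩
        Q k α ≤⟨ m≤m+n (Q k α) 1 ⟩
        Q k α + 1 ≤⟨ m≤m*n (Q k α + 1) (cst k b) {{>-nonZero (cst-positive k b)}} ⟩
        cst (suc k) α ∎)) (K-large p∈)
        where open ≤-Reasoning

      -- Label classes with too many residue classes are few, and each has small good mass.
      bad-mass : ∀ {p} → p ∈ 𝒫 → b * count S (λ s → E s p ∧ not (okay (ψ s) p)) ≤ α * (Λ * n)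
      bad-mass {p} p∈ = *-cancelˡ-≤ (p ^ suc k) {{>-nonZero (m^n>0 p {{>-nonZero (𝒫-positive p∈)}} (suc k))}} (begin
        p ^ suc k * (b * count S Bad) ≡⟨ lemma₁ p (p ^ k) b (count S Bad) ⟩
        p * (b * p ^ k * count S Bad) ≡⟨ cong (p *_) (∑-*ˡ S (b * p ^ k) _) ⟩
        p * ∑ S (λ s → b * p ^ k * Bad s ⊙ 1) ≤⟨ *-monoʳ-≤ p (∑-mono S (λ {s} _ → pointwise s)) ⟩
        p * ∑ S (λ s → ∑ (Ω p) (λ t → (E s p ∧ ψ t ≈[ p ] ψ s) ⊙ 1))
            ≡⟨ cong (p *_) (∑-swap S (Ω p) _) ⟩
        p * ∑ (Ω p) (λ t → count S (λ s → E s p ∧ ψ t ≈[ p ] ψ s))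
            ≡⟨ ∑-*ˡ (Ω p) p _ ⟩
        ∑ (Ω p) (λ t → p * count S (λ s → E s p ∧ ψ t ≈[ p ] ψ s))
            ≤⟨ ∑-≤-const (Ω p) (Λ * n) (λ {t} _ → per-class t) ⟩
        length (Ω p) * (Λ * n) ≤⟨ *-monoˡ-≤ (Λ * n) (Ω-few p∈) ⟩
        α * p ^ suc k * (Λ * n) ≡⟨ *-assoc-swap α (p ^ suc k) (Λ * n) ⟩
        p ^ suc k * (α * (Λ * n)) ∎)
        where
        open ≤-Reasoning
        Bad : A → Bool
        Bad s = E s p ∧ not (okay (ψ s) p)
        lemma₁ : ∀ x y v m → x * y * (v * m) ≡ x * (v * y * m)
        lemma₁ = solve-∀
        pointwise : ∀ s → b * p ^ k * Bad s ⊙ 1 ≤ ∑ (Ω p) (λ t → (E s p ∧ ψ t ≈[ p ] ψ s) ⊙ 1)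
        pointwise s with E s p | okay (ψ s) p in eq
        ... | false | _ = *0≤ (b * p ^ k)
        ... | true | true = *0≤ (b * p ^ k)
        ... | true | false = ≡-≤ (*-identityʳ _)
          (≤-≡ (<⇒≤ (≰⇒> (fails (_ ≤? _) eq))) (length-filterᵇ (Ω p) _))
        per-class : ∀ t → p * count S (λ s → E s p ∧ ψ t ≈[ p ] ψ s) ≤ Λ * n
        per-class t = ≤-trans (*-monoʳ-≤ p (∑-mono S (λ {s} s∈ → ⊙-mono _ _ (λ e →
          ∧-intro (∧-left (level ψ S (ψ s) p) (E⇒good s∈ (∧-left (E s p) e)))
              (≈-sym p (ψ t) (ψ s) (∧-right (E s p) e))))))
          (level-mass ψ S p (ψ t))

      module WithChildren
        (child : ∀ y → Captured (cst k b * (M + 1) ^ k) (3 * k) τ (fib ψ y S) E′) where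

        B : A → A → Bool
        B y s = kept (child y) s

        -- `H` keeps the points captured inside their own fibre. Popularity is measured among these
        -- alone, since only captured points can pass on divisibility.
        H popular E″ : A → ℕ → Bool
        H s p = E′ s p ∧ B (ψ s) s
        popular s p = does (n ≤? θ * p ^ suc k * count S (λ t → H t p ∧ t ≈[ p ] s))
        E″ s p = H s p ∧ popular s p

        H⇒E : ∀ {s p} → H s p ≡ true → E s p ≡ true
        H⇒E {s} {p} h = ∧-left (E s p) (∧-left (E′ s p) h)

        -- At most α p ^ (k + 1) classes occur, and an unpopular one holds less than n / (θ p ^ (k +
        -- 1)) points of `H`.
        unpopular-mass : ∀ {p} → p ∈ 𝒫 → θ * count S (λ s → H s p ∧ not (popular s p)) ≤ α * n
        unpopular-mass {p} p∈ = *-cancelˡ-≤ (p ^ suc k) {{>-nonZero (m^n>0 p {{>-nonZero (𝒫-positive p∈)}} (suc k))}} (begin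
          p ^ suc k * (θ * count S N) ≡⟨ *-swap-assoc (p ^ suc k) θ (count S N) ⟩
          θ * p ^ suc k * count S N ≤⟨ *-monoʳ-≤ (θ * p ^ suc k) (∑-mono S pointwise) ⟩
          θ * p ^ suc k * ∑ S (λ s → ∑ (Ω p) (λ t → (N s ∧ t ≈[ p ] s) ⊙ 1))
              ≡⟨ cong (θ * p ^ suc k *_) (∑-swap S (Ω p) _) ⟩
          θ * p ^ suc k * ∑ (Ω p) (λ t → count S (λ s → N s ∧ t ≈[ p ] s))
              ≡⟨ ∑-*ˡ (Ω p) (θ * p ^ suc k) _ ⟩
          ∑ (Ω p) (λ t → θ * p ^ suc k * count S (λ s → N s ∧ t ≈[ p ] s))
              ≤⟨ ∑-≤-const (Ω p) n (λ {t} _ → per-class t) ⟩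
          length (Ω p) * n ≤⟨ *-monoˡ-≤ n (Ω-few p∈) ⟩
          α * p ^ suc k * n ≡⟨ *-assoc-swap α (p ^ suc k) n ⟩
          p ^ suc k * (α * n) ∎)
          where
          open ≤-Reasoning
          N : A → Bool
          N s = H s p ∧ not (popular s p)
          pointwise : ∀ {s} → s ∈ S → N s ⊙ 1 ≤ ∑ (Ω p) (λ t → (N s ∧ t ≈[ p ] s) ⊙ 1)
          pointwise {s} s∈ = ⊙-bound (N s) λ e →
            let (t , t∈ , t≈s) = Ω-covers p∈ s∈ (H⇒E (∧-left (H s p) e))
            in ≡-≤ (sym (cong (_⊙ 1) (∧-intro e t≈s)))
                (∑-member (λ t → (N s ∧ t ≈[ p ] s) ⊙ 1) t∈)
          per-class : ∀ t → θ * p ^ suc k * count S (λ s → N s ∧ t ≈[ p ] s) ≤ n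
          per-class t with 0 <? count S (λ s → N s ∧ t ≈[ p ] s)
          ... | no ¬pos = ≡-≤ (trans (cong (θ * p ^ suc k *_) (n≤0⇒n≡0 (≮⇒≥ ¬pos)))
              (*-zeroʳ (θ * p ^ suc k))) z≤n
          ... | yes pos with count-positive S _ pos
          ... | (s₀ , _ , both) = ≤-trans
            (*-monoʳ-≤ (θ * p ^ suc k) (∑-mono S (λ {s} _ → ⊙-mono _ _ (λ e →
              ∧-intro (∧-left (H s p) (∧-left (N s) e))
                (≈-trans p s t s₀ (≈-sym p t s (∧-right (N s) e)) (∧-right (N s₀) both))))))
            (<⇒≤ (≰⇒> (fails (n ≤? _) (not-true (∧-right (H s₀ p) (∧-left (N s₀) both))))))

        -- `meets` asks for a captured point in the fibre of t that is congruent to s. The own fibre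
        -- of s is excluded from `hit` because `separation` bounds the agreement of distinct labels
        -- only.
        meets hit : A → A → ℕ → Bool
        meets t s p = someᵇ (λ x → B (ψ t) x ∧ x ≈[ p ] s) (fib ψ (ψ t) S)
        hit t s p = not (ψ t == ψ s) ∧ meets t s p

        -- A popular class has at least n / (θ p ^ (k + 1)) points, while by `good-mass` a fibre
        -- holds at most (Λ / p) ^ k of its size in that class. So at least n / (θ Λ ^ k p) points
        -- lie in fibres that meet it. The factor 2 in `γ` pays for the own fibre of s, which is
        -- small as γ p ≤ K.
        hits-many : ∀ {s p} → p ∈ 𝒫 → E″ s p ≡ true → n ≤ c * p * count S (λ t → hit t s p)
        hits-many {s} {p} p∈ e = +-cancelʳ-≤ n n _ (begin
          n + n ≤⟨ +-mono-≤ one one ⟩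
          θ * p * (Λ ^ k * D) + θ * p * (Λ ^ k * D) ≤⟨ +-mono-≤ two two ⟩
          θ * p * (Λ ^ k * (X + F)) + θ * p * (Λ ^ k * (X + F)) ≡⟨ lemma₁ θ p (Λ ^ k) X F ⟩
          c * p * X + c * p * F ≤⟨ +-monoʳ-≤ (c * p * X) three ⟩
          c * p * X + n ∎)
          where
          open ≤-Reasoning
          C D X F : ℕ
          C = count S (λ t → H t p ∧ t ≈[ p ] s)
          D = count S (λ t → meets t s p)
          X = count S (λ t → hit t s p)
          F = count S (λ t → ψ t == ψ s)
          lemma₁ : ∀ h q l x f → h * q * (l * (x + f)) + h * q * (l * (x + f))
              ≡ 2 * (h * l) * q * x + 2 * (h * l) * q * f
          lemma₁ = solve-∀
          lemma₂ : ∀ h q r v → h * (q * r) * v ≡ h * q * (r * v)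
          lemma₂ = solve-∀
          fibre-step : ∀ y → ∑ (fib ψ y S) (λ t → p ^ k * (H t p ∧ t ≈[ p ] s) ⊙ 1)
              ≤ ∑ (fib ψ y S) (λ t → Λ ^ k * meets t s p ⊙ 1)
          fibre-step y with someᵇ (λ x → B y x ∧ x ≈[ p ] s) (fib ψ y S) in met | children y in eq
          ... | _ | inj₁ none = ≡-≤ (∑-empty _ none) z≤n
          ... | false | inj₂ br = ∑-mono (fib ψ y S) λ {t} t∈ →
                ≡-≤ (⊙-*ˡ (H t p ∧ t ≈[ p ] s) (p ^ k) 1) (⊙-bound (H t p ∧ t ≈[ p ] s) λ h →
                  contradiction (trans (sym (someᵇ⁺ _ t∈ (∧-intro
                    (trans (cong (λ v → B v t) (sym (proj₂ (∈-fibre⁻ ψ {y} {S} t∈)))) (∧-right (E′ t p) (∧-left (H t p) h)))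
                    (∧-right (H t p) h)))) met) (λ ()))
          ... | true | inj₂ br = begin
              ∑ T (λ t → p ^ k * (H t p ∧ t ≈[ p ] s) ⊙ 1) ≡⟨ ∑-*ˡ T (p ^ k) _ ⟨
              p ^ k * count T (λ t → H t p ∧ t ≈[ p ] s)
              ≤⟨ *-monoʳ-≤ (p ^ k) (∑-mono T (λ {t} t∈ → ⊙-mono _ _ (λ h → ∧-intro
              (trans (cong (λ v → goodᶜ v t p) (sym eq)) (E′⇒good y t∈ (∧-left (E′ t p) (∧-left (H t p) h))))
              (∧-right (H t p) h)))) ⟩
              p ^ k * count T (λ t → good br t p ∧ t ≈[ p ] s) ≤⟨ good-mass br p s ⟩
              Λ ^ k * length T ≡⟨ cong (Λ ^ k *_) (length-∑ T) ⟩
              Λ ^ k * ∑ T (λ _ → 1) ≡⟨ cong (Λ ^ k *_) (∑-cong T (λ t∈ → cong (_⊙ 1) (sym (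
              trans (cong (λ v → someᵇ (λ x → B v x ∧ x ≈[ p ] s) (fib ψ v S))
              (proj₂ (∈-fibre⁻ ψ {y} {S} t∈))) met)))) ⟩
              Λ ^ k * count T (λ t → meets t s p) ≡⟨ ∑-*ˡ T (Λ ^ k) _ ⟩
              ∑ T (λ t → Λ ^ k * meets t s p ⊙ 1) ∎
              where
              T = fib ψ y S
          one : n ≤ θ * p * (Λ ^ k * D)
          one = begin
            n ≤⟨ holds (n ≤? _) (∧-right (H s p) e) ⟩
            θ * p ^ suc k * C ≡⟨ lemma₂ θ p (p ^ k) C ⟩
            θ * p * (p ^ k * C) ≤⟨ *-monoʳ-≤ (θ * p) (subst₂ _≤_ (sym (∑-*ˡ S (p ^ k) _)) (sym (∑-*ˡ S (Λ ^ k) _))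
                (∑-fibrewise ψ S fibre-step)) ⟩
            θ * p * (Λ ^ k * D) ∎
          two : θ * p * (Λ ^ k * D) ≤ θ * p * (Λ ^ k * (X + F))
          two = *-monoʳ-≤ (θ * p) (*-monoʳ-≤ (Λ ^ k) (≤-≡ (∑-mono S (λ {t} _ → split (ψ t == ψ s) (meets t s p)))
                  (∑-+ S _ _)))
            where
            split : ∀ x y → y ⊙ 1 ≤ (not x ∧ y) ⊙ 1 + x ⊙ 1
            split true true = ≤-refl
            split true false = z≤n
            split false y = m≤m+n _ _
          three : c * p * F ≤ n
          three = ≤-trans (*-monoˡ-≤ F (γp≤K p∈)) (subst (λ v → K * v ≤ n) (length-filterᵇ S _) (light (ψ s)))

        reached : List A → A → ℕ → Bool
        reached ts s p = someᵇ (λ t → hit t s p) ts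

        -- Measured in `w`, that is in log p, because it is compared with the size of polynomial
        -- values. `weight` is measured in `u`, that is in log p / p, because p is hit with
        -- frequency about 1 / p.
        covered : List A → A → ℕ
        covered ts s = ∑ 𝒫 (λ p → (E″ s p ∧ reached ts s p) ⊙ w p)

        rich active : List A → A → Bool
        rich ts s = does (τ ≤? weight (E″ s))
        active ts s = rich ts s ∧ does (covered ts s <? M * ℓ)

        cap : ℕ
        cap = (M + 1) * ℓ

        -- Truncation bounds the potential by n (M + 1) ℓ and hence the number of greedy steps. It
        -- costs an active point nothing: such a point is below M ℓ and gains at most ℓ at a time.
        potential : List A → ℕ
        potential ts = ∑ S (λ s → covered ts s ⊓ cap)

        gain : List A → A → A → ℕ
        gain ts t s = ∑ 𝒫 (λ p → (E″ s p ∧ (not (reached ts s p) ∧ hit t s p)) ⊙ w p)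

        covered-∷ : ∀ ts t s → covered (t ∷ ts) s ≡ covered ts s + gain ts t s
        covered-∷ ts t s = trans (∑-cong 𝒫 (λ {p} _ → lemma (E″ s p) (hit t s p) (reached ts s p) (w p))) (∑-+ 𝒫 _ _)
          where
          lemma : ∀ x y v m → (x ∧ (y ∨ v)) ⊙ m ≡ (x ∧ v) ⊙ m + (x ∧ (not v ∧ y)) ⊙ m
          lemma false y v m = refl
          lemma true true true m = sym (+-identityʳ m)
          lemma true true false m = refl
          lemma true false true m = sym (+-identityʳ m)
          lemma true false false m = refl

        -- A hit modulo p makes the distinct labels `ψ t` and `ψ s` agree modulo p, so `separation`
        -- applies.
        gain≤ℓ : ∀ ts t s → gain ts t s ≤ ℓ
        gain≤ℓ ts t s with ψ t ≟ ψ s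
        ... | yes _ = ≡-≤ (trans (∑-cong 𝒫 (λ {p} _ → lemma (E″ s p) (reached ts s p) (w p))) (∑-zero 𝒫)) z≤n
          where
          lemma : ∀ x y m → (x ∧ (not y ∧ false)) ⊙ m ≡ 0
          lemma false y m = refl
          lemma true true m = refl
          lemma true false m = refl
        ... | no ψt≢ψs = ≤-trans (∑-mono 𝒫 (λ {p} _ → ⊙-mono _ _ (λ e → same p (∧-right _ (∧-right (E″ s p) e)))))
                           (separation ψt≢ψs)
          where
          same : ∀ p → meets t s p ≡ true → ψ t ≈[ p ] ψ s ≡ true
          same p m with someᵇ⁻ _ m
          ... | (x , x∈ , h) = trans (cong (λ v → v ≈[ p ] ψ s) (sym (proj₂ (∈-fibre⁻ ψ {ψ t} {S} x∈))))
              (≈⁺ (compat (≈⁻ {p} {x} {s} (∧-right (B (ψ t) x) h))))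

        potential-grows : ∀ ts t → potential ts + ∑ S (λ s → active ts s ⊙ gain ts t s) ≤ potential (t ∷ ts)
        potential-grows ts t = ≡-≤ (sym (∑-+ S _ _)) (∑-mono S (λ {s} _ →
          subst (λ v → covered ts s ⊓ cap + active ts s ⊙ gain ts t s ≤ v ⊓ cap) (sym (covered-∷ ts t s)) (pointwise s)))
          where
          pointwise : ∀ s → covered ts s ⊓ cap + active ts s ⊙ gain ts t s ≤ (covered ts s + gain ts t s) ⊓ cap
          pointwise s with active ts s in eq
          ... | false = ≡-≤ (+-identityʳ _) (⊓-monoˡ-≤ cap (m≤m+n (covered ts s) _))
          ... | true = ≤-trans (+-monoˡ-≤ (gain ts t s) (m⊓n≤m (covered ts s) cap)) (⊓-glb ≤-refl
              (≤-≡ (+-mono-≤ (<⇒≤ (holds (covered ts s <? M * ℓ) (∧-right (rich ts s) eq))) (gain≤ℓ ts t s))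
                (lemma M ℓ)))
              where
              lemma : ∀ x y → x * y + y ≡ (x + 1) * y
              lemma = solve-∀

        -- A point that is still active has most of its primes unreached, and each of them is hit often.
        active-gain : ∀ ts {s} → s ∈ S → active ts s ≡ true → n * ℓ ≤ 2 * c * δ * ∑ S (λ t → gain ts t s)
        active-gain ts {s} s∈ act = *-cancelˡ-≤ Π {{>-nonZero Π-positive}} (begin
          Π * (n * ℓ) ≡⟨ *-swap Π n ℓ ⟩
          n * (Π * ℓ) ≤⟨ *-monoʳ-≤ n (≤-trans Πℓ≤δτ₀ (*-monoʳ-≤ δ τ₀≤τ)) ⟩
          n * (δ * τ) ≤⟨ *-monoʳ-≤ n (*-monoʳ-≤ δ τ≤2Unc) ⟩
          n * (δ * (2 * Unc)) ≡⟨ lemma₂ n δ Unc ⟩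
          2 * δ * (n * Unc) ≤⟨ *-monoʳ-≤ (2 * δ) unreached-gain ⟩
          2 * δ * (c * Π * X) ≡⟨ lemma₃ δ c Π X ⟩
          Π * (2 * c * δ * X) ∎)
          where
          open ≤-Reasoning
          Cov Unc X : ℕ
          Cov = weight (λ p → E″ s p ∧ reached ts s p)
          Unc = weight (λ p → E″ s p ∧ not (reached ts s p))
          X = ∑ S (λ t → gain ts t s)
          lemma₂ : ∀ x y v → x * (y * (2 * v)) ≡ 2 * y * (x * v)
          lemma₂ = solve-∀
          lemma₃ : ∀ x y v m → 2 * x * (y * v * m) ≡ v * (2 * y * x * m)
          lemma₃ = solve-∀
          lemma₄ : ∀ x y v → x * y * v ≡ v * y * x
          lemma₄ = solve-∀
          τ≤ : τ ≤ Cov + Unc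
          τ≤ = ≤-≡ (holds (τ ≤? _) (∧-left (rich ts s) act)) (weight-split (E″ s) (reached ts s))
          -- Here the primes have to be large: since p ≥ 2 M δ, reached primes weighing less than M
          -- ℓ in `w` weigh at most τ / 2 in `u`.
          2Cov≤τ : 2 * Cov ≤ τ
          2Cov≤τ = *-cancelˡ-≤ (M * δ) {{>-nonZero (*-mono-< M-positive δ-positive)}} (begin
            M * δ * (2 * Cov) ≡⟨ rearr (M * δ) Cov ⟩
            2 * (M * δ) * Cov ≡⟨ ∑-*ˡ 𝒫 (2 * (M * δ)) _ ⟩
            ∑ 𝒫 (λ p → 2 * (M * δ) * (E″ s p ∧ reached ts s p) ⊙ u p) ≤⟨ ∑-mono 𝒫 (λ {p} p∈ → pt (E″ s p ∧ reached ts s p) p∈) ⟩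
            ∑ 𝒫 (λ p → Π * (E″ s p ∧ reached ts s p) ⊙ w p) ≡⟨ ∑-*ˡ 𝒫 Π _ ⟨
            Π * covered ts s ≤⟨ *-monoʳ-≤ Π (<⇒≤ (holds (covered ts s <? M * ℓ) (∧-right (rich ts s) act))) ⟩
            Π * (M * ℓ) ≡⟨ *-swap Π M ℓ ⟩
            M * (Π * ℓ) ≤⟨ *-monoʳ-≤ M (≤-trans Πℓ≤δτ₀ (*-monoʳ-≤ δ τ₀≤τ)) ⟩
            M * (δ * τ) ≡⟨ *-assoc M δ τ ⟨
            M * δ * τ ∎)
            where
            rearr : ∀ x y → x * (2 * y) ≡ 2 * x * y
            rearr = solve-∀
            pt : ∀ v {p} → p ∈ 𝒫 → 2 * (M * δ) * v ⊙ u p ≤ Π * v ⊙ w p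
            pt false p∈ = *0≤ (2 * (M * δ))
            pt true {p} p∈ = ≤-≡ (*-monoˡ-≤ (u p) (𝒫-large p∈)) (scale p∈)
          τ≤2Unc : τ ≤ 2 * Unc
          τ≤2Unc = +-cancelˡ-≤ (2 * Cov) _ _ (begin
            2 * Cov + τ ≤⟨ +-monoˡ-≤ τ 2Cov≤τ ⟩
            τ + τ ≤⟨ +-mono-≤ τ≤ τ≤ ⟩
            Cov + Unc + (Cov + Unc) ≡⟨ rearr Cov Unc ⟩
            2 * Cov + 2 * Unc ∎)
            where
            rearr : ∀ x y → x + y + (x + y) ≡ 2 * x + 2 * y
            rearr = solve-∀
          unreached-gain : n * Unc ≤ c * Π * X
          unreached-gain = begin
            n * Unc ≡⟨ ∑-*ˡ 𝒫 n _ ⟩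
            ∑ 𝒫 (λ p → n * (E″ s p ∧ not (reached ts s p)) ⊙ u p) ≤⟨ ∑-mono 𝒫 pt ⟩
            ∑ 𝒫 (λ p → c * Π * ∑ S (λ t → (E″ s p ∧ (not (reached ts s p) ∧ hit t s p)) ⊙ w p)) ≡⟨ ∑-*ˡ 𝒫 (c * Π) _ ⟨
            c * Π * ∑ 𝒫 (λ p → ∑ S (λ t → (E″ s p ∧ (not (reached ts s p) ∧ hit t s p)) ⊙ w p)) ≡⟨ cong (c * Π *_) (∑-swap 𝒫 S _) ⟩
            c * Π * X ∎
            where
            pt : ∀ {p} → p ∈ 𝒫 → n * (E″ s p ∧ not (reached ts s p)) ⊙ u p
                ≤ c * Π * ∑ S (λ t → (E″ s p ∧ (not (reached ts s p) ∧ hit t s p)) ⊙ w p)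
            pt {p} p∈ with E″ s p in e | reached ts s p
            ... | false | _ = *0≤ n
            ... | true | true = *0≤ n
            ... | true | false = begin
              n * u p ≤⟨ *-monoˡ-≤ (u p) (hits-many p∈ e) ⟩
              c * p * Y * u p ≡⟨ l₁ c p Y (u p) ⟩
              c * (p * u p) * Y ≡⟨ cong (λ v → c * v * Y) (scale p∈) ⟩
              c * (Π * w p) * Y ≡⟨ l₂ c Π (w p) Y ⟩
              c * Π * (w p * Y) ≡⟨ cong (c * Π *_) (∑-*ˡ S (w p) _) ⟩
              c * Π * ∑ S (λ t → w p * hit t s p ⊙ 1) ≡⟨ cong (c * Π *_) (∑-cong S (λ {t} _ →
                  trans (⊙-*ˡ (hit t s p) (w p) 1) (cong (hit t s p ⊙_) (*-identityʳ (w p))))) ⟩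
              c * Π * ∑ S (λ t → hit t s p ⊙ w p) ∎
              where
              Y = count S (λ t → hit t s p)
              l₁ : ∀ x y v m → x * y * v * m ≡ x * (y * m) * v
              l₁ = solve-∀
              l₂ : ∀ x y v m → x * (y * v) * m ≡ x * y * (v * m)
              l₂ = solve-∀

        -- Averaging over t in S: more than n / z active points, each gaining n ℓ / (2 c δ) in total
        -- over all t, give some t with a gain of at least n ℓ / Q.
        improve : ∀ ts → n < z * count S (active ts) →
            ∃[ t ] (t ∈ S × n * ℓ + Q k α * potential ts ≤ Q k α * potential (t ∷ ts))
        improve ts many = let (t , t∈ , le) = ∑-average S (λ t → Q k α * total t) (n * ℓ) n-positive averaged in
          t , t∈ , ≤-trans (+-monoˡ-≤ _ le) (≡-≤ (trans (+-comm (Q k α * total t) _)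
            (sym (*-distribˡ-+ (Q k α) (potential ts) (total t)))) (*-monoʳ-≤ (Q k α) (potential-grows ts t)))
          where
          open ≤-Reasoning
          total : A → ℕ
          total t = ∑ S (λ s → active ts s ⊙ gain ts t s)
          n-positive : 0 < n
          n-positive = ≤-trans (positiveʳ z many) (count≤length S (active ts))
          averaged : n * (n * ℓ) ≤ ∑ S (λ t → Q k α * total t)
          averaged = begin
            n * (n * ℓ) ≤⟨ *-monoˡ-≤ (n * ℓ) (<⇒≤ many) ⟩
            z * count S (active ts) * (n * ℓ) ≡⟨ *-assoc z _ _ ⟩
            z * (count S (active ts) * (n * ℓ)) ≡⟨ cong (z *_) (∑-*ʳ S (n * ℓ) _) ⟩
            z * ∑ S (λ s → active ts s ⊙ 1 * (n * ℓ)) ≤⟨ *-monoʳ-≤ z (∑-mono S pt) ⟩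
            z * ∑ S (λ s → 2 * c * δ * ∑ S (λ t → active ts s ⊙ gain ts t s)) ≡⟨ cong (z *_) (∑-*ˡ S (2 * c * δ) _) ⟨
            z * (2 * c * δ * ∑ S (λ s → ∑ S (λ t → active ts s ⊙ gain ts t s)))
                ≡⟨ cong (λ v → z * (2 * c * δ * v)) (∑-swap S S _) ⟩
            z * (2 * c * δ * ∑ S total) ≡⟨ *-swap-assoc z (2 * c * δ) (∑ S total) ⟩
            Q k α * ∑ S total ≡⟨ ∑-*ˡ S (Q k α) total ⟩
            ∑ S (λ t → Q k α * total t) ∎
            where
            pt : ∀ {s} → s ∈ S → active ts s ⊙ 1 * (n * ℓ) ≤ 2 * c * δ * ∑ S (λ t → active ts s ⊙ gain ts t s)
            pt {s} s∈ with active ts s in act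
            ... | false = z≤n
            ... | true = ≡-≤ (*-identityˡ (n * ℓ)) (active-gain ts s∈ act)

        length-bound : ∀ ts → length ts * (n * ℓ) ≤ Q k α * potential ts → 0 < n → length ts ≤ Q k α * (M + 1)
        length-bound ts inv n-positive = *-cancelʳ-≤ _ _ (n * ℓ) {{>-nonZero (*-mono-< n-positive ℓ-positive)}} (begin
          length ts * (n * ℓ) ≤⟨ inv ⟩
          Q k α * potential ts ≤⟨ *-monoʳ-≤ (Q k α) (∑-≤-const S cap (λ {s} _ → m⊓n≤n (covered ts s) cap)) ⟩
          Q k α * (n * ((M + 1) * ℓ)) ≡⟨ lemma (Q k α) n (M + 1) ℓ ⟩
          Q k α * (M + 1) * (n * ℓ) ∎)
          where
          open ≤-Reasoning
          lemma : ∀ x y v m → x * (y * (v * m)) ≡ x * v * (y * m)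
          lemma = solve-∀

        Saturated : Set
        Saturated = ∃[ ts ] (length ts ≤ Q k α * (M + 1) × z * count S (active ts) ≤ n)

        greedy : ∀ fuel ts → length ts ≤ Q k α * (M + 1) → length ts + fuel ≡ Q k α * (M + 1) →
            length ts * (n * ℓ) ≤ Q k α * potential ts → Saturated
        greedy fuel ts short budget inv = decide (z * count S (active ts) ≤? n)
          where
          continue : ∀ fuel → length ts + fuel ≡ Q k α * (M + 1) →
              (∃[ t ] (t ∈ S × n * ℓ + Q k α * potential ts ≤ Q k α * potential (t ∷ ts))) → Saturated
          continue fuel budget (t , t∈ , le) = next fuel budget
            where
            inv′ : length (t ∷ ts) * (n * ℓ) ≤ Q k α * potential (t ∷ ts)
            inv′ = ≤-trans (+-monoʳ-≤ (n * ℓ) inv) le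
            short′ : length (t ∷ ts) ≤ Q k α * (M + 1)
            short′ = length-bound (t ∷ ts) inv′ (>-nonZero⁻¹ n {{∈⇒nonZero t∈}})
            next : ∀ fuel → length ts + fuel ≡ Q k α * (M + 1) → Saturated
            -- With the fuel used up, `ts` has already reached the maximal length, so the longer
            -- list contradicts `length-bound`.
            next zero budget = contradiction short′ (<⇒≱ (≤-reflexive (cong suc (trans (sym budget) (+-identityʳ _)))))
            next (suc f) budget = greedy f (t ∷ ts) short′ (trans (sym (+-suc (length ts) f)) budget) inv′
          decide : Dec (z * count S (active ts) ≤ n) → Saturated
          decide (yes few) = ts , short , few
          decide (no many) = continue fuel budget (improve ts (≰⇒> many))

        saturated : Saturated
        saturated = greedy (Q k α * (M + 1)) [] z≤n refl z≤n

        generatorsOf : List A → List A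
        generatorsOf = concatMap (λ t → generators (child (ψ t)))

        generatorsOf-few : ∀ ts → length (generatorsOf ts) ≤ length ts * (cst k b * (M + 1) ^ k)
        generatorsOf-few [] = z≤n
        generatorsOf-few (t ∷ ts) = ≡-≤ (length-++ (generators (child (ψ t))))
          (+-mono-≤ (generators-few (child (ψ t))) (generatorsOf-few ts))

        generatorsOf-∈ : ∀ {ts t x} → t ∈ ts → x ∈ generators (child (ψ t)) → x ∈ generatorsOf ts
        generatorsOf-∈ (here refl) x∈ = ∈-++⁺ˡ x∈
        generatorsOf-∈ {t′ ∷ _} (there t∈) x∈ = ∈-++⁺ʳ (generators (child (ψ t′))) (generatorsOf-∈ t∈ x∈)

        module WithSlices (ts : List A) (short : length ts ≤ Q k α * (M + 1)) (few : z * count S (active ts) ≤ n) where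

          keep : A → Bool
          keep s = not (does (covered ts s <? M * ℓ))

          -- By induction V contains the captured points of the chosen fibres. A kept point agrees
          -- with such points modulo primes of weight at least M ℓ, which is what `Closed` asks for.
          forced-step : ∀ {V} → Closed class 𝒫 w (M * ℓ) V → (∀ {x} → x ∈ generatorsOf ts → V x) →
              ∀ {x} → x ∈ S → keep x ≡ true → V x
          forced-step {V} closed vanish {s} s∈ kp = closed (λ p → E″ s p ∧ reached ts s p) witness
              (≮⇒≥ (fails (covered ts s <? M * ℓ) (not-true kp)))
            where
            witness : ∀ {p} → p ∈ 𝒫 → E″ s p ∧ reached ts s p ≡ true → ∃[ x ] (V x × class p x ≡ class p s)
            witness {p} p∈ e with someᵇ⁻ (λ t → hit t s p) {ts} (∧-right (E″ s p) e)
            ... | (t , t∈ , h) with someᵇ⁻ _ (∧-right (not (ψ t == ψ s)) h)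
            ... | (x , x∈ , bx) = x ,
              forced (child (ψ t)) closed (λ g∈ → vanish (generatorsOf-∈ {ts} t∈ g∈)) x∈ (∧-left (B (ψ t) x) bx) ,
              ≈⁻ {p} {x} {s} (∧-right (B (ψ t) x) bx)

          -- A point rich in usable primes is lost for one of four reasons: `bad`, `missed` in its
          -- own fibre, `dull`, or still active. In units of n / z they cost 1, 3 k, 1 and 1.
          few-lost-step : z * count S (λ s → not (keep s) ∧ does (3 ^ suc k * τ₀ ≤? weight (E s))) ≤ 3 * suc k * n
          few-lost-step = begin
            z * count S lost
              ≤⟨ *-monoʳ-≤ z (∑-mono S (λ {s} _ → cover s)) ⟩
            z * ∑ S (λ s → bad s ⊙ 1 + (missed s ⊙ 1 + (dull s ⊙ 1 + active ts s ⊙ 1)))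
              ≡⟨ cong (z *_) (trans (∑-+ S _ _) (cong (count S bad +_) (trans (∑-+ S _ _) (cong (count S missed +_) (∑-+ S _ _))))) ⟩
            z * (count S bad + (count S missed + (count S dull + count S (active ts))))
              ≡⟨ lemma z (count S bad) (count S missed) (count S dull) (count S (active ts)) ⟩
            z * count S bad + (z * count S missed + (z * count S dull + z * count S (active ts)))
              ≤⟨ +-mono-≤ bad-few (+-mono-≤ missed-few (+-mono-≤ dull-few few)) ⟩
            n + (3 * k * n + (n + n)) ≡⟨ lemma′ k n ⟩
            3 * suc k * n ∎
            where
            open ≤-Reasoning
            lost bad missed dull : A → Bool
            lost s = not (keep s) ∧ does (3 ^ suc k * τ₀ ≤? weight (E s))
            bad s = does (τ ≤? weight (λ p → E s p ∧ not (okay (ψ s) p)))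
            missed s = not (B (ψ s) s) ∧ does (τ ≤? weight (E′ s))
            dull s = does (τ ≤? weight (λ p → H s p ∧ not (popular s p)))
            lemma : ∀ x y v m q → x * (y + (v + (m + q))) ≡ x * y + (x * v + (x * m + x * q))
            lemma = solve-∀
            lemma′ : ∀ k n → n + (3 * k * n + (n + n)) ≡ 3 * suc k * n
            lemma′ = solve-∀
            3τ : ∀ x t → 3 * x * t ≡ x * t + (x * t + x * t)
            3τ = solve-∀
            τ-positive : 0 < τ
            τ-positive = ≤-trans τ₀-positive τ₀≤τ

            cover : ∀ s → lost s ⊙ 1 ≤ bad s ⊙ 1 + (missed s ⊙ 1 + (dull s ⊙ 1 + active ts s ⊙ 1))
            cover s = one-of (lost s) (bad s) (missed s) (dull s) (active ts s) λ l ¬bad ¬missed ¬dull →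
              let E-rich = holds (3 ^ suc k * τ₀ ≤? _) (∧-right (not (keep s)) l)
                  bad<τ = ≰⇒> (fails (τ ≤? _) ¬bad)
                  dull<τ = ≰⇒> (fails (τ ≤? _) ¬dull)
                  E′-rich : τ + τ ≤ weight (E′ s)
                  E′-rich = +-cancelʳ-≤ τ _ _ (begin
                    τ + τ + τ ≡⟨ +-assoc τ τ τ ⟩
                    τ + (τ + τ) ≡⟨ 3τ (3 ^ k) τ₀ ⟨
                    3 ^ suc k * τ₀ ≤⟨ E-rich ⟩
                    weight (E s) ≡⟨ weight-split (E s) (okay (ψ s)) ⟩
                    weight (E′ s) + _ ≤⟨ +-monoʳ-≤ (weight (E′ s)) (<⇒≤ bad<τ) ⟩
                    weight (E′ s) + τ ∎)
                  in-child : B (ψ s) s ≡ true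
                  in-child = not-both (B (ψ s) s) ¬missed (dec-true (τ ≤? _) (≤-trans (m≤m+n τ τ) E′-rich))
                  E″-rich : τ ≤ weight (E″ s)
                  E″-rich = +-cancelʳ-≤ τ _ _ (begin
                    τ + τ ≤⟨ E′-rich ⟩
                    weight (E′ s) ≡⟨ ∑-cong 𝒫 (λ {p} _ → cong (_⊙ u p) (sym (∧-true (E′ s p) in-child))) ⟩
                    weight (H s) ≡⟨ weight-split (H s) (popular s) ⟩
                    weight (E″ s) + _ ≤⟨ +-monoʳ-≤ (weight (E″ s)) (<⇒≤ dull<τ) ⟩
                    weight (E″ s) + τ ∎)
              in ∧-intro (dec-true (τ ≤? _) E″-rich) (not-false (not-true (∧-left (not (keep s)) l)))
              where
              one-of : ∀ l a b c d → (l ≡ true → a ≡ false → b ≡ false → c ≡ false → d ≡ true) →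
                  l ⊙ 1 ≤ a ⊙ 1 + (b ⊙ 1 + (c ⊙ 1 + d ⊙ 1))
              one-of false a b c d h = z≤n
              one-of true true b c d h = s≤s z≤n
              one-of true false true c d h = s≤s z≤n
              one-of true false false true d h = s≤s z≤n
              one-of true false false false d h rewrite h refl refl refl refl = ≤-refl
              not-both : ∀ x {y} → not x ∧ y ≡ false → y ≡ true → x ≡ true
              not-both true _ _ = refl
              not-both false {true} () _

            -- Exchange the sums over points and primes. With a proportion 1 / (z σ) for each prime
            -- and total prime weight at most σ τ, the sum of the weights is at most n τ / z, so at
            -- most n / z points reach τ.
            markov : ∀ (F : A → ℕ → Bool) ζ → 0 < ζ →
                (∀ {p} → p ∈ 𝒫 → z * σ * ζ * count S (λ s → F s p) ≤ ζ * n) →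
                z * count S (λ s → does (τ ≤? weight (F s))) ≤ n
            markov F ζ ζ-positive h = *-cancelˡ-≤ (σ * τ) {{>-nonZero (*-mono-< σ-positive τ-positive)}} (begin
              σ * τ * (z * count S rich′) ≡⟨ l₁ σ τ z (count S rich′) ⟩
              z * σ * (τ * count S rich′) ≡⟨ cong (z * σ *_) (∑-*ˡ S τ _) ⟩
              z * σ * ∑ S (λ s → τ * rich′ s ⊙ 1) ≤⟨ *-monoʳ-≤ (z * σ) (∑-mono S (λ {s} _ → pt s)) ⟩
              z * σ * ∑ S (λ s → weight (F s)) ≡⟨ cong (z * σ *_) (∑-swap S 𝒫 _) ⟩
              z * σ * ∑ 𝒫 (λ p → ∑ S (λ s → F s p ⊙ u p)) ≡⟨ ∑-*ˡ 𝒫 (z * σ) _ ⟩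
              ∑ 𝒫 (λ p → z * σ * ∑ S (λ s → F s p ⊙ u p)) ≤⟨ ∑-mono 𝒫 (λ {p} p∈ → per-prime p p∈) ⟩
              ∑ 𝒫 (λ p → u p * n) ≡⟨ ∑-*ʳ 𝒫 n u ⟨
              ∑ 𝒫 u * n ≤⟨ *-monoˡ-≤ n (≤-trans total≤στ₀ (*-monoʳ-≤ σ τ₀≤τ)) ⟩
              σ * τ * n ∎)
              where
              rich′ : A → Bool
              rich′ s = does (τ ≤? weight (F s))
              l₁ : ∀ x y v m → x * y * (v * m) ≡ v * x * (y * m)
              l₁ = solve-∀
              pt : ∀ s → τ * rich′ s ⊙ 1 ≤ weight (F s)
              pt s with rich′ s in eq
              ... | true = ≡-≤ (*-identityʳ τ) (holds (τ ≤? _) eq)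
              ... | false = *0≤ τ
              per-prime : ∀ p → p ∈ 𝒫 → z * σ * ∑ S (λ s → F s p ⊙ u p) ≤ u p * n
              per-prime p p∈ = begin
                z * σ * ∑ S (λ s → F s p ⊙ u p) ≡⟨ cong (z * σ *_) (trans (∑-cong S (λ {s} _ →
                    trans (cong (F s p ⊙_) (sym (*-identityʳ (u p)))) (sym (⊙-*ˡ (F s p) (u p) 1)))) (sym (∑-*ˡ S (u p) _))) ⟩
                z * σ * (u p * count S (λ s → F s p)) ≡⟨ *-swap (z * σ) (u p) _ ⟩
                u p * (z * σ * count S (λ s → F s p)) ≤⟨ *-monoʳ-≤ (u p) (*-cancelˡ-≤ ζ {{>-nonZero ζ-positive}}
                    (≡-≤ (*-swap-assoc ζ (z * σ) _) (h p∈))) ⟩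
                u p * n ∎

            bad-few : z * count S bad ≤ n
            bad-few = markov (λ s p → E s p ∧ not (okay (ψ s) p)) (Λ * α) (*-mono-< Λ-positive α-positive)
              (λ p∈ → ≤-≡ (bad-mass p∈) (*-swap-assoc α Λ n))

            dull-few : z * count S dull ≤ n
            dull-few = markov (λ s p → H s p ∧ not (popular s p)) α α-positive unpopular-mass

            missed-few : z * count S missed ≤ 3 * k * n
            missed-few = subst₂ _≤_ (sym (∑-*ˡ S z _)) (trans (∑-const S (3 * k)) (*-comm n (3 * k)))
              (∑-fibrewise ψ S λ y → begin
                ∑ (fib ψ y S) (λ s → z * missed s ⊙ 1) ≡⟨ ∑-*ˡ (fib ψ y S) z _ ⟨
                z * count (fib ψ y S) missed
                  ≡⟨ cong (z *_) (∑-cong (fib ψ y S) (λ {s} s∈ →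
                       cong (λ v → (not (B v s) ∧ does (τ ≤? weight (E′ s))) ⊙ 1) (proj₂ (∈-fibre⁻ ψ {y} {S} s∈)))) ⟩
                z * count (fib ψ y S) (λ s → not (B y s) ∧ does (τ ≤? weight (E′ s))) ≤⟨ few-lost (child y) ⟩
                3 * k * length (fib ψ y S) ≡⟨ *-comm (3 * k) _ ⟩
                length (fib ψ y S) * (3 * k) ≡⟨ ∑-const (fib ψ y S) (3 * k) ⟨
                ∑ (fib ψ y S) (λ _ → 3 * k) ∎)

          captured-by : Captured (cst (suc k) α * (M + 1) ^ suc k) (3 * suc k) (3 ^ suc k * τ₀) S E
          captured-by = record
            { generators = generatorsOf ts
            ; kept = keep
            ; generators-few = begin
                length (generatorsOf ts) ≤⟨ generatorsOf-few ts ⟩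
                length ts * (cst k b * (M + 1) ^ k) ≤⟨ *-monoˡ-≤ _ (≤-trans short (*-monoˡ-≤ (M + 1) (m≤m+n (Q k α) 1))) ⟩
                (Q k α + 1) * (M + 1) * (cst k b * (M + 1) ^ k) ≡⟨ *-interchange (Q k α + 1) (M + 1) (cst k b) ((M + 1) ^ k) ⟩
                cst (suc k) α * (M + 1) ^ suc k ∎
            ; forced = forced-step
            ; few-lost = few-lost-step
            }
            where
            open ≤-Reasoning

        captured : Captured (cst (suc k) α * (M + 1) ^ suc k) (3 * suc k) (3 ^ suc k * τ₀) S E
        captured = let (ts , short , few) = saturated in WithSlices.captured-by ts short few

    capture : ∀ {k S} (br : Branching k S) α → 0 < α → (E : A → ℕ → Bool) (Ω : ℕ → List A) →
      (∀ {s p} → s ∈ S → E s p ≡ true → good br s p ≡ true) →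
      (∀ {p} → p ∈ 𝒫 → length (Ω p) ≤ α * p ^ k) →
      (∀ {p s} → p ∈ 𝒫 → s ∈ S → E s p ≡ true → ∃[ t ] (t ∈ Ω p × t ≈[ p ] s ≡ true)) →
      (∀ {p} → p ∈ 𝒫 → cst k α * p ≤ K) →
      Captured (cst k α * (M + 1) ^ k) (3 * k) (3 ^ k * τ₀) S E
    capture (leaf s) α _ E Ω _ _ _ _ = record
      { generators = s ∷ []
      ; kept = λ _ → true
      ; generators-few = ≤-refl
      ; forced = λ _ vanish x∈ _ → vanish x∈
      ; few-lost = ≤-reflexive (*-zeroʳ z)
      }
    capture (node {k} {S} ψ compat light children) α α-positive E Ω E⇒good Ω-few Ω-covers K-large =
      WithChildren.captured child
      where
      open Step ψ compat light children α α-positive E Ω E⇒good Ω-few Ω-covers K-large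
      -- Stated for an arbitrary list T, so that an empty fibre can be replaced by `[]`.
      descend : ∀ {T} (c : T ≡ [] ⊎ Branching k T) (Ω″ : ℕ → List A) →
        (∀ {s p} → s ∈ T → E′ s p ≡ true → goodᶜ c s p ≡ true) →
        (∀ {p} → p ∈ 𝒫 → length (Ω″ p) ≤ β α * p ^ k) →
        (∀ {p s} → p ∈ 𝒫 → s ∈ T → E′ s p ≡ true → ∃[ t ] (t ∈ Ω″ p × t ≈[ p ] s ≡ true)) →
        Captured (cst k (β α) * (M + 1) ^ k) (3 * k) (3 ^ k * τ₀) T E′
      descend (inj₁ refl) _ _ _ _ = record
        { generators = []
        ; kept = λ _ → true
        ; generators-few = z≤n
        ; forced = λ { _ _ () }
        ; few-lost = *0≤ z
        }
      descend (inj₂ br) Ω″ good′ few covers =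
        capture br (β α) (*-mono-< (*-mono-< z-positive σ-positive) (*-mono-< Λ-positive α-positive))
          E′ Ω″ good′ few covers cst-child
      child : ∀ y → Captured (cst k (β α) * (M + 1) ^ k) (3 * k) (3 ^ k * τ₀) (fib ψ y S) E′
      child y = descend (children y) (Ω′ y) (E′⇒good y) (Ω′-few y) (Ω′-covers y)

    -- The choice of Λ limits the loss of good primes at every point to `τ₀`. The total weight is at
    -- least twice 3 ^ (k + 1) `τ₀`, so every point stays rich. The choice z = 6 (k + 1) turns the
    -- loss 3 (k + 1) / z into one half.
    capture-half : ∀ {k T} (br : Branching (suc k) T) α → 0 < α → (Ω : ℕ → List A) →
      z ≡ 6 * suc k → Λ ≡ 2 * suc k * δ → 2 * 3 ^ suc k * τ₀ ≤ ∑ 𝒫 u →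
      (∀ {p} → p ∈ 𝒫 → length (Ω p) ≤ α * p ^ suc k) →
      (∀ {p s} → p ∈ 𝒫 → s ∈ T → ∃[ t ] (t ∈ Ω p × class p t ≡ class p s)) →
      (∀ {p} → p ∈ 𝒫 → cst (suc k) α * p ≤ K) →
      ∃[ G ] ∃[ keep ] (length G ≤ cst (suc k) α * (M + 1) ^ suc k ×
        (∀ {V} → Closed class 𝒫 w (M * ℓ) V → (∀ {x} → x ∈ G → V x) → ∀ {x} → x ∈ T → keep x ≡ true → V x) ×
        length T ≤ 2 * count T keep)
    capture-half {k} {T} br α α-positive Ω refl refl total-large Ω-few Ω-covers K-large =
      generators C , kept C , generators-few C , forced C , half
      where
      open ≤-Reasoning
      C : Captured (cst (suc k) α * (M + 1) ^ suc k) (3 * suc k) (3 ^ suc k * τ₀) T (good br)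
      C = capture br α α-positive (good br) Ω (λ _ e → e) Ω-few
        (λ {p} {s} p∈ s∈ _ → let (t , t∈ , eq) = Ω-covers p∈ s∈ in t , t∈ , ≈⁺ {p} {t} {s} eq) K-large
      lemma : ∀ k v → 2 * k * v ≡ k * (2 * v)
      lemma = solve-∀
      loss≤τ₀ : ∀ {s} → s ∈ T → ∑ 𝒫 (λ p → not (good br s p) ⊙ u p) ≤ τ₀
      loss≤τ₀ s∈ = *-cancelˡ-≤ Λ {{>-nonZero Λ-positive}} (≤-trans (good-loss br s∈) (≤-trans
        (*-monoʳ-≤ (suc k) (*-monoʳ-≤ 2 Πℓ≤δτ₀)) (≤-reflexive (trans (sym (lemma (suc k) (δ * τ₀))) (sym (*-assoc (2 * suc k) δ τ₀))))))
      rich : ∀ {s} → s ∈ T → 3 ^ suc k * τ₀ ≤ weight (good br s)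
      rich {s} s∈ = +-cancelʳ-≤ τ₀ _ _ (begin
        3 ^ suc k * τ₀ + τ₀ ≤⟨ +-monoʳ-≤ (3 ^ suc k * τ₀) (≡-≤ (sym (*-identityˡ τ₀)) (*-monoˡ-≤ τ₀ (m^n>0 3 (suc k)))) ⟩
        3 ^ suc k * τ₀ + 3 ^ suc k * τ₀ ≡⟨ double (3 ^ suc k) τ₀ ⟩
        2 * 3 ^ suc k * τ₀ ≤⟨ total-large ⟩
        ∑ 𝒫 u ≡⟨ trans (∑-cong 𝒫 (λ {p} _ → ⊙-split true (good br s p) (u p))) (∑-+ 𝒫 _ _) ⟩
        weight (good br s) + ∑ 𝒫 (λ p → not (good br s p) ⊙ u p) ≤⟨ +-monoʳ-≤ (weight (good br s)) (loss≤τ₀ s∈) ⟩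
        weight (good br s) + τ₀ ∎)
        where
        double : ∀ x y → x * y + x * y ≡ 2 * x * y
        double = solve-∀
      lost : 2 * count T (λ s → not (kept C s)) ≤ length T
      lost = *-cancelˡ-≤ (3 * suc k) (begin
        3 * suc k * (2 * count T (λ s → not (kept C s)))
          ≡⟨ rearr (suc k) (count T (λ s → not (kept C s))) ⟩
        6 * suc k * count T (λ s → not (kept C s))
          ≡⟨ cong (6 * suc k *_) (∑-cong T (λ {s} s∈ → cong (_⊙ 1) (sym (∧-true (not (kept C s)) (dec-true (_ ≤? weight (good br s)) (rich s∈)))))) ⟩
        6 * suc k * count T (λ s → not (kept C s) ∧ does (3 ^ suc k * τ₀ ≤? weight (good br s)))
          ≤⟨ few-lost C ⟩
        3 * suc k * length T ∎)
        where
        rearr : ∀ k c → 3 * k * (2 * c) ≡ 6 * k * c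
        rearr = solve-∀
      half : length T ≤ 2 * count T (kept C)
      half = +-cancelʳ-≤ (length T) _ _ (begin
        length T + length T ≡⟨ cong (length T +_) (+-identityʳ (length T)) ⟨
        2 * length T ≡⟨ cong (2 *_) (trans (length-∑ T) (trans (∑-cong T (λ {s} _ → ⊙-split true (kept C s) 1)) (∑-+ T _ _))) ⟩
        2 * (count T (kept C) + count T (λ s → not (kept C s))) ≡⟨ *-distribˡ-+ 2 (count T (kept C)) _ ⟩
        2 * count T (kept C) + 2 * count T (λ s → not (kept C s)) ≤⟨ +-monoʳ-≤ (2 * count T (kept C)) lost ⟩
        2 * count T (kept C) + length T ∎)

-- Sums over primes

-- The binary logarithm rounded down, with the default value 0 at 0.
lg : ℕ → ℕ
lg zero = 0
lg (suc m) with suc m <? 2 ^ suc (lg m)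
... | yes _ = lg m
... | no _ = suc (lg m)

<2^[1+lg] : ∀ m → m < 2 ^ suc (lg m)
<2^[1+lg] zero = s≤s z≤n
<2^[1+lg] (suc m) with suc m <? 2 ^ suc (lg m)
... | yes lt = lt
... | no _ = ≤-trans (s≤s (<2^[1+lg] m)) (≤-trans (+-monoˡ-≤ (2 ^ suc (lg m)) (m^n>0 2 (suc (lg m))))
    (+-monoʳ-≤ (2 ^ suc (lg m)) (≤-reflexive (sym (+-identityʳ _)))))

2^lg≤ : ∀ m .{{_ : NonZero m}} → 2 ^ lg m ≤ m
2^lg≤ (suc m) = go m
  where
  go : ∀ m → 2 ^ lg (suc m) ≤ suc m
  go zero = ≤-refl
  go (suc m) with suc (suc m) <? 2 ^ suc (lg (suc m))
  ... | yes _ = m≤n⇒m≤1+n (go m)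
  ... | no ¬lt = ≮⇒≥ ¬lt

lg-bound : ∀ {m e} → m < 2 ^ suc e → lg m ≤ e
lg-bound {zero} _ = z≤n
lg-bound {suc m} {e} lt = s≤s⁻¹ (≰⇒> λ e<lg →
  <⇒≱ lt (≤-trans (^-monoʳ-≤ 2 e<lg) (2^lg≤ (suc m))))

lg-lower : ∀ {m e} → 2 ^ e ≤ m → e ≤ lg m
lg-lower {m} {e} le = s≤s⁻¹ (≰⇒> λ lg<e → <⇒≱ (<2^[1+lg] m) (≤-trans (^-monoʳ-≤ 2 lg<e) le))

-- Rounding costs an additive 1, which is absorbed by doubling `lg p`. In this form the bound adds
-- up over a factorisation.
lg-* : ∀ p m → 2 ≤ p → lg (p * m) ≤ 2 * lg p + lg m
lg-* p m 2≤p = ≤-trans (lg-bound {e = suc (lg p + lg m)} (≤-≡ (*-mono-< (<2^[1+lg] p) (<2^[1+lg] m))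
    (trans (sym (^-distribˡ-+-* 2 (suc (lg p)) (suc (lg m)))) (cong (λ v → 2 ^ suc v) (+-suc (lg p) (lg m))))))
  (≤-≡ (+-monoˡ-≤ (lg p + lg m) (lg-lower {p} {1} 2≤p)) (lemma (lg p) (lg m)))
  where
  lemma : ∀ a b → a + (a + b) ≡ 2 * a + b
  lemma = solve-∀

lg≤ : ∀ m → lg m ≤ m
lg≤ zero = z≤n
lg≤ (suc m) = ≤-trans (<⇒≤ (n<2^n (lg (suc m)))) (2^lg≤ (suc m))

prime≥2 : ∀ {p} → Prime p → 2 ≤ p
prime≥2 {p} pr = nonTrivial⇒n>1 p {{prime⇒nonTrivial pr}}

prime∣prime : ∀ {p q} → Prime p → Prime q → p ∣ q → p ≡ q
prime∣prime pp pq p∣q with prime⇒irreducible pq p∣q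
... | inj₁ refl = contradiction pp ¬prime[1]
... | inj₂ eq = eq

prime∣product : ∀ {p qs} → Prime p → All Prime qs → p ∣ product qs → p ∈ qs
prime∣product pp [] p∣1 = contradiction (subst Prime (∣1⇒≡1 p∣1) pp) ¬prime[1]
prime∣product {p} {q ∷ qs} pp (pq ∷ pqs) p∣ with euclidsLemma q (product qs) pp p∣
... | inj₁ p∣q = here (prime∣prime pp pq p∣q)
... | inj₂ p∣qs = there (prime∣product pp pqs p∣qs)

product∣ : ∀ {ps x} → Unique ps → All Prime ps → All (_∣ x) ps → product ps ∣ x
product∣ [] [] [] = 1∣ _
product∣ {p ∷ ps} {x} (p∉ ∷ uniq) (pp ∷ pps) (p∣x ∷ ps∣x) with product∣ uniq pps ps∣x
... | divides q refl with euclidsLemma q (product ps) pp p∣x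
... | inj₁ (divides r refl) = divides r (*-assoc r p (product ps))
... | inj₂ p∣ps = contradiction refl (All.lookup p∉ (prime∣product pp pps p∣ps))

2^∑lg≤product : ∀ {ps} → All Prime ps → 2 ^ ∑ ps lg ≤ product ps
2^∑lg≤product [] = ≤-refl
2^∑lg≤product {p ∷ ps} (pp ∷ pps) = ≡-≤ (^-distribˡ-+-* 2 (lg p) (∑ ps lg))
  (*-mono-≤ (2^lg≤ p {{prime⇒nonZero pp}}) (2^∑lg≤product pps))

-- Serves twice: with x a difference of coordinates it separates points, and with x the value of a
-- polynomial it forces that value to be zero.
common-prime-divisors : ∀ {ps x} (e : ℕ → Bool) → Unique ps → All Prime ps →
  (∀ {p} → p ∈ ps → e p ≡ true → p ∣ x) → .{{NonZero x}} → 2 ^ ∑ ps (λ p → e p ⊙ lg p) ≤ x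
common-prime-divisors {ps} {x} e uniq primes div = begin
  2 ^ ∑ ps (λ p → e p ⊙ lg p) ≡⟨ cong (2 ^_) (∑-filter ps e lg) ⟨
  2 ^ ∑ (filterᵇ e ps) lg ≤⟨ 2^∑lg≤product primes′ ⟩
  product (filterᵇ e ps) ≤⟨ ∣⇒≤ (product∣ (Unique.filter⁺ _ uniq) primes′
      (All.tabulate λ q∈ → let (q∈ps , eq) = ∈-filterᵇ⁻ e q∈ in div q∈ps eq)) ⟩
  x ∎
  where
  open ≤-Reasoning
  primes′ : All Prime (filterᵇ e ps)
  primes′ = All.tabulate λ q∈ → All.lookup primes (proj₁ (∈-filterᵇ⁻ e q∈))

∑-applyUpTo-+ : ∀ (g : ℕ → ℕ) a b f →
  ∑ (applyUpTo g (a + b)) f ≡ ∑ (applyUpTo g a) f + ∑ (applyUpTo (λ j → g (a + j)) b) f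
∑-applyUpTo-+ g zero b f = refl
∑-applyUpTo-+ g (suc a) b f =
  trans (cong (f (g 0) +_) (∑-applyUpTo-+ (g ∘ suc) a b f)) (sym (+-assoc (f (g 0)) _ _))

∑-applyUpTo-suc : ∀ (g : ℕ → ℕ) n f → ∑ (applyUpTo g (suc n)) f ≡ ∑ (applyUpTo g n) f + f (g n)
∑-applyUpTo-suc g n f = begin
  ∑ (applyUpTo g (suc n)) f ≡⟨ cong (λ v → ∑ (applyUpTo g v) f) (+-comm 1 n) ⟩
  ∑ (applyUpTo g (n + 1)) f ≡⟨ ∑-applyUpTo-+ g n 1 f ⟩
  ∑ (applyUpTo g n) f + (f (g (n + 0)) + 0) ≡⟨ cong (∑ (applyUpTo g n) f +_) (trans (+-identityʳ _) (cong (f ∘ g) (+-identityʳ n))) ⟩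
  ∑ (applyUpTo g n) f + f (g n) ∎
  where open ≡-Reasoning

-- The sum of n / 2 ^ j over j. The recursion doubles the shifted terms rather than halving n.
∑-geometric : ∀ (g x : ℕ → ℕ) n J → (∀ j → 2 ^ j * x (g j) ≤ n) → ∑ (applyUpTo g J) x ≤ 2 * n
∑-geometric g x n zero h = z≤n
∑-geometric g x n (suc J) h = begin
  x (g 0) + ∑ (applyUpTo (g ∘ suc) J) x ≤⟨ +-mono-≤ (≡-≤ (sym (*-identityˡ _)) (h 0)) half ⟩
  n + n ≡⟨ cong (n +_) (+-identityʳ n) ⟨
  2 * n ∎
  where
  open ≤-Reasoning
  lemma : ∀ a b → a * (2 * b) ≡ 2 * a * b
  lemma = solve-∀
  half : ∑ (applyUpTo (g ∘ suc) J) x ≤ n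
  half = *-cancelˡ-≤ 2 (≡-≤ (∑-*ˡ (applyUpTo (g ∘ suc) J) 2 x)
    (∑-geometric (g ∘ suc) (λ y → 2 * x y) n J (λ j → ≡-≤ (lemma (2 ^ j) (x (g (suc j)))) (h (suc j)))))

multiples : ∀ d n → d * count (applyUpTo suc n) (λ m → does (d ∣? m)) ≤ n
multiples d zero = ≤-reflexive (*-zeroʳ d)
multiples d (suc n) rewrite ∑-applyUpTo-suc suc n (λ m → does (d ∣? m) ⊙ 1) with d ∣? suc n
... | no _ = ≡-≤ (cong (d *_) (+-identityʳ _)) (m≤n⇒m≤1+n (multiples d n))
... | yes (divides q eq) = begin
  d * (C + 1) ≤⟨ *-monoʳ-≤ d (≡-≤ (+-comm C 1) (*-cancelˡ-< d _ _ (begin-strict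
      d * C ≤⟨ multiples d n ⟩
      n <⟨ n<1+n n ⟩
      suc n ≡⟨ trans eq (*-comm q d) ⟩
      d * q ∎))) ⟩
  d * q ≡⟨ trans eq (*-comm q d) ⟨
  suc n ∎
  where
  open ≤-Reasoning
  C = count (applyUpTo suc n) (λ m → does (d ∣? m))

-- The p-adic valuation, counted by the powers of p that divide m and cut off at J.
valuation : ℕ → ℕ → ℕ → ℕ
valuation J p m = count (upTo J) (λ j → does (p ^ suc j ∣? m))

-- Legendre's formula: the sum is at most n / p + n / p ^ 2 + ..., and p ≥ 2 bounds this series by 2
-- n / p.
valuation-total : ∀ J {p} n → 2 ≤ p → p * ∑ (applyUpTo suc n) (valuation J p) ≤ 2 * n
valuation-total J {p} n 2≤p = begin
  p * ∑ (applyUpTo suc n) (valuation J p)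
    ≡⟨ cong (p *_) (∑-swap (applyUpTo suc n) (upTo J) _) ⟩
  p * ∑ (upTo J) (λ j → count (applyUpTo suc n) (λ m → does (p ^ suc j ∣? m)))
    ≡⟨ ∑-*ˡ (upTo J) p _ ⟩
  ∑ (upTo J) (λ j → p * count (applyUpTo suc n) (λ m → does (p ^ suc j ∣? m)))
    ≤⟨ ∑-geometric id _ n J (λ j → ≤-trans (*-monoˡ-≤ _ (^-monoˡ-≤ j 2≤p))
        (≡-≤ (*-swap-assoc (p ^ j) p _) (multiples (p ^ suc j) n))) ⟩
  2 * n ∎
  where
  open ≤-Reasoning

count-initial : ∀ {a J} (q : ℕ → Bool) → a ≤ J → (∀ {j} → j < a → q j ≡ true) → a ≤ count (upTo J) q
count-initial {a} {J} q a≤J h = begin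
  a ≡⟨ trans (*-identityʳ _) (length-upTo a) ⟨
  length (upTo a) * 1 ≡⟨ ∑-const (upTo a) 1 ⟨
  ∑ (upTo a) (λ _ → 1) ≡⟨ ∑-cong (upTo a) (λ j∈ → cong (_⊙ 1) (sym (h (∈-upTo⁻ j∈)))) ⟩
  count (upTo a) q ≤⟨ m≤m+n _ _ ⟩
  count (upTo a) q + _ ≡⟨ ∑-applyUpTo-+ id a (J ∸ a) (λ j → q j ⊙ 1) ⟨
  count (upTo (a + (J ∸ a))) q ≡⟨ cong (λ v → count (upTo v) q) (m+[n∸m]≡n a≤J) ⟩
  count (upTo J) q ∎
  where open ≤-Reasoning

_≡ᵇ?_ : ℕ → ℕ → Bool
p ≡ᵇ? q = does (p ≟ q)

power∣product : ∀ p qs → p ^ count qs (p ≡ᵇ?_) ∣ product qs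
power∣product p [] = ∣-refl
power∣product p (q ∷ qs) with p ≡ᵇ? q in eq
... | true rewrite holds (p ≟ q) eq = *-monoʳ-∣ q (power∣product q qs)
... | false = ∣-trans (power∣product p qs) (n∣m*n q)

lg-product : ∀ {qs} → All Prime qs → lg (product qs) ≤ ∑ qs (λ q → 2 * lg q)
lg-product [] = z≤n
lg-product {q ∷ qs} (pq ∷ pqs) = ≤-trans (lg-* q (product qs) (prime≥2 pq)) (+-monoʳ-≤ (2 * lg q) (lg-product pqs))

primesUpTo : ℕ → List ℕ
primesUpTo n = filter prime? (upTo (suc n))

primesUpTo-prime : ∀ n → All Prime (primesUpTo n)
primesUpTo-prime n = All.tabulate λ p∈ → proj₂ (∈-filter⁻ prime? {xs = upTo (suc n)} p∈)

primesUpTo-unique : ∀ n → Unique (primesUpTo n)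
primesUpTo-unique n = Unique.filter⁺ prime? (Unique.upTo⁺ (suc n))

primesUpTo-≤ : ∀ n {p} → p ∈ primesUpTo n → p ≤ n
primesUpTo-≤ n p∈ = s≤s⁻¹ (∈-upTo⁻ (proj₁ (∈-filter⁻ prime? {xs = upTo (suc n)} p∈)))

-- This is log m = Σ v(p) log p, where the factor 2 pays for the rounding in `lg`. As m < 2 ^ J, the
-- cut-off of the valuation is never reached.
lg≤valuations : ∀ {n J m} → 0 < m → m ≤ n → m < 2 ^ J →
  lg m ≤ ∑ (primesUpTo n) (λ p → 2 * lg p * valuation J p m)
lg≤valuations {n} {J} {m@(suc _)} _ m≤n m<2^J = begin
  lg m ≡⟨ cong lg isFactorisation ⟩
  lg (product factors) ≤⟨ lg-product factorsPrime ⟩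
  ∑ factors (λ q → 2 * lg q) ≤⟨ ∑-mono factors (λ {q} q∈ → by-prime q q∈) ⟩
  ∑ factors (λ q → ∑ P (λ p → (p ≡ᵇ? q) ⊙ (2 * lg p)))
      ≡⟨ ∑-swap factors P _ ⟩
  ∑ P (λ p → ∑ factors (λ q → (p ≡ᵇ? q) ⊙ (2 * lg p)))
      ≡⟨ ∑-cong P (λ {p} _ → trans (∑-cong factors (λ {q} _ →
      trans (cong ((p ≡ᵇ? q) ⊙_) (sym (*-identityʳ _))) (sym (⊙-*ˡ (p ≡ᵇ? q) (2 * lg p) 1))))
      (sym (∑-*ˡ factors (2 * lg p) _))) ⟩
  ∑ P (λ p → 2 * lg p * count factors (p ≡ᵇ?_)) ≤⟨ ∑-mono P (λ {p} p∈ → *-monoʳ-≤ (2 * lg p) (multiplicity p∈)) ⟩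
  ∑ P (λ p → 2 * lg p * valuation J p m) ∎
  where
  open ≤-Reasoning
  open PrimeFactorisation (factorise m)
  P = primesUpTo n
  ∣m⇒≤n : ∀ {q} → q ∣ m → q ≤ n
  ∣m⇒≤n q∣m = ≤-trans (∣⇒≤ q∣m) m≤n
  factor∣ : ∀ {q qs} → q ∈ qs → q ∣ product qs
  factor∣ (here refl) = m∣m*n _
  factor∣ {qs = r ∷ _} (there q∈) = ∣-trans (factor∣ q∈) (n∣m*n r)
  by-prime : ∀ q → q ∈ factors → 2 * lg q ≤ ∑ P (λ p → (p ≡ᵇ? q) ⊙ (2 * lg p))
  by-prime q q∈ = ≡-≤ (cong (_⊙ (2 * lg q)) (sym (dec-true (q ≟ q) refl)))
    (∑-member (λ p → (p ≡ᵇ? q) ⊙ (2 * lg p))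
      (∈-filter⁺ prime? (∈-upTo⁺ (s≤s (∣m⇒≤n (subst (q ∣_) (sym isFactorisation) (factor∣ q∈))))) (All.lookup factorsPrime q∈)))
  multiplicity : ∀ {p} → p ∈ P → count factors (p ≡ᵇ?_) ≤ valuation J p m
  multiplicity {p} p∈ = count-initial {a} {J} _ (<⇒≤ (≰⇒> λ J≤a → <⇒≱ m<2^J (begin
      2 ^ J ≤⟨ ^-monoʳ-≤ 2 J≤a ⟩
      2 ^ a ≤⟨ ^-monoˡ-≤ a (prime≥2 (All.lookup (primesUpTo-prime n) p∈)) ⟩
      p ^ a ≤⟨ ∣⇒≤ p^a∣m ⟩
      m ∎)))
    (λ {j} j<a → dec-true (p ^ suc j ∣? m) (∣-trans (power∣power j<a) p^a∣m))
    where
    a = count factors (p ≡ᵇ?_)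
    p^a∣m : p ^ a ∣ m
    p^a∣m = subst (p ^ a ∣_) (sym isFactorisation) (power∣product p factors)
    power∣power : ∀ {i j} → i ≤ j → p ^ i ∣ p ^ j
    power∣power {i} {j} i≤j = divides (p ^ (j ∸ i))
      (trans (cong (p ^_) (sym (m∸n+n≡m i≤j))) (^-distribˡ-+-* p (j ∸ i) i))

-- Mertens' lower bound for Σ log p / p, from the prime factorisation of n ! with n = 2 ^ suc h.
mertens : ∀ h (Π : ℕ) (u : ℕ → ℕ) → (∀ {p} → p ∈ primesUpTo (2 ^ suc h) → p * u p ≡ Π * lg p) →
  Π * h ≤ 8 * ∑ (primesUpTo (2 ^ suc h)) u
mertens h Π u scale = *-cancelˡ-≤ H {{>-nonZero (m^n>0 2 h)}} (begin
  H * (Π * h) ≡⟨ *-swap H Π h ⟩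
  Π * (H * h) ≤⟨ *-monoʳ-≤ Π lower ⟩
  Π * ∑ ms lg ≤⟨ *-monoʳ-≤ Π (∑-mono ms (λ m∈ → let (0<m , m≤n) = bounds m∈ in
                                                     lg≤valuations {n} {suc (suc h)} 0<m m≤n (≤-<-trans m≤n (n<2n h)))) ⟩
  Π * ∑ ms (λ m → ∑ P (λ p → 2 * lg p * valuation J p m)) ≡⟨ cong (Π *_) (∑-swap ms P _) ⟩
  Π * ∑ P (λ p → ∑ ms (λ m → 2 * lg p * valuation J p m)) ≡⟨ ∑-*ˡ P Π _ ⟩
  ∑ P (λ p → Π * ∑ ms (λ m → 2 * lg p * valuation J p m)) ≤⟨ ∑-mono P per-prime ⟩
  ∑ P (λ p → H * 8 * u p) ≡⟨ ∑-*ˡ P (H * 8) u ⟨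
  H * 8 * ∑ P u ≡⟨ *-assoc H 8 _ ⟩
  H * (8 * ∑ P u) ∎)
  where
  open ≤-Reasoning
  H n J : ℕ
  H = 2 ^ h
  n = 2 ^ suc h
  J = suc (suc h)
  P = primesUpTo n
  ms = applyUpTo suc n
  n<2n : ∀ h → 2 ^ suc h < 2 ^ suc (suc h)
  n<2n h = ^-monoʳ-< 2 (s≤s (s≤s z≤n)) (n<1+n (suc h))
  bounds : ∀ {m} → m ∈ ms → 0 < m × m ≤ n
  bounds m∈ with ∈-applyUpTo⁻ suc m∈
  ... | (i , i<n , refl) = z<s , i<n
  -- Only the upper half of the range is used: there every logarithm is at least h.
  lower : H * h ≤ ∑ ms lg
  lower = begin
    H * h ≡⟨ cong (_* h) (length-upTo H) ⟨
    length (upTo H) * h ≡⟨ ∑-const (upTo H) h ⟨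
    ∑ (upTo H) (λ _ → h) ≤⟨ ∑-mono (upTo H) (λ {j} _ → lg-lower (≤-trans (m≤m+n H j) (n≤1+n _))) ⟩
    ∑ (upTo H) (λ j → lg (suc (H + j))) ≡⟨ shift id H ⟨
    ∑ (applyUpTo (λ j → suc (H + j)) H) lg ≤⟨ m≤n+m _ (∑ (applyUpTo suc H) lg) ⟩
    ∑ (applyUpTo suc H) lg + ∑ (applyUpTo (λ j → suc (H + j)) H) lg ≡⟨ ∑-applyUpTo-+ suc H H lg ⟨
    ∑ (applyUpTo suc (H + H)) lg ≡⟨ cong (λ v → ∑ (applyUpTo suc v) lg) (cong (H +_) (sym (+-identityʳ H))) ⟩
    ∑ ms lg ∎
    where
    shift : ∀ (g : ℕ → ℕ) r → ∑ (applyUpTo (λ j → suc (H + g j)) r) lg ≡ ∑ (applyUpTo g r) (λ j → lg (suc (H + j)))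
    shift g zero = refl
    shift g (suc r) = cong (lg (suc (H + g 0)) +_) (shift (g ∘ suc) r)
  per-prime : ∀ {p} → p ∈ P → Π * ∑ ms (λ m → 2 * lg p * valuation J p m) ≤ H * 8 * u p
  per-prime {p} p∈ = begin
    Π * ∑ ms (λ m → 2 * lg p * valuation J p m) ≡⟨ cong (Π *_) (∑-*ˡ ms (2 * lg p) _) ⟨
    Π * (2 * lg p * ∑ ms (valuation J p)) ≡⟨ l₂ Π (lg p) _ ⟩
    2 * (Π * lg p) * ∑ ms (valuation J p) ≡⟨ cong (λ v → 2 * v * ∑ ms (valuation J p)) (scale p∈) ⟨
    2 * (p * u p) * ∑ ms (valuation J p) ≡⟨ l₃ p (u p) _ ⟩
    2 * u p * (p * ∑ ms (valuation J p)) ≤⟨ *-monoʳ-≤ (2 * u p) (valuation-total J n (prime≥2 (All.lookup (primesUpTo-prime n) p∈))) ⟩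
    2 * u p * (2 * n) ≡⟨ l₄ (u p) H ⟩
    H * 8 * u p ∎
    where
    l₂ : ∀ a b c → a * (2 * b * c) ≡ 2 * (a * b) * c
    l₂ = solve-∀
    l₃ : ∀ a b c → 2 * (a * b) * c ≡ 2 * b * (a * c)
    l₃ = solve-∀
    l₄ : ∀ a b → 2 * a * (2 * (2 * b)) ≡ b * 8 * a
    l₄ = solve-∀

count-below : ∀ a n → count (upTo n) (λ p → not (does (a ≤? p))) ≤ a
count-below a zero = z≤n
count-below a (suc n) rewrite ∑-applyUpTo-suc id n (λ p → not (does (a ≤? p)) ⊙ 1) with does (a ≤? n) in eq
... | true = ≡-≤ (+-identityʳ _) (count-below a n)
... | false = ≤-trans (+-monoˡ-≤ 1 (count≤length (upTo n) _))
  (≡-≤ (trans (+-comm _ 1) (cong suc (length-upTo n))) (≰⇒> (fails (a ≤? n) eq)))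

primesBetween : ℕ → ℕ → List ℕ
primesBetween a n = filterᵇ (λ p → does (a ≤? p)) (primesUpTo n)

-- At most a primes are discarded, and each weighs at most `Π` because `lg p` ≤ p.
∑-primesBetween : ∀ a n (Π : ℕ) (u : ℕ → ℕ) → (∀ {p} → p ∈ primesUpTo n → p * u p ≡ Π * lg p) →
  ∑ (primesUpTo n) u ≤ ∑ (primesBetween a n) u + a * Π
∑-primesBetween a n Π u scale = begin
  ∑ P u ≡⟨ ∑-cong P (λ {p} _ → ⊙-split true (does (a ≤? p)) (u p)) ⟩
  ∑ P (λ p → does (a ≤? p) ⊙ u p + not (does (a ≤? p)) ⊙ u p) ≡⟨ ∑-+ P _ _ ⟩
  ∑ P (λ p → does (a ≤? p) ⊙ u p) + ∑ P (λ p → not (does (a ≤? p)) ⊙ u p)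
    ≡⟨ cong (_+ ∑ P (λ p → not (does (a ≤? p)) ⊙ u p)) (∑-filter P (λ p → does (a ≤? p)) u) ⟨
  ∑ (primesBetween a n) u + ∑ P (λ p → not (does (a ≤? p)) ⊙ u p)
    ≤⟨ +-monoʳ-≤ _ (≤-trans (∑-mono P (λ {p} p∈ → ⊙-monoʳ (not (does (a ≤? p))) (u≤Π p∈))) small) ⟩
  ∑ (primesBetween a n) u + a * Π ∎
  where
  open ≤-Reasoning
  P = primesUpTo n
  u≤Π : ∀ {p} → p ∈ P → u p ≤ Π
  u≤Π {p} p∈ = *-cancelˡ-≤ p {{prime⇒nonZero (All.lookup (primesUpTo-prime n) p∈)}}
    (≡-≤ (scale p∈) (≤-≡ (*-monoʳ-≤ Π (lg≤ p)) (*-comm Π p)))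
  small : ∑ P (λ p → not (does (a ≤? p)) ⊙ Π) ≤ a * Π
  small = begin
    ∑ P (λ p → not (does (a ≤? p)) ⊙ Π) ≡⟨ ∑-filter? prime? (upTo (suc n)) _ ⟩
    ∑ (upTo (suc n)) (λ p → does (prime? p) ⊙ (not (does (a ≤? p)) ⊙ Π))
        ≤⟨ ∑-mono (upTo (suc n)) (λ {p} _ → ≤-≡ (⊙-≤ (does (prime? p)))
        (unit (not (does (a ≤? p))))) ⟩
    ∑ (upTo (suc n)) (λ p → not (does (a ≤? p)) ⊙ 1 * Π) ≡⟨ ∑-*ʳ (upTo (suc n)) Π (λ p → not (does (a ≤? p)) ⊙ 1) ⟨
    count (upTo (suc n)) (λ p → not (does (a ≤? p))) * Π ≤⟨ *-monoˡ-≤ Π (count-below a (suc n)) ⟩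
    a * Π ∎
    where
    unit : ∀ b → b ⊙ Π ≡ b ⊙ 1 * Π
    unit true = sym (+-identityʳ Π)
    unit false = refl

-- Residue classes of points and pruning

-- a modulo p, with the junk value a at p = 0.
rem : ℕ → ℕ → ℕ
rem zero a = a
rem p@(suc _) a = a % p

rem≡⇒∣ : ∀ p a b → rem p a ≡ rem p b → p ∣ ∣ a - b ∣
rem≡⇒∣ zero a b refl = divides 0 (∣n-n∣≡0 a)
rem≡⇒∣ p@(suc _) a b eq = divides ∣ a / p - b / p ∣ (begin
  ∣ a - b ∣ ≡⟨ cong₂ ∣_-_∣ (m≡m%n+[m/n]*n a p) (m≡m%n+[m/n]*n b p) ⟩
  ∣ a % p + a / p * p - b % p + b / p * p ∣ ≡⟨ cong (λ r → ∣ r + a / p * p - b % p + b / p * p ∣) eq ⟩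
  ∣ b % p + a / p * p - b % p + b / p * p ∣ ≡⟨ ∣m+n-m+o∣≡∣n-o∣ (b % p) _ _ ⟩
  ∣ a / p * p - b / p * p ∣ ≡⟨ *-distribʳ-∣-∣ p (a / p) (b / p) ⟨
  ∣ a / p - b / p ∣ * p ∎)
  where open ≡-Reasoning

representatives : ∀ {A B : Set} (f : A → B) ys → (∀ {y} → y ∈ ys → ∃[ x ] f x ≡ y) →
  ∃[ xs ] (length xs ≡ length ys × (∀ {y} → y ∈ ys → ∃[ x ] (x ∈ xs × f x ≡ y)))
representatives f [] h = [] , refl , λ ()
representatives f (y ∷ ys) h with h (here refl) | representatives f ys (h ∘ there)
... | (x , fx≡y) | (xs , len , covers) = x ∷ xs , cong suc len , λ
  { (here refl) → x , here refl , fx≡y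
  ; (there y∈) → let (z , z∈ , eq) = covers y∈ in z , there z∈ , eq }

same-elements⇒↭ : ∀ {A : Set} {xs ys : List A} → Unique xs → Unique ys →
  (∀ {z} → z ∈ xs → z ∈ ys) → (∀ {z} → z ∈ ys → z ∈ xs) → xs ↭ ys
same-elements⇒↭ ux uy to from = ∼bag⇒↭ (unique∧set⇒bag ux uy (mk⇔ to from))

differing-coordinate : ∀ {A : Set} {d} → DecidableEquality A → {s t : Vec A d} → s ≢ t → ∃[ i ] lookup s i ≢ lookup t i
differing-coordinate _≟_ {[]} {[]} s≢t = contradiction refl s≢t
differing-coordinate _≟_ {x ∷ xs} {y ∷ ys} s≢t with x ≟ y
... | no x≢y = Fin.zero , x≢y
... | yes refl = let (i , ne) = differing-coordinate _≟_ {xs} {ys} (λ eq → s≢t (cong (x ∷_) eq)) in Fin.suc i , ne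

module Points (N d : ℕ) where

  _≟ₚ_ : DecidableEquality (Point N d)
  _≟ₚ_ = Vec.≡-dec Fin._≟_

  _≟ᵣ_ : DecidableEquality (Vec ℕ d)
  _≟ᵣ_ = Vec.≡-dec _≟_

  -- Residues are natural numbers, so that the type of classes is the same for all p.
  class : ℕ → Point N d → Vec ℕ d
  class p = Vec.map (λ a → rem p (toℕ a))

  class⇒rem : ∀ {p} {s t : Point N d} → class p s ≡ class p t → ∀ i → rem p (toℕ (lookup s i)) ≡ rem p (toℕ (lookup t i))
  class⇒rem {p} {s} {t} eq i = trans (sym (Vec.lookup-map i _ s)) (trans (cong (λ v → lookup v i) eq) (Vec.lookup-map i _ t))

  residue⇒class : ∀ p .{{_ : NonZero p}} {s t : Point N d} →
    Vec.map (λ a → toℕ a mod p) s ≡ Vec.map (λ a → toℕ a mod p) t → class p s ≡ class p t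
  residue⇒class (suc p) {s} {t} eq = trans (conv s) (trans (cong (Vec.map toℕ) eq) (sym (conv t)))
    where
    conv : ∀ v → class (suc p) v ≡ Vec.map toℕ (Vec.map (λ a → toℕ a mod suc p) v)
    conv v = trans (Vec.map-cong (λ a → sym (Fin.toℕ-fromℕ< (m%n<n (toℕ a) (suc p)))) v) (Vec.map-∘ toℕ _ v)

  -- The sieve applies labels to residue classes, so each class is represented by a point.
  residue-representatives : ∀ p .{{_ : NonZero p}} (S : FinSet (Point N d)) →
    ∃[ Ω ] (length Ω ≡ ∣ residues p S ∣ × (∀ {s} → s ∈ elements S → ∃[ t ] (t ∈ Ω × class p t ≡ class p s)))
  residue-representatives p S =
    let (Ω , len , covers) = representatives r (elements (residues p S))
          (λ y∈ → let (x , _ , eq) = ∈-map⁻ r (∈-deduplicate⁻ (Vec.≡-dec Fin._≟_) (map r (elements S)) y∈) in x , sym eq)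
    in Ω , len , λ s∈ → let (t , t∈ , eq) = covers (∈-deduplicate⁺ (Vec.≡-dec Fin._≟_) (∈-map⁺ r s∈))
                        in t , t∈ , residue⇒class p eq
    where
    r : Point N d → Vec (Fin p) d
    r = Vec.map (λ a → toℕ a mod p)

  -- Distinct points differ in some coordinate, by a positive number of size at most N < 2 ^ ℓ. All
  -- primes modulo which they agree divide this number.
  separated : ∀ {ℓ ps} → N < 2 ^ ℓ → Unique ps → All Prime ps → ∀ {s t : Point N d} → s ≢ t →
    ∑ ps (λ p → does (class p s ≟ᵣ class p t) ⊙ lg p) ≤ ℓ
  separated {ℓ} {ps} N<2^ℓ uniq primes {s} {t} s≢t = <⇒≤ (≰⇒> λ ℓ≤ → <⇒≱ N<2^ℓ (begin
    2 ^ ℓ ≤⟨ ^-monoʳ-≤ 2 ℓ≤ ⟩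
    2 ^ ∑ ps (λ p → does (class p s ≟ᵣ class p t) ⊙ lg p) ≤⟨ common-prime-divisors _ uniq primes
        (λ {p} _ eq → rem≡⇒∣ p a b (class⇒rem {p} {s} {t} (holds (class p s ≟ᵣ class p t) eq) i)) {{≢-nonZero (λ z → ne (Fin.toℕ-injective (∣m-n∣≡0⇒m≡n z)))}} ⟩
    ∣ a - b ∣ ≤⟨ ∣m-n∣≤m⊔n a b ⟩
    a ⊔ b ≤⟨ ⊔-lub (s≤s⁻¹ (Fin.toℕ<n (lookup s i))) (s≤s⁻¹ (Fin.toℕ<n (lookup t i))) ⟩
    N ∎))
    where
    open ≤-Reasoning
    i = proj₁ (differing-coordinate Fin._≟_ s≢t)
    ne = proj₂ (differing-coordinate Fin._≟_ s≢t)
    a = toℕ (lookup s i)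
    b = toℕ (lookup t i)

  module Pruning (K : ℕ) where
    open Trees _≟ₚ_ _≟ᵣ_ class K
    open DecMembership _≟ₚ_ using (_∈?_)

    -- A constant vector encodes a coordinate as a point, as the type of labels requires.
    coord : Fin d → Point N d → Point N d
    coord i s = replicate d (lookup s i)

    coord-compatible : ∀ i → Compatible (coord i)
    coord-compatible i {p} {s} {t} eq = trans (Vec.map-replicate _ (lookup s i) d)
      (trans (cong (replicate d) (class⇒rem {p} {s} {t} eq i)) (sym (Vec.map-replicate _ (lookup t i) d)))

    coord-injective : ∀ i {s t} → coord i s ≡ coord i t → lookup s i ≡ lookup t i
    coord-injective i {s} {t} eq = trans (sym (Vec.lookup-replicate i _))
      (trans (cong (λ v → lookup v i) eq) (Vec.lookup-replicate i _))

    ∈-coord-fibre : ∀ i {s z S} → z ∈ fib (coord i) (coord i s) S → z ∈ S × lookup z i ≡ lookup s i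
    ∈-coord-fibre i {s} {z} {S} z∈ = let (z∈S , eq) = ∈-fibre⁻ (coord i) {_} {S} z∈ in z∈S , coord-injective i {z} {s} eq

    coord-fibre-∈ : ∀ i {s z S} → z ∈ S → lookup z i ≡ lookup s i → z ∈ fib (coord i) (coord i s) S
    coord-fibre-∈ i {s} {z} z∈S eq = ∈-filterᵇ⁺ _ z∈S (dec-true (coord i z ≟ₚ coord i s) (cong (replicate d) eq))

    fibre↭ : ∀ i s S → fib (coord i) (coord i s) (elements S) ↭ elements (fibre i (lookup s i) S)
    fibre↭ i s S = same-elements⇒↭ (filterᵇ-unique _ (unique S)) (unique (fibre i (lookup s i) S))
      (λ {z} z∈ → let (z∈S , eq) = ∈-coord-fibre i {s} {z} {elements S} z∈ in ∈-filter⁺ (λ v → lookup v i Fin.≟ lookup s i) z∈S eq)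
      (λ {z} z∈ → let (z∈S , eq) = ∈-filter⁻ (λ v → lookup v i Fin.≟ lookup s i) {xs = elements S} z∈ in coord-fibre-∈ i {s} {z} z∈S eq)

    Pruned : ℕ → ℕ → List (Point N d) → Set
    Pruned k h S = ∃[ T ] (Branching k T × Unique T × (∀ {z} → z ∈ T → z ∈ S) × length S ≤ h * length T)

    -- The heavy fibres together hold less than half of S, since they are few.
    module _ (k h : ℕ) (h-positive : 0 < h) (K-positive : 0 < K) (S : FinSet (Point N d)) (i : Fin d)
      (wide : ∀ A → A ⊆ S → ∣ S ∣ ≤ 2 * ∣ A ∣ → 2 * h * K ≤ ∣ π i A ∣)
      (pruned-fibre : ∀ x → ∣ fibre i x S ∣ ≡ 0 ⊎ Pruned k h (elements (fibre i x S)))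
      where
      n K₁ : ℕ
      n = ∣ S ∣
      -- Pruning shrinks S by a factor of at most 2 h. A fibre below |S| / (2 h K) is therefore
      -- still below |T| / K.
      K₁ = 2 * h * K

      thin : [ N ] → Bool
      thin x = does (K₁ * ∣ fibre i x S ∣ ≤? n)

      branch : [ N ] → List (Point N d)
      branch x = [ (λ _ → []) , proj₁ ]′ (pruned-fibre x)

      in-branch : ∀ {x z} → z ∈ branch x → z ∈ elements S × lookup z i ≡ x
      in-branch {x} z∈ with pruned-fibre x
      in-branch {x} () | inj₁ _
      ... | inj₂ (T , _ , _ , T⊆ , _) = ∈-filter⁻ (λ v → lookup v i Fin.≟ x) (T⊆ z∈)

      branch-unique : ∀ x → Unique (branch x)
      branch-unique x with pruned-fibre x
      ... | inj₁ _ = []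
      ... | inj₂ (_ , _ , uniq , _) = uniq

      branch-large : ∀ x → ∣ fibre i x S ∣ ≤ h * length (branch x)
      branch-large x with pruned-fibre x
      ... | inj₁ none = ≡-≤ none z≤n
      ... | inj₂ (_ , _ , _ , _ , large) = large

      branch-tree : ∀ x {z} → z ∈ branch x → Branching k (branch x)
      branch-tree x z∈ with pruned-fibre x
      branch-tree x () | inj₁ _
      ... | inj₂ (_ , br , _) = br

      branch-small : ∀ x → length (branch x) ≤ ∣ fibre i x S ∣
      branch-small x = ≡-≤ (↭-length (same-elements⇒↭ (branch-unique x)
          (filterᵇ-unique q (unique (fibre i x S)))
          (λ z∈ → let (z∈S , eq) = in-branch z∈ in ∈-filterᵇ⁺ q (∈-filter⁺ (λ v → lookup v i Fin.≟ x) z∈S eq) (dec-true (_ ∈? branch x) z∈))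
          (λ z∈ → holds (_ ∈? branch x) (proj₂ (∈-filterᵇ⁻ q {elements (fibre i x S)} z∈)))))
        (≡-≤ (length-filterᵇ (elements (fibre i x S)) q) (count≤length (elements (fibre i x S)) q))
        where
        q : Point N d → Bool
        q z = does (z ∈? branch x)

      keep : Point N d → Bool
      keep s = thin (lookup s i) ∧ does (s ∈? branch (lookup s i))

      T : List (Point N d)
      T = filterᵇ keep (elements S)

      fibre-of-T : ∀ s → s ∈ T → fib (coord i) (coord i s) T ↭ branch (lookup s i)
      fibre-of-T s s∈T = same-elements⇒↭ (filterᵇ-unique _ (filterᵇ-unique keep (unique S))) (branch-unique (lookup s i))
        (λ {z} z∈ → let (z∈T , eq) = ∈-coord-fibre i {s} {z} {T} z∈
                        kp = proj₂ (∈-filterᵇ⁻ keep {elements S} z∈T)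
                    in subst (λ x → z ∈ branch x) eq (holds (z ∈? branch (lookup z i)) (∧-right (thin (lookup z i)) kp)))
        (λ {z} z∈ → let (z∈S , eq) = in-branch z∈ in coord-fibre-∈ i {s} {z} {T}
           (∈-filterᵇ⁺ keep z∈S (∧-intro (trans (cong thin eq) (∧-left (thin (lookup s i)) (proj₂ (∈-filterᵇ⁻ keep {elements S} s∈T))))
             (dec-true (z ∈? branch (lookup z i)) (subst (λ x → z ∈ branch x) (sym eq) z∈)))) eq)

      ∑-fibres≤ : ∀ {xs} → Unique xs → ∑ xs (λ x → ∣ fibre i x S ∣) ≤ n
      ∑-fibres≤ {xs} uniq = begin
        ∑ xs (λ x → ∣ fibre i x S ∣) ≡⟨ ∑-cong xs (λ {x} _ → length-filter? (λ v → lookup v i Fin.≟ x) (elements S)) ⟩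
        ∑ xs (λ x → count (elements S) (λ s → does (lookup s i Fin.≟ x))) ≡⟨ ∑-swap xs (elements S) _ ⟩
        ∑ (elements S) (λ s → ∑ xs (λ x → does (lookup s i Fin.≟ x) ⊙ 1)) ≤⟨ ∑-≤-const (elements S) 1 (λ {s} _ → at-most-one {lookup s i} uniq) ⟩
        n * 1 ≡⟨ *-identityʳ n ⟩
        n ∎
        where
        open ≤-Reasoning
        at-most-none : ∀ {y xs} → All (y ≢_) xs → ∑ xs (λ x → does (y Fin.≟ x) ⊙ 1) ≤ 0
        at-most-none [] = z≤n
        at-most-none {y} {x ∷ _} (ne ∷ p) rewrite dec-false (y Fin.≟ x) ne = at-most-none {y} p
        at-most-one : ∀ {y xs} → Unique xs → ∑ xs (λ x → does (y Fin.≟ x) ⊙ 1) ≤ 1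
        at-most-one [] = z≤n
        at-most-one {y} {x ∷ _} (ne ∷ p) with does (y Fin.≟ x) in eq
        ... | false = at-most-one {y} p
        ... | true = s≤s (at-most-none (subst (λ v → All (v ≢_) _) (sym (holds (y Fin.≟ x) eq)) ne))

      A : FinSet (Point N d)
      A = record { elements = filterᵇ (λ s → not (thin (lookup s i))) (elements S) ; unique = filterᵇ-unique _ (unique S) }

      K₁-positive : 0 < K₁
      K₁-positive = *-mono-< (*-mono-< {0} {2} z<s h-positive) K-positive

      half : 2 * ∣ A ∣ < n
      half = ≰⇒> λ n≤2A → <⇒≱ (*-monoʳ-< K₁ {{>-nonZero K₁-positive}} (n<1+n n)) (begin
        K₁ * suc n ≤⟨ *-monoˡ-≤ (suc n) (wide A (λ z∈ → proj₁ (∈-filterᵇ⁻ _ z∈)) n≤2A) ⟩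
        ∣ π i A ∣ * suc n ≡⟨ ∑-const (elements (π i A)) (suc n) ⟨
        ∑ (elements (π i A)) (λ _ → suc n) ≤⟨ ∑-mono (elements (π i A)) heavy ⟩
        ∑ (elements (π i A)) (λ x → K₁ * ∣ fibre i x S ∣) ≡⟨ ∑-*ˡ (elements (π i A)) K₁ _ ⟨
        K₁ * ∑ (elements (π i A)) (λ x → ∣ fibre i x S ∣) ≤⟨ *-monoʳ-≤ K₁ (∑-fibres≤ (unique (π i A))) ⟩
        K₁ * n ∎)
        where
        open ≤-Reasoning
        heavy : ∀ {x} → x ∈ elements (π i A) → n < K₁ * ∣ fibre i x S ∣
        heavy x∈ with ∈-map⁻ (λ v → lookup v i) (∈-deduplicate⁻ Fin._≟_ (map (λ v → lookup v i) (elements A)) x∈)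
        ... | (v , v∈ , refl) = ≰⇒> (fails (K₁ * ∣ fibre i (lookup v i) S ∣ ≤? n) (not-true (proj₂ (∈-filterᵇ⁻ _ {elements S} v∈))))

      -- Thin fibres hold at least half of S, and each of them keeps a proportion 1 / h in its
      -- branch.
      T-large : n ≤ 2 * h * length T
      T-large = begin
        n ≤⟨ +-cancelʳ-≤ (2 * ∣ A ∣) n _ (≤-≡ (+-monoʳ-≤ n (<⇒≤ half)) split) ⟩
        2 * count (elements S) (λ s → thin (lookup s i)) ≤⟨ *-monoʳ-≤ 2 thin≤ ⟩
        2 * (h * count (elements S) keep) ≡⟨ *-assoc 2 h _ ⟨
        2 * h * count (elements S) keep ≡⟨ cong (2 * h *_) (length-filterᵇ (elements S) keep) ⟨
        2 * h * length T ∎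
        where
        open ≤-Reasoning
        split : n + n ≡ 2 * count (elements S) (λ s → thin (lookup s i)) + 2 * ∣ A ∣
        split = trans (cong (n +_) (sym (+-identityʳ n))) (trans (cong (2 *_) (trans (length-∑ (elements S))
          (trans (∑-cong (elements S) (λ {s} _ → ⊙-split true (thin (lookup s i)) 1)) (trans (∑-+ (elements S) _ _)
            (cong (count (elements S) (λ s → thin (lookup s i)) +_) (sym (length-filterᵇ (elements S) _))))))) (*-distribˡ-+ 2 (count (elements S) (λ s → thin (lookup s i))) ∣ A ∣))
        thin≤ : count (elements S) (λ s → thin (lookup s i)) ≤ h * count (elements S) keep
        thin≤ = ≤-≡ (∑-fibrewise (coord i) (elements S) by-fibre) (sym (∑-*ˡ (elements S) h _))
          where
          by-fibre : ∀ y → count (fib (coord i) y (elements S)) (λ s → thin (lookup s i))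
              ≤ ∑ (fib (coord i) y (elements S)) (λ s → h * keep s ⊙ 1)
          by-fibre y = go (fib (coord i) y (elements S)) refl
            where
            go : ∀ F → fib (coord i) y (elements S) ≡ F → count F (λ s → thin (lookup s i)) ≤ ∑ F (λ s → h * keep s ⊙ 1)
            go [] _ = z≤n
            go F@(s ∷ _) eq with ∈-fibre⁻ (coord i) {y} {elements S} {s} (subst (s ∈_) (sym eq) (here refl))
            ... | (_ , refl) = begin
              count F (λ z → thin (lookup z i)) ≡⟨ ∑-cong F (λ {z} z∈ → cong (λ x → thin x ⊙ 1) (same {z} z∈)) ⟩
              ∑ F (λ _ → thin x ⊙ 1) ≡⟨ trans (∑-const F (thin x ⊙ 1)) (⊙-*ˡ (thin x) (length F) 1) ⟩
              thin x ⊙ (length F * 1) ≤⟨ ⊙-monoʳ (thin x) (≡-≤ (trans (*-identityʳ _)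
                  (trans (cong length (sym eq)) (↭-length (fibre↭ i s S)))) (branch-large x)) ⟩
              thin x ⊙ (h * length (branch x)) ≤⟨ ⊙-monoʳ (thin x) (*-monoʳ-≤ h branch≤) ⟩
              thin x ⊙ (h * count F (λ z → does (z ∈? branch x))) ≡⟨ ⊙-*ˡ (thin x) h _ ⟨
              h * thin x ⊙ count F (λ z → does (z ∈? branch x)) ≡⟨ cong (h *_) (∑-⊙ F (thin x) _) ⟨
              h * ∑ F (λ z → thin x ⊙ (does (z ∈? branch x) ⊙ 1)) ≡⟨ cong (h *_) (∑-cong F (λ {z} z∈ →
                  trans (sym (⊙-∧ (thin x) _ 1)) (cong (λ x → (thin x ∧ does (z ∈? branch x)) ⊙ 1) (sym (same z∈))))) ⟩
              h * count F keep ≡⟨ ∑-*ˡ F h _ ⟩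
              ∑ F (λ z → h * keep z ⊙ 1) ∎
              where
              x = lookup s i
              same : ∀ {z} → z ∈ F → lookup z i ≡ x
              same {z} z∈ = proj₂ (∈-coord-fibre i {s} {z} {elements S} (subst (z ∈_) (sym eq) z∈))
              q : Point N d → Bool
              q z = does (z ∈? branch x)
              branch≤ : length (branch x) ≤ count F q
              branch≤ = ≤-reflexive (trans (↭-length (same-elements⇒↭ (branch-unique x)
                (filterᵇ-unique q (subst Unique eq (filterᵇ-unique _ (unique S))))
                (λ {z} z∈ → let (z∈S , e) = in-branch z∈ in
                   ∈-filterᵇ⁺ q (subst (z ∈_) eq (coord-fibre-∈ i {s} {z} z∈S e)) (dec-true (z ∈? branch x) z∈))
                (λ {z} z∈ → holds (z ∈? branch x) (proj₂ (∈-filterᵇ⁻ q {F} z∈))))) (length-filterᵇ F q))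

      prune : Pruned (suc k) (2 * h) (elements S)
      prune = T , node (coord i) (λ {p} {s} {t} → coord-compatible i {p} {s} {t})
          (λ y → by-fibre y _ refl) (λ y → tree y _ refl)
        , filterᵇ-unique keep (unique S) , (λ z∈ → proj₁ (∈-filterᵇ⁻ keep z∈)) , T-large
        where
        member : ∀ y s {F} → fib (coord i) y T ≡ s ∷ F → s ∈ T × coord i s ≡ y
        member y s eq = ∈-fibre⁻ (coord i) {y} {T} {s} (subst (s ∈_) (sym eq) (here refl))
        by-fibre : ∀ y F → fib (coord i) y T ≡ F → K * length F ≤ length T
        by-fibre y [] _ = *0≤ K
        by-fibre y F@(s ∷ _) eq with member y s eq
        ... | (s∈T , refl) = *-cancelˡ-≤ (2 * h) {{>-nonZero (*-mono-< {0} {2} z<s h-positive)}} (begin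
          2 * h * (K * length F) ≡⟨ *-assoc (2 * h) K _ ⟨
          K₁ * length F ≡⟨ cong (λ v → K₁ * length v) eq ⟨
          K₁ * length (fib (coord i) (coord i s) T) ≡⟨ cong (K₁ *_) (↭-length (fibre-of-T s s∈T)) ⟩
          K₁ * length (branch (lookup s i)) ≤⟨ *-monoʳ-≤ K₁ (branch-small (lookup s i)) ⟩
          K₁ * ∣ fibre i (lookup s i) S ∣ ≤⟨ holds (_ ≤? n) (∧-left (thin (lookup s i)) (proj₂ (∈-filterᵇ⁻ keep {elements S} s∈T))) ⟩
          n ≤⟨ T-large ⟩
          2 * h * length T ∎)
          where open ≤-Reasoning
        tree : ∀ y F → fib (coord i) y T ≡ F → fib (coord i) y T ≡ [] ⊎ Branching k (fib (coord i) y T)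
        tree y [] eq = inj₁ eq
        tree y (s ∷ _) eq with member y s eq
        ... | (s∈T , refl) = inj₂ (Branching-resp-↭ (↭-sym (fibre-of-T s s∈T)) (branch-tree (lookup s i)
            (holds (s ∈? branch (lookup s i)) (∧-right (thin (lookup s i)) (proj₂ (∈-filterᵇ⁻ keep {elements S} s∈T))))))

-- Comparisons with real numbers

open import Data.Integer using (+_; -[1+_])

-- Cross-multiplication is done with unnormalised rationals, where numerator and denominator are
-- visible; normal forms enter only through their equivalence with these.
module Fraction (a b : ℕ) where

  q : ℚ
  q = + a ℚ./ suc b

  scaled : ∀ n → ℚ.toℚᵘ (q ℚ.* ℕ→ℚ n) ℚᵘ.≃ mkℚᵘ (+ (a * n)) b
  scaled n = ℚᵘ.≃-trans (ℚ.toℚᵘ-homo-* q (ℕ→ℚ n))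
    (ℚᵘ.≃-trans (ℚᵘ.*-cong (ℚ.toℚᵘ-fromℚᵘ (mkℚᵘ (+ a) b)) (ℚ.toℚᵘ-fromℚᵘ (mkℚᵘ (+ n) 0)))
      (ℚᵘ.*≡* (cong₂ ℤ._*_ (sym (ℤ.pos-* a n)) (cong +_ (sym (*-identityʳ (suc b)))))))

  natural : ∀ m → ℚ.toℚᵘ (ℕ→ℚ m) ℚᵘ.≃ mkℚᵘ (+ m) 0
  natural m = ℚ.toℚᵘ-fromℚᵘ (mkℚᵘ (+ m) 0)

  to-nat : ∀ x → + x ℤ.* + 1 ≡ + x
  to-nat x = ℤ.*-identityʳ (+ x)

  scaled≤ : ∀ {m n} → a * n ≤ m * suc b → q ℚ.* ℕ→ℚ n ℚ.≤ ℕ→ℚ m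
  scaled≤ {m} {n} le = ℚ.toℚᵘ-cancel-≤ (ℚᵘ.≤-respˡ-≃ (ℚᵘ.≃-sym (scaled n)) (ℚᵘ.≤-respʳ-≃ (ℚᵘ.≃-sym (natural m))
    (ℚᵘ.*≤* (subst₂ ℤ._≤_ (sym (to-nat (a * n))) (ℤ.pos-* m (suc b)) (ℤ.+≤+ le)))))

  scaled≤⁻¹ : ∀ {m n} → q ℚ.* ℕ→ℚ n ℚ.≤ ℕ→ℚ m → a * n ≤ m * suc b
  scaled≤⁻¹ {m} {n} le with ℚᵘ.≤-respˡ-≃ (scaled n) (ℚᵘ.≤-respʳ-≃ (natural m) (ℚ.toℚᵘ-mono-≤ le))
  ... | ℚᵘ.*≤* le′ = ℤ.drop‿+≤+ (subst₂ ℤ._≤_ (to-nat (a * n)) (sym (ℤ.pos-* m (suc b))) le′)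

  ≤scaled : ∀ {m n} → m * suc b ≤ a * n → ℕ→ℚ m ℚ.≤ q ℚ.* ℕ→ℚ n
  ≤scaled {m} {n} le = ℚ.toℚᵘ-cancel-≤ (ℚᵘ.≤-respʳ-≃ (ℚᵘ.≃-sym (scaled n)) (ℚᵘ.≤-respˡ-≃ (ℚᵘ.≃-sym (natural m))
    (ℚᵘ.*≤* (subst₂ ℤ._≤_ (ℤ.pos-* m (suc b)) (sym (to-nat (a * n))) (ℤ.+≤+ le)))))

  <scaled : ∀ {m n} → m * suc b < a * n → ℕ→ℚ m ℚ.< q ℚ.* ℕ→ℚ n
  <scaled {m} {n} lt = ℚ.toℚᵘ-cancel-< (ℚᵘ.<-respʳ-≃ (ℚᵘ.≃-sym (scaled n)) (ℚᵘ.<-respˡ-≃ (ℚᵘ.≃-sym (natural m))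
    (ℚᵘ.*<* (subst₂ ℤ._<_ (ℤ.pos-* m (suc b)) (sym (to-nat (a * n))) (ℤ.+<+ lt)))))

  <scaled⁻¹ : ∀ {m n} → ℕ→ℚ m ℚ.< q ℚ.* ℕ→ℚ n → m * suc b < a * n
  <scaled⁻¹ {m} {n} lt with ℚᵘ.<-respʳ-≃ (scaled n) (ℚᵘ.<-respˡ-≃ (natural m) (ℚ.toℚᵘ-mono-< lt))
  ... | ℚᵘ.*<* lt′ = ℤ.drop‿+<+ (subst₂ ℤ._<_ (sym (ℤ.pos-* m (suc b))) (to-nat (a * n)) lt′)

ℕ→ℚ-nonNeg : ∀ n → ℚ.NonNegative (ℕ→ℚ n)
ℕ→ℚ-nonNeg n = ℚ.nonNegative (ℚ.≤-trans (ℚ.≤-reflexive (sym (ℚ.*-zeroˡ (ℕ→ℚ n)))) (Fraction.scaled≤ 0 0 {n} {n} z≤n))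

ℕ→ℚ-pos : ∀ n .{{_ : NonZero n}} → ℚ.Positive (ℕ→ℚ n)
ℕ→ℚ-pos n@(suc k) = ℚ.positive (subst (0ℚ ℚ.<_) (ℚ.*-identityʳ (ℕ→ℚ n)) (Fraction.<scaled n 0 {0} {1} (s≤s z≤n)))

*-monoʳ-ℕ→ℚ : ∀ {p q} n → p ℚ.≤ q → p ℚ.* ℕ→ℚ n ℚ.≤ q ℚ.* ℕ→ℚ n
*-monoʳ-ℕ→ℚ n = ℚ.*-monoʳ-≤-nonNeg (ℕ→ℚ n) {{ℕ→ℚ-nonNeg n}}

below-positive : ∀ q → 0ℚ ℚ.< q → ∃[ b ] + 1 ℚ./ suc b ℚ.< q
below-positive (mkℚ (+ zero) d _) 0<q = contradiction (ℚ.toℚᵘ-mono-< 0<q) λ { (ℚᵘ.*<* (ℤ.+<+ ())) }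
below-positive (mkℚ -[1+ n ] d _) 0<q = contradiction (ℚ.toℚᵘ-mono-< 0<q) λ { (ℚᵘ.*<* ()) }
below-positive (mkℚ (+ suc n) d _) _ = suc d , ℚ.toℚᵘ-cancel-< (ℚᵘ.<-respˡ-≃ (ℚᵘ.≃-sym (ℚ.toℚᵘ-fromℚᵘ (mkℚᵘ (+ 1) (suc d))))
  (ℚᵘ.*<* (subst₂ ℤ._<_ (ℤ.pos-* 1 (suc d)) (ℤ.pos-* (suc n) (2+ d))
    (ℤ.+<+ (≤-trans (s≤s (≤-reflexive (*-identityˡ (suc d)))) (m≤n*m (2+ d) (suc n)))))))

above : ∀ q → ∃[ a ] q ℚ.≤ + suc a ℚ./ 1
above (mkℚ -[1+ n ] d _) = 0 , ℚ.toℚᵘ-cancel-≤ (ℚᵘ.≤-respʳ-≃ (ℚᵘ.≃-sym (ℚ.toℚᵘ-fromℚᵘ (mkℚᵘ (+ 1) 0))) (ℚᵘ.*≤* ℤ.-≤+))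
above (mkℚ (+ n) d _) = n , ℚ.toℚᵘ-cancel-≤ (ℚᵘ.≤-respʳ-≃ (ℚᵘ.≃-sym (ℚ.toℚᵘ-fromℚᵘ (mkℚᵘ (+ suc n) 0)))
  (ℚᵘ.*≤* (subst₂ ℤ._≤_ (ℤ.pos-* n 1) (ℤ.pos-* (suc n) (suc d))
    (ℤ.+≤+ (≤-trans (≤-reflexive (*-identityʳ n)) (≤-trans (n≤1+n n) (m≤m*n (suc n) (suc d))))))))

positive-fraction : ∀ x → Positive x → ∃[ b ] Lower x (+ 1 ℚ./ suc b)
positive-fraction x pos = let (q , 0<q , q<x) = lower-open x pos
                              (b , lt) = below-positive q 0<q
                          in b , lower-closed x lt q<x

≥1ℝ : ∀ m → m ≥[ 1ℝ · m ]
≥1ℝ m q q<1 = ℚ.≤-trans (*-monoʳ-ℕ→ℚ m (ℚ.<⇒≤ q<1)) (Fraction.scaled≤ 1 0 {m} {m} (≤-reflexive (*-comm 1 m)))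

≥·0 : ∀ x → 0 ≥[ x · 0 ]
≥·0 x q _ = ℚ.≤-reflexive (ℚ.*-zeroʳ q)

<·-antimono : ∀ x {m m′ n} → m′ ≤ m → m <[ x · n ] → m′ <[ x · n ]
<·-antimono x {m} {m′} m′≤m (q , lo , lt) = q , lo , ℚ.≤-<-trans
  (subst (ℕ→ℚ m′ ℚ.≤_) (ℚ.*-identityˡ (ℕ→ℚ m)) (Fraction.≤scaled 1 0 {m′} {m}
    (≤-trans (≤-reflexive (*-identityʳ m′)) (≤-trans m′≤m (≤-reflexive (sym (*-identityˡ m))))))) lt

≥·⇒≤ : ∀ x b → Lower x (+ 1 ℚ./ suc b) → ∀ {m n} → m ≥[ x · n ] → n ≤ suc b * m
≥·⇒≤ x b low {m} {n} h = subst₂ _≤_ (*-identityˡ n) (*-comm m (suc b)) (Fraction.scaled≤⁻¹ 1 b {m} {n} (h _ low))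

≥^⇒≤ : ∀ x b → Lower x (+ 1 ℚ./ suc b) → ∀ {m N} → m ≥[ N ^ x ] → N ≤ m ^ suc b
≥^⇒≤ x b low {m} {N} h = ≤-trans (≤-reflexive (sym (*-identityʳ N))) (h 1 (suc b) low)

lower≤upper : ∀ x {p q} → Lower x p → Upper x q → p ℚ.< q
lower≤upper x {p} {q} lo up with ℚ.<-cmp p q
... | tri< p<q _ _ = p<q
... | tri≈ _ refl _ = ⊥-elim (disjoint x lo up)
... | tri> _ _ q<p = ⊥-elim (disjoint x (lower-closed x q<p lo) up)

natural-upper-bound : ∀ x → ∃[ a ] (∀ {m n} → m <[ x · n ] → m ≤ suc a * n)
natural-upper-bound x = let (q , up) = upper-inhabited x ; (a , q≤a) = above q in a ,
  λ { {m} {n} (r , lo , lt) → subst (_≤ suc a * n) (*-identityʳ m) (<⇒≤ (Fraction.<scaled⁻¹ (suc a) 0 {m} {n}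
        (ℚ.<-≤-trans lt (*-monoʳ-ℕ→ℚ n (ℚ.≤-trans (ℚ.<⇒≤ (lower≤upper x lo up)) q≤a))))) }

-- A cut can be located only between two different rationals, here m / n and (m + 1) / n. Hence the
-- gap of one.
<·-dichotomy : ∀ x m n .{{_ : NonZero n}} → m <[ x · n ] ⊎ suc m ≥[ x · n ]
<·-dichotomy x m n@(suc n-1) with located x (ℚ.*-cancelʳ-<-nonNeg (ℕ→ℚ n) {{ℕ→ℚ-nonNeg n}} {+ m ℚ./ n} {+ suc m ℚ./ n} m/n<)
  where
  m/n< : (+ m ℚ./ n) ℚ.* ℕ→ℚ n ℚ.< (+ suc m ℚ./ n) ℚ.* ℕ→ℚ n
  m/n< = ℚ.≤-<-trans (Fraction.scaled≤ m n-1 {m} {n} ≤-refl) (Fraction.<scaled (suc m) n-1 {m} {n} (*-monoˡ-< n (n<1+n m)))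
... | inj₁ lo = let (r , lt , lo′) = lower-open x lo in inj₁ (r , lo′ ,
  ℚ.≤-<-trans (Fraction.≤scaled m n-1 {m} {n} ≤-refl) (ℚ.*-monoˡ-<-pos (ℕ→ℚ n) {{ℕ→ℚ-pos n}} {+ m ℚ./ n} {r} lt))
... | inj₂ up = inj₂ λ q lo → ℚ.≤-trans (*-monoʳ-ℕ→ℚ {q} {+ suc m ℚ./ n} n (ℚ.<⇒≤ (lower≤upper x lo up))) (Fraction.scaled≤ (suc m) n-1 {suc m} {n} ≤-refl)

-- Without a gap, but at the price of replacing x by the smaller rational 1 / (b + 1) in the second
-- alternative.
<·-or-≤ : ∀ x b → Lower x (+ 1 ℚ./ suc b) → ∀ m n → m <[ x · n ] ⊎ n ≤ suc b * m
<·-or-≤ x b low m n with n ≤? suc b * m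
... | yes le = inj₂ le
... | no ¬le = inj₁ (_ , low , Fraction.<scaled 1 b {m} {n} (subst₂ _<_ (*-comm (suc b) m) (sym (*-identityˡ n)) (≰⇒> ¬le)))

>·-complement : ∀ x {z m n} → z + m ≡ n → m <[ x · n ] → z >[ 1ℚ ⊖ x · n ]
>·-complement x {z} {m} {n} refl (r , lo , lt) = 1ℚ ℚ.- r , subst (Lower x) (sym involutive) lo ,
  subst₂ ℚ._<_ (sym distrib) z≡ (ℚ.+-monoʳ-< (ℕ→ℚ n) (ℚ.neg-antimono-< lt))
  where
  open ≡-Reasoning
  involutive : 1ℚ ℚ.- (1ℚ ℚ.- r) ≡ r
  involutive = begin
    1ℚ ℚ.- (1ℚ ℚ.- r) ≡⟨ cong (1ℚ ℚ.+_) (ℚ.neg-distrib-+ 1ℚ (ℚ.- r)) ⟩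
    1ℚ ℚ.+ (ℚ.- 1ℚ ℚ.+ ℚ.- (ℚ.- r)) ≡⟨ ℚ.+-assoc 1ℚ (ℚ.- 1ℚ) (ℚ.- (ℚ.- r)) ⟨
    0ℚ ℚ.+ ℚ.- (ℚ.- r) ≡⟨ ℚ.+-identityˡ (ℚ.- (ℚ.- r)) ⟩
    ℚ.- (ℚ.- r) ≡⟨ neg-neg r ⟩
    r ∎
    where
    neg-neg : ∀ r → ℚ.- (ℚ.- r) ≡ r
    neg-neg (mkℚ (+ zero) _ _) = refl
    neg-neg (mkℚ (+ suc _) _ _) = refl
    neg-neg (mkℚ -[1+ _ ] _ _) = refl
  distrib : (1ℚ ℚ.- r) ℚ.* ℕ→ℚ n ≡ ℕ→ℚ n ℚ.- r ℚ.* ℕ→ℚ n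
  distrib = trans (ℚ.*-distribʳ-+ (ℕ→ℚ n) 1ℚ (ℚ.- r)) (cong₂ ℚ._+_ (ℚ.*-identityˡ (ℕ→ℚ n)) (sym (ℚ.neg-distribˡ-* r (ℕ→ℚ n))))
  sum : ℕ→ℚ (z + m) ≡ ℕ→ℚ z ℚ.+ ℕ→ℚ m
  sum = ℚ.toℚᵘ-injective (ℚᵘ.≃-trans (ℚ.toℚᵘ-fromℚᵘ (mkℚᵘ (+ (z + m)) 0)) (ℚᵘ.≃-sym (ℚᵘ.≃-trans (ℚ.toℚᵘ-homo-+ (ℕ→ℚ z) (ℕ→ℚ m))
    (ℚᵘ.≃-trans (ℚᵘ.+-cong (ℚ.toℚᵘ-fromℚᵘ (mkℚᵘ (+ z) 0)) (ℚ.toℚᵘ-fromℚᵘ (mkℚᵘ (+ m) 0)))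
      (ℚᵘ.*≡* (cong (ℤ._* + 1) (trans (cong₂ ℤ._+_ (ℤ.*-identityʳ (+ z)) (ℤ.*-identityʳ (+ m))) (sym (ℤ.pos-+ z m)))))))))
  z≡ : ℕ→ℚ n ℚ.- ℕ→ℚ m ≡ ℕ→ℚ z
  z≡ = begin
    ℕ→ℚ (z + m) ℚ.- ℕ→ℚ m ≡⟨ cong (ℚ._- ℕ→ℚ m) sum ⟩
    ℕ→ℚ z ℚ.+ ℕ→ℚ m ℚ.- ℕ→ℚ m ≡⟨ ℚ.+-assoc (ℕ→ℚ z) (ℕ→ℚ m) _ ⟩
    ℕ→ℚ z ℚ.+ (ℕ→ℚ m ℚ.- ℕ→ℚ m) ≡⟨ cong (ℕ→ℚ z ℚ.+_) (ℚ.+-inverseʳ (ℕ→ℚ m)) ⟩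
    ℕ→ℚ z ℚ.+ 0ℚ ≡⟨ ℚ.+-identityʳ (ℕ→ℚ z) ⟩
    ℕ→ℚ z ∎

-- Interpolation

rem-+ : ∀ p {a a′ b b′} → rem p a ≡ rem p a′ → rem p b ≡ rem p b′ → rem p (a + b) ≡ rem p (a′ + b′)
rem-+ zero e e′ = cong₂ _+_ e e′
rem-+ p@(suc _) {a} {a′} {b} {b′} e e′ = trans (%-distribˡ-+ a b p)
  (trans (cong₂ (λ x y → (x + y) % p) e e′) (sym (%-distribˡ-+ a′ b′ p)))

rem-* : ∀ p {a a′ b b′} → rem p a ≡ rem p a′ → rem p b ≡ rem p b′ → rem p (a * b) ≡ rem p (a′ * b′)
rem-* zero e e′ = cong₂ _*_ e e′
rem-* p@(suc _) {a} {a′} {b} {b′} e e′ = trans (%-distribˡ-* a b p)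
  (trans (cong₂ (λ x y → (x * y) % p) e e′) (sym (%-distribˡ-* a′ b′ p)))

rem-^ : ∀ p {a a′} n → rem p a ≡ rem p a′ → rem p (a ^ n) ≡ rem p (a′ ^ n)
rem-^ p zero e = refl
rem-^ p {a} {a′} (suc n) e = rem-* p {a} {a′} e (rem-^ p {a} {a′} n e)

funToFin-cong : ∀ {m n} {f g : Fin m → Fin n} → (∀ i → f i ≡ g i) → funToFin f ≡ funToFin g
funToFin-cong {zero} h = refl
funToFin-cong {suc m} h = cong₂ Fin.combine (h Fin.zero) (funToFin-cong (h ∘ Fin.suc))

finToFun-distinguishes : ∀ m n {i j : Fin (n ^ m)} → i ≢ j → ∃[ u ] finToFun {n} {m} i u ≢ finToFun {n} {m} j u
finToFun-distinguishes m n {i} {j} i≢j = Fin.¬∀⟶∃¬ m _ (λ u → finToFun {n} {m} i u Fin.≟ finToFun {n} {m} j u)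
  λ same → i≢j (trans (sym (Fin.funToFin-finToFin {m} {n} i)) (trans (funToFin-cong same) (Fin.funToFin-finToFin {m} {n} j)))

index-lookup : ∀ {A : Set} {xs : List A} → Unique xs → ∀ u (x∈ : List.lookup xs u ∈ xs) → Any.index x∈ ≡ u
index-lookup {xs = xs} uniq u x∈ = trans (cong Any.index (unique⇒irrelevant uniq x∈ (∈-lookup {xs = xs} u))) (go xs u)
  where
  go : ∀ {A : Set} (xs : List A) u → Any.index (∈-lookup {xs = xs} u) ≡ u
  go (x ∷ xs) Fin.zero = refl
  go (x ∷ xs) (Fin.suc u) = cong Fin.suc (go xs u)

-- Exponents up to D in the first m variables and 0 in the others. Thus neither the degree nor, for
-- m ≤ d, the number of monomials depends on d.
exponents : ∀ d (m D : ℕ) → List (Vec ℕ d)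
exponents zero m D = [] ∷ []
exponents (suc d) zero D = map (0 ∷_) (exponents d 0 D)
exponents (suc d) (suc m) D = cartesianProductWith _∷_ (upTo (suc D)) (exponents d m D)

length-cartesianProductWith : ∀ {A B C : Set} (f : A → B → C) xs ys → length (cartesianProductWith f xs ys) ≡ length xs * length ys
length-cartesianProductWith f [] ys = refl
length-cartesianProductWith f (x ∷ xs) ys = trans (length-++ (map (f x) ys))
  (cong₂ _+_ (length-map (f x) ys) (length-cartesianProductWith f xs ys))

exponents-length : ∀ {d m} D → m ≤ d → length (exponents d m D) ≡ suc D ^ m
exponents-length {zero} {zero} D _ = refl
exponents-length {suc d} {zero} D _ = trans (length-map (0 ∷_) (exponents d 0 D)) (exponents-length {d} D z≤n)
exponents-length {suc d} {suc m} D (s≤s m≤d) = trans (length-cartesianProductWith _∷_ (upTo (suc D)) (exponents d m D))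
  (cong₂ _*_ (length-upTo (suc D)) (exponents-length D m≤d))

exponents-unique : ∀ d m D → Unique (exponents d m D)
exponents-unique zero m D = [] ∷ []
exponents-unique (suc d) zero D = Unique.map⁺ (λ eq → proj₂ (Vec.∷-injective eq)) (exponents-unique d 0 D)
exponents-unique (suc d) (suc m) D =
  Unique.cartesianProductWith⁺ _∷_ Vec.∷-injective (Unique.upTo⁺ (suc D)) (exponents-unique d m D)

exponents-sum : ∀ d m D {e} → e ∈ exponents d m D → Vec.sum e ≤ m * D
exponents-sum zero m D (here refl) = z≤n
exponents-sum (suc d) zero D e∈ with ∈-map⁻ (0 ∷_) e∈
... | (e , e∈′ , refl) = exponents-sum d 0 D e∈′
exponents-sum (suc d) (suc m) D e∈ with ∈-cartesianProductWith⁻ _∷_ (upTo (suc D)) (exponents d m D) e∈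
... | (a , e , a∈ , e∈′ , refl) = +-mono-≤ (s≤s⁻¹ (∈-upTo⁻ a∈)) (exponents-sum d m D e∈′)

module Siegel (N d : ℕ) where
  open Points N d using (class; class⇒rem)

  power : ∀ {d} → Vec ℕ d → Point N d → ℕ
  power [] [] = 1
  power (a ∷ e) (x ∷ v) = toℕ x ^ a * power e v

  power≡monomial : ∀ {d} (e : Vec ℕ d) v → monomial e (Vec.map (λ a → + toℕ a) v) ≡ + power e v
  power≡monomial [] [] = refl
  power≡monomial (a ∷ e) (x ∷ v) = trans (cong₂ ℤ._*_ (pos-^ (toℕ x) a) (power≡monomial e v)) (sym (ℤ.pos-* (toℕ x ^ a) _))
    where
    pos-^ : ∀ b n → (+ b) ℤ.^ n ≡ + (b ^ n)
    pos-^ b zero = refl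
    pos-^ b (suc n) = trans (cong (+ b ℤ.*_) (pos-^ b n)) (sym (ℤ.pos-* b (b ^ n)))

  power≤ : ∀ .{{_ : NonZero N}} {d} (e : Vec ℕ d) v → power e v ≤ N ^ Vec.sum e
  power≤ [] [] = ≤-refl
  power≤ (a ∷ e) (x ∷ v) = ≤-≡ (*-mono-≤ (^-monoˡ-≤ a (s≤s⁻¹ (Fin.toℕ<n x))) (power≤ e v))
    (sym (^-distribˡ-+-* N a (Vec.sum e)))

  power-class : ∀ p {d} (e : Vec ℕ d) {s t : Point N d} → (∀ i → rem p (toℕ (lookup s i)) ≡ rem p (toℕ (lookup t i))) →
    rem p (power e s) ≡ rem p (power e t)
  power-class p [] {[]} {[]} h = refl
  power-class p (a ∷ e) {x ∷ s} {y ∷ t} h =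
    rem-* p {toℕ x ^ a} {toℕ y ^ a} (rem-^ p {toℕ x} {toℕ y} a (h Fin.zero)) (power-class p e {s} {t} (h ∘ Fin.suc))

  power-local : ∀ d m D {e} → e ∈ exponents d m D → ∀ {s t : Point N d} →
    (∀ i → toℕ i < m → lookup s i ≡ lookup t i) → power e s ≡ power e t
  power-local zero m D (here refl) {[]} {[]} h = refl
  power-local (suc d) zero D e∈ {x ∷ s} {y ∷ t} h with ∈-map⁻ (0 ∷_) e∈
  ... | (e , e∈′ , refl) = cong (1 *_) (power-local d 0 D e∈′ {s} {t} (λ _ ()))
  power-local (suc d) (suc m) D e∈ {x ∷ s} {y ∷ t} h with ∈-cartesianProductWith⁻ _∷_ (upTo (suc D)) (exponents d m D) e∈
  ... | (a , e , a∈ , e∈′ , refl) = cong₂ _*_ (cong (λ v → toℕ v ^ a) (h Fin.zero z<s))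
    (power-local d m D e∈′ {s} {t} (λ i lt → h (Fin.suc i) (s≤s lt)))

  -- Records what later arguments use of the shape of f: `periodic` makes its zero set closed, and
  -- `local` spreads zeros along the variables that do not occur.
  record Interpolant (m D H : ℕ) (zs : List (Point N d)) : Set where
    field
      f : Polynomial d
      nonzero : Nonzero f
      degree : DegreeAtMost (m * D) f
      coefficients : CoefficientsAtMost H f
      -- The values of f are differences of these two natural numbers.
      plus minus : Point N d → ℕ
      zero-value : ∀ v → plus v ≡ minus v → eval f (Vec.map (λ a → + toℕ a) v) ≡ 0ℤ
      vanishes : ∀ {z} → z ∈ zs → plus z ≡ minus z
      periodic : ∀ {p s t} → class p s ≡ class p t → plus t ≡ minus t → p ∣ ∣ plus s - minus s ∣
      local : ∀ {s t} → (∀ i → toℕ i < m → lookup s i ≡ lookup t i) → plus t ≡ minus t → plus s ≡ minus s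
      bounded : ∀ v → ∣ plus v - minus v ∣ ≤ length (exponents d m D) * (H * N ^ (m * D))

    Zero : Point N d → Set
    Zero v = plus v ≡ minus v

  -- Siegel's lemma. Coefficient vectors with entries up to H outnumber the possible vectors of
  -- values at `zs`, so two of them share all values there, and f is their difference.
  siegel : ∀ .{{_ : NonZero N}} m D H zs →
    suc (length (exponents d m D) * (H * N ^ (m * D))) ^ length zs < suc H ^ length (exponents d m D) →
    Interpolant m D H zs
  siegel m D H zs enough = record
    { f = record
      { coeff = λ e → + coefficient i e ℤ.- + coefficient j e
      ; support = record { elements = es ; unique = exponents-unique d m D }
      ; supported = supported′
      }
    ; nonzero = List.lookup es u , distinct
    ; degree = λ e ne → exponents-sum d m D (supported′ e ne)
    ; coefficients = λ e → ≡-≤ (cong ℤ.∣_∣ (ℤ.[+m]-[+n]≡m⊖n (coefficient i e) (coefficient j e)))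
        (≤-trans (ℤ.∣m⊝n∣≤m⊔n (coefficient i e) (coefficient j e)) (⊔-lub (coefficient≤ i e) (coefficient≤ j e)))
    ; plus = value i
    ; minus = value j
    ; zero-value = λ v eq → trans (eval≡ v es) (ℤ.i≡j⇒i-j≡0 (cong +_ eq))
    ; vanishes = agree
    ; periodic = λ {p} {s} {t} st eq → rem≡⇒∣ p (value i s) (value j s)
        (trans (value-class p i {s} {t} st) (trans (cong (rem p) eq) (sym (value-class p j {s} {t} st))))
    ; local = λ {s} {t} h eq → trans (value-local i {s} {t} h) (trans eq (sym (value-local j {s} {t} h)))
    ; bounded = λ v → ≤-trans (∣m-n∣≤m⊔n (value i v) (value j v)) (⊔-lub (value≤ i v) (value≤ j v))
    }
    where
    open DecMembership (Vec.≡-dec {n = d} _≟_) using (_∈?_)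
    es = exponents d m D
    U = length es
    X = U * (H * N ^ (m * D))

    at : Fin (suc H ^ U) → ∀ {e} → Dec (e ∈ es) → ℕ
    at i (yes e∈) = toℕ (finToFun {suc H} {U} i (Any.index e∈))
    at i (no _) = 0

    coefficient : Fin (suc H ^ U) → Vec ℕ d → ℕ
    coefficient i e = at i (e ∈? es)

    coefficient≤ : ∀ i e → coefficient i e ≤ H
    coefficient≤ i e with e ∈? es
    ... | yes e∈ = s≤s⁻¹ (Fin.toℕ<n (finToFun {suc H} {U} i (Any.index e∈)))
    ... | no _ = z≤n

    value : Fin (suc H ^ U) → Point N d → ℕ
    value i v = ∑ es (λ e → coefficient i e * power e v)

    value≤ : ∀ i v → value i v ≤ X
    value≤ i v = ∑-≤-const es (H * N ^ (m * D)) λ {e} e∈ →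
      *-mono-≤ (coefficient≤ i e) (≤-trans (power≤ e v) (^-monoʳ-≤ N (exponents-sum d m D e∈)))

    values : Fin (suc H ^ U) → Fin (suc X ^ length zs)
    values i = funToFin (λ k → fromℕ< (s≤s (value≤ i (List.lookup zs k))))

    collision = Fin.pigeonhole enough values
    i = proj₁ collision
    j = proj₁ (proj₂ collision)

    i≢j : i ≢ j
    i≢j = Fin.<⇒≢ (proj₁ (proj₂ (proj₂ collision)))

    agree : ∀ {z} → z ∈ zs → value i z ≡ value j z
    agree {z} z∈ = subst (λ v → value i v ≡ value j v) (sym (lookup-index z∈)) (begin
      value i y ≡⟨ Fin.toℕ-fromℕ< (s≤s (value≤ i y)) ⟨
      toℕ (fromℕ< (s≤s (value≤ i y))) ≡⟨ cong toℕ (Fin.finToFun-funToFin (λ k → fromℕ< (s≤s (value≤ i (List.lookup zs k)))) q) ⟨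
      toℕ (finToFun {suc X} (values i) q) ≡⟨ cong (λ v → toℕ (finToFun {suc X} v q)) (proj₂ (proj₂ (proj₂ collision))) ⟩
      toℕ (finToFun {suc X} (values j) q) ≡⟨ cong toℕ (Fin.finToFun-funToFin (λ k → fromℕ< (s≤s (value≤ j (List.lookup zs k)))) q) ⟩
      toℕ (fromℕ< (s≤s (value≤ j y))) ≡⟨ Fin.toℕ-fromℕ< (s≤s (value≤ j y)) ⟩
      value j y ∎)
      where
      open ≡-Reasoning
      q = Any.index z∈
      y = List.lookup zs q

    supported′ : ∀ e → + coefficient i e ℤ.- + coefficient j e ≢ 0ℤ → e ∈ es
    supported′ e ne with e ∈? es
    ... | yes e∈ = e∈
    ... | no _ = contradiction refl ne

    u = proj₁ (finToFun-distinguishes U (suc H) i≢j)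

    distinct : + coefficient i (List.lookup es u) ℤ.- + coefficient j (List.lookup es u) ≢ 0ℤ
    distinct eq with List.lookup es u ∈? es
    ... | no ∉ = ∉ (∈-lookup {xs = es} u)
    ... | yes e∈ = proj₂ (finToFun-distinguishes U (suc H) i≢j)
      (subst (λ q → finToFun {suc H} {U} i q ≡ finToFun {suc H} {U} j q) (index-lookup (exponents-unique d m D) u e∈)
        (Fin.toℕ-injective (ℤ.+-injective (ℤ.i-j≡0⇒i≡j _ _ eq))))

    value-class : ∀ p i {s t} → class p s ≡ class p t → rem p (value i s) ≡ rem p (value i t)
    value-class p i {s} {t} st = go es
      where
      go : ∀ xs → rem p (∑ xs (λ e → coefficient i e * power e s)) ≡ rem p (∑ xs (λ e → coefficient i e * power e t))
      go [] = refl
      go (e ∷ xs) = rem-+ p {coefficient i e * power e s} {coefficient i e * power e t}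
        (rem-* p {coefficient i e} {coefficient i e} refl (power-class p e {s} {t} (class⇒rem {p} {s} {t} st))) (go xs)

    value-local : ∀ i {s t} → (∀ c → toℕ c < m → lookup s c ≡ lookup t c) → value i s ≡ value i t
    value-local i {s} {t} h = ∑-cong es λ {e} e∈ → cong (coefficient i e *_) (power-local d m D e∈ {s} {t} h)

    eval≡ : ∀ v xs → List.foldr ℤ._+_ 0ℤ (map (λ e → (+ coefficient i e ℤ.- + coefficient j e) ℤ.* monomial e (Vec.map (λ a → + toℕ a) v)) xs)
        ≡ + ∑ xs (λ e → coefficient i e * power e v) ℤ.- + ∑ xs (λ e → coefficient j e * power e v)
    eval≡ v [] = refl
    eval≡ v (e ∷ xs) = begin
      (+ a ℤ.- + b) ℤ.* monomial e (Vec.map (λ a → + toℕ a) v) ℤ.+ _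
        ≡⟨ cong₂ ℤ._+_ (cong ((+ a ℤ.- + b) ℤ.*_) (power≡monomial e v)) (eval≡ v xs) ⟩
      (+ a ℤ.- + b) ℤ.* + x ℤ.+ (+ r ℤ.- + s) ≡⟨ cong (ℤ._+ (+ r ℤ.- + s)) (expand (+ a) (+ b) (+ x)) ⟩
      + a ℤ.* + x ℤ.- + b ℤ.* + x ℤ.+ (+ r ℤ.- + s) ≡⟨ cong₂ (λ y z → y ℤ.- z ℤ.+ (+ r ℤ.- + s)) (sym (ℤ.pos-* a x)) (sym (ℤ.pos-* b x)) ⟩
      + (a * x) ℤ.- + (b * x) ℤ.+ (+ r ℤ.- + s) ≡⟨ regroup (+ (a * x)) (+ (b * x)) (+ r) (+ s) ⟩
      + (a * x) ℤ.+ + r ℤ.- (+ (b * x) ℤ.+ + s) ≡⟨ cong₂ ℤ._-_ (sym (ℤ.pos-+ (a * x) r)) (sym (ℤ.pos-+ (b * x) s)) ⟩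
      + (a * x + r) ℤ.- + (b * x + s) ∎
      where
      open ≡-Reasoning
      a = coefficient i e
      b = coefficient j e
      x = power e v
      r = ∑ xs (λ e → coefficient i e * power e v)
      s = ∑ xs (λ e → coefficient j e * power e v)
      expand : ∀ a b x → (a ℤ.- b) ℤ.* x ≡ a ℤ.* x ℤ.- b ℤ.* x
      expand a b x = trans (ℤ.*-distribʳ-+ x a (ℤ.- b)) (cong (λ y → a ℤ.* x ℤ.+ y) (sym (ℤ.neg-distribˡ-* b x)))
      regroup : ∀ a b c d → a ℤ.- b ℤ.+ (c ℤ.- d) ≡ a ℤ.+ c ℤ.- (b ℤ.+ d)
      regroup a b c d = trans (ℤ.+-assoc a (ℤ.- b) (c ℤ.- d)) (trans (cong (λ y → a ℤ.+ y)
          (trans (sym (ℤ.+-assoc (ℤ.- b) c (ℤ.- d))) (trans (cong (ℤ._- d) (ℤ.+-comm (ℤ.- b) c)) (ℤ.+-assoc c (ℤ.- b) (ℤ.- d)))))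
        (trans (sym (ℤ.+-assoc a c _)) (cong (λ y → a ℤ.+ c ℤ.+ y) (sym (ℤ.neg-distrib-+ b d)))))

  -- With U coefficients and H = U N ^ (m D), the values are at most H ^ 2. Since H ^ 2 + 1 ≤ (H +
  -- 1) ^ 2, two coefficients per point are enough.
  interpolate : ∀ .{{_ : NonZero N}} m D zs → m ≤ d → 2 * length zs < suc D ^ m →
    Interpolant m D (suc D ^ m * N ^ (m * D)) zs
  interpolate m D zs m≤d few = siegel m D H zs (subst (λ u → suc (u * (H * N ^ (m * D))) ^ length zs < suc H ^ u)
      (sym (exponents-length D m≤d)) (begin-strict
    suc (U * (H * N ^ (m * D))) ^ length zs ≤⟨ ^-monoˡ-≤ (length zs) (≤-trans (s≤s (≤-reflexive (*-swap U H (N ^ (m * D))))) square) ⟩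
    (suc H * suc H) ^ length zs ≡⟨ cong (_^ length zs) (cong (suc H *_) (*-identityʳ (suc H))) ⟨
    (suc H ^ 2) ^ length zs ≡⟨ ^-*-assoc (suc H) 2 (length zs) ⟩
    suc H ^ (2 * length zs) <⟨ ^-monoʳ-< (suc H) (s≤s H-positive) few ⟩
    suc H ^ U ∎))
    where
    open ≤-Reasoning
    U H : ℕ
    U = suc D ^ m
    H = U * N ^ (m * D)
    H-positive : 0 < H
    H-positive = *-mono-< (m^n>0 (suc D) m) (m^n>0 N (m * D))
    square : suc (H * H) ≤ suc H * suc H
    square = s≤s (≤-trans (*-monoʳ-≤ H (n≤1+n H)) (m≤n+m (H * suc H) H))

-- Regular sets

length-⊆ : ∀ {A : Set} {xs ys : List A} → (∀ (x y : A) → Dec (x ≡ y)) → Unique xs → Unique ys →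
  (∀ {z} → z ∈ xs → z ∈ ys) → length xs ≤ length ys
length-⊆ {xs = xs} {ys} _≟_ uxs uys xs⊆ys = begin
  length xs ≡⟨ ↭-length (same-elements⇒↭ uxs (filterᵇ-unique q uys)
      (λ z∈ → ∈-filterᵇ⁺ q (xs⊆ys z∈) (dec-true (_ ∈? xs) z∈))
      (λ z∈ → holds (_ ∈? xs) (proj₂ (∈-filterᵇ⁻ q {ys} z∈)))) ⟩
  length (filterᵇ q ys) ≡⟨ length-filterᵇ ys q ⟩
  count ys q ≤⟨ count≤length ys q ⟩
  length ys ∎
  where
  open ≤-Reasoning
  open import Data.List.Membership.DecPropositional _≟_ using (_∈?_)
  q = λ z → does (z ∈? xs)

two-elements : ∀ {A : Set} {xs : List A} → Unique xs → 2 ≤ length xs → ∃[ x ] ∃[ y ] (x ∈ xs × y ∈ xs × x ≢ y)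
two-elements {xs = x ∷ y ∷ _} ((x≢y ∷ _) ∷ _) _ = x , y , here refl , there (here refl) , x≢y
two-elements {xs = x ∷ []} _ (s≤s ())

fin-list-short : ∀ {d} {cs : List (Fin d)} → Unique cs → length cs ≤ d
fin-list-short {d} uniq = ≤-≡ (length-⊆ Fin._≟_ uniq (Unique.allFin⁺ d) (λ {z} _ → ∈-allFin z)) (length-tabulate id)

module Loss (r : ℕ) where

  -- Per level, passing to `S″` costs a factor r + 1 and pruning its heavy fibres a factor 2.
  loss : ℕ → ℕ
  loss zero = 1
  loss (suc k) = suc r * (2 * loss k)

  loss-positive : ∀ k → 0 < loss k
  loss-positive zero = z<s
  loss-positive (suc k) = *-mono-< {0} {suc r} z<s (*-mono-< {0} {2} z<s (loss-positive k))

  loss-mono : ∀ k → loss k ≤ loss (suc k)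
  loss-mono k = ≤-trans (m≤n*m (loss k) 2) (m≤n*m (2 * loss k) (suc r))

module RegularSets {N d : ℕ} (ε ρ : ℝ) (E₀ r : ℕ)
  (ε-bound : ∀ {m} → m ≥[ N ^ ε ] → E₀ ≤ m)
  (ρ-bound : ∀ {m n} → m ≥[ ρ · n ] → n ≤ suc r * m)
  where
  open Points N d

  π-member : ∀ i (S : FinSet (Point N d)) {x} → x ∈ elements (π i S) → ∃[ v ] (v ∈ elements S × x ≡ lookup v i)
  π-member i S x∈ = ∈-map⁻ (λ v → lookup v i) (∈-deduplicate⁻ Fin._≟_ (map (λ v → lookup v i) (elements S)) x∈)

  varying : ∀ i (S : FinSet (Point N d)) → 2 ≤ ∣ π i S ∣ →
    ∃[ s ] ∃[ t ] (s ∈ elements S × t ∈ elements S × lookup s i ≢ lookup t i)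
  varying i S two with two-elements (unique (π i S)) two
  ... | (x , y , x∈ , y∈ , x≢y) with π-member i S x∈ | π-member i S y∈
  ... | (s , s∈ , refl) | (t , t∈ , refl) = s , t , s∈ , t∈ , x≢y

  Constant : List (Fin d) → FinSet (Point N d) → Set
  Constant cs S = ∀ {i} → i ∈ cs → ∀ {s t} → s ∈ elements S → t ∈ elements S → lookup s i ≡ lookup t i

  new-coordinate : ∀ {cs i S} → Constant cs S → ∃[ s ] ∃[ t ] (s ∈ elements S × t ∈ elements S × lookup s i ≢ lookup t i) →
    All (i ≢_) cs
  new-coordinate const (s , t , s∈ , t∈ , ne) = All.tabulate λ { c∈ refl → ne (const c∈ s∈ t∈) }

  Witness : ℕ → ℕ → FinSet (Point N d) → Set
  Witness k n S′ = ∃[ S″ ] (S″ ⊆ S′ × ∣ S″ ∣ ≥[ ρ · n ] × Σ[ i ∈ Fin d ]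
    ((∀ A → A ⊆ S″ → ∣ S″ ∣ ≤ 2 * ∣ A ∣ → ∣ π i A ∣ ≥[ N ^ ε ]) ×
     (∀ x → ∣ fibre i x S″ ∣ ≡ 0 ⊎ Regular (suc k) 1ℝ ε ρ (fibre i x S″))))

  -- Each level of a regular set uses up a coordinate, which is constant from then on.
  coordinates-used : 2 ≤ E₀ → ∀ k S {cs} → Regular (suc k) 1ℝ ε ρ S → Unique cs → Constant cs S → length cs + suc k ≤ d
  coordinates-used-by : 2 ≤ E₀ → ∀ k (S : FinSet (Point N d)) {cs n} → Unique cs → Constant cs S → Witness k n S → length cs + suc (suc k) ≤ d

  coordinates-used two zero S {cs} reg uniq const with two-elements (unique S) (≤-trans two (ε-bound reg))
  ... | (s , t , s∈ , t∈ , s≢t) with differing-coordinate Fin._≟_ s≢t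
  ... | (i , ne) = ≡-≤ (+-comm (length cs) 1)
    (fin-list-short (new-coordinate {cs} {i} {S} const (s , t , s∈ , t∈ , ne) ∷ uniq))
  coordinates-used two (suc k) S {cs} reg uniq const = coordinates-used-by two k S {n = ∣ S ∣} uniq const (reg S (λ z → z) (≥1ℝ ∣ S ∣))

  coordinates-used-by two k S {cs} uniq const (S″ , S″⊆S , _ , i , wide , fibres) =
    let (s , t , s∈ , t∈ , ne) = varying i S″ (≤-trans two (ε-bound (wide S″ (λ z → z) (m≤n*m ∣ S″ ∣ 2))))
        new = new-coordinate {cs} {i} {S} const (s , t , S″⊆S s∈ , S″⊆S t∈ , ne)
    in [ (λ none → contradiction (∈-filter⁺ (λ v → lookup v i Fin.≟ lookup s i) s∈ refl) (empty none))
       , (λ reg → ≡-≤ (+-suc (length cs) (suc k))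
           (coordinates-used two k (fibre i (lookup s i) S″) reg (new ∷ uniq) (constant (lookup s i)))) ]′
       (fibres (lookup s i))
    where
    empty : ∀ {A : Set} {xs : List A} {x} → length xs ≡ 0 → x ∉ xs
    empty {xs = []} _ ()
    constant : ∀ x → Constant (i ∷ cs) (fibre i x S″)
    constant x c∈ {s} {t} u∈ v∈ =
      let (s∈ , s≡) = ∈-filter⁻ (λ v → lookup v i Fin.≟ x) {xs = elements S″} u∈
          (t∈ , t≡) = ∈-filter⁻ (λ v → lookup v i Fin.≟ x) {xs = elements S″} v∈
      in go c∈ s∈ t∈ (trans s≡ (sym t≡))
      where
      go : ∀ {c} → c ∈ i ∷ cs → s ∈ elements S″ → t ∈ elements S″ → lookup s i ≡ lookup t i → lookup s c ≡ lookup t c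
      go (here refl) _ _ eq = eq
      go (there c∈′) s∈ t∈ _ = const c∈′ (S″⊆S s∈) (S″⊆S t∈)

  -- The hypothesis on `∣ S ∣` says that S may itself be taken as `S′`. For η > 1 a nonempty S has
  -- no admissible `S′`, and regularity says nothing.
  coordinates-bound : 2 ≤ E₀ → ∀ k {η} (S : FinSet (Point N d)) → Regular (suc k) η ε ρ S → ∣ S ∣ ≥[ η · ∣ S ∣ ] → suc k ≤ d
  coordinates-bound two zero S reg _ = coordinates-used two zero S reg [] λ ()
  coordinates-bound two (suc k) S reg le = coordinates-used-by two k S {n = ∣ S ∣} [] (λ ()) (reg S (λ z → z) le)

  -- The empty set is admissible as its own `S′`, and then the projection of an empty set would need
  -- at least one value.
  nonempty : 1 ≤ E₀ → ∀ k {η} (S : FinSet (Point N d)) → Regular (suc k) η ε ρ S → ∃[ s ] s ∈ elements S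
  nonempty one zero S reg = member (≤-trans one (ε-bound reg))
    where
    member : ∀ {A : Set} {xs : List A} → 1 ≤ length xs → ∃[ x ] x ∈ xs
    member {xs = x ∷ _} _ = x , here refl
  nonempty one (suc k) {η} S reg = by-cases (elements S) refl
    where
    by-cases : ∀ xs → elements S ≡ xs → ∃[ s ] s ∈ elements S
    by-cases (x ∷ _) eq = x , subst (x ∈_) (sym eq) (here refl)
    by-cases [] eq =
      let (S″ , S″⊆S , _ , i , wide , _) = reg S (λ z → z) (subst (λ xs → length xs ≥[ η · length xs ]) (sym eq) (≥·0 η))
          (_ , x∈) = member (≤-trans one (ε-bound (wide S″ (λ z → z) (m≤n*m ∣ S″ ∣ 2))))
          (v , v∈ , _) = π-member i S″ x∈
      in v , S″⊆S v∈
      where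
      member : ∀ {A : Set} {xs : List A} → 1 ≤ length xs → ∃[ x ] x ∈ xs
      member {xs = x ∷ _} _ = x , here refl

  open Loss r

  module _ (K : ℕ) (K-positive : 0 < K) where
    open Pruning K
    open Trees _≟ₚ_ _≟ᵣ_ class K

    -- Regularity at k = 1 only bounds the size, so each point is its own label and the fibres are
    -- single points.
    branching₁ : ∀ (S : FinSet (Point N d)) → K ≤ ∣ S ∣ → Branching 1 (elements S)
    branching₁ S large = node id (λ eq → eq) light (λ y → child _ (same y) (filterᵇ-unique _ (unique S)))
      where
      same : ∀ y {z} → z ∈ fib id y (elements S) → z ≡ y
      same y {z} z∈ = proj₂ (∈-fibre⁻ id {y} {elements S} {z} z∈)
      child : ∀ {y} F → (∀ {z} → z ∈ F → z ≡ y) → Unique F → F ≡ [] ⊎ Branching 0 F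
      child [] h u = inj₁ refl
      child (s ∷ []) h u = inj₂ (leaf s)
      child (s ∷ t ∷ _) h ((s≢t ∷ _) ∷ _) = contradiction (trans (h (here refl)) (sym (h (there (here refl))))) s≢t
      light : ∀ y → K * length (fib id y (elements S)) ≤ ∣ S ∣
      light y with child _ (same y) (filterᵇ-unique _ (unique S))
      ... | inj₁ none = ≡-≤ (trans (cong (λ F → K * length F) none) (*-zeroʳ K)) z≤n
      ... | inj₂ br = ≡-≤ (trans (cong (K *_) (one br)) (*-identityʳ K)) large
        where
        one : ∀ {F} → Branching 0 F → length F ≡ 1
        one (leaf _) = refl

    regular⇒pruned : ∀ k S → 2 * loss k * K ≤ E₀ → Regular (suc k) 1ℝ ε ρ S → Pruned (suc k) (loss k) (elements S)

    prune-witness : ∀ k {n} S′ → 2 * loss k * K ≤ E₀ → Witness k n S′ →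
      ∃[ T ] (Branching (suc (suc k)) T × Unique T × (∀ {z} → z ∈ T → z ∈ elements S′) × n ≤ loss (suc k) * length T)

    regular⇒pruned zero S small reg = elements S , branching₁ S (≤-trans (≤-trans (m≤n*m K 2) small) (ε-bound reg)) ,
      unique S , (λ z → z) , ≤-reflexive (sym (+-identityʳ _))
    regular⇒pruned (suc k) S small reg =
      prune-witness k S (≤-trans (*-monoˡ-≤ K (*-monoʳ-≤ 2 (loss-mono k))) small) (reg S (λ z → z) (≥1ℝ ∣ S ∣))

    prune-witness k S′ small (S″ , S″⊆S′ , large , i , wide , fibres) =
      let (T , br , uniq , T⊆ , T-large) = prune (suc k) (loss k) (loss-positive k) K-positive S″ i
            (λ A A⊆ half → ≤-trans small (ε-bound (wide A A⊆ half)))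
            (λ x → [ inj₁ , (λ reg → inj₂ (regular⇒pruned k (fibre i x S″) small reg)) ]′ (fibres x))
      in T , br , uniq , (λ z → S″⊆S′ (T⊆ z)) ,
         ≤-trans (ρ-bound large) (≤-≡ (*-monoʳ-≤ (suc r) T-large) (sym (*-assoc (suc r) (2 * loss k) (length T))))

    BranchingPart : ℕ → ℕ → FinSet (Point N d) → (Point N d → Bool) → Point N d → Set
    BranchingPart k e S rest s₀ = ∃[ T ] (Branching (suc k) T × Unique T × (∀ {z} → z ∈ T → z ∈ elements S) ×
      (∀ {z} → z ∈ T → rest z ≡ true ⊎ z ≡ s₀) × ∣ S ∣ ≤ suc e * loss k * length T)

    -- As η can only be compared approximately with ratios, regularity is applied to the rest of S enlarged by one point.
    branching-part : ∀ k {η} e → Lower η (+ 1 ℚ./ suc e) → (S : FinSet (Point N d)) → Regular (suc k) η ε ρ S →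
      suc e * (2 * loss k * K) ≤ E₀ → ∀ {s₀} → s₀ ∈ elements S → (rest : Point N d → Bool) → rest s₀ ≡ false →
      count (elements S) rest <[ η · ∣ S ∣ ] ⊎ BranchingPart k e S rest s₀
    branching-part zero {η} e low S reg small {s₀} s₀∈ rest ¬rest =
      -- At k = 1 only the size of the rest matters, so the alternative without a gap suffices and
      -- no point has to be added.
      [ inj₁ , (λ many → inj₂ (part many)) ]′ (<·-or-≤ η e low (count (elements S) rest) ∣ S ∣)
      where
      S′ : FinSet (Point N d)
      S′ = record { elements = filterᵇ rest (elements S) ; unique = filterᵇ-unique rest (unique S) }
      part : ∣ S ∣ ≤ suc e * count (elements S) rest → BranchingPart zero e S rest s₀
      part many = elements S′ , branching₁ S′ K≤ , unique S′ , (λ z∈ → proj₁ (∈-filterᵇ⁻ rest z∈)) ,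
          (λ {z} z∈ → inj₁ (proj₂ (∈-filterᵇ⁻ rest {elements S} z∈))) ,
          ≤-≡ many (cong₂ _*_ (sym (*-identityʳ (suc e))) (sym (length-filterᵇ (elements S) rest)))
        where
        K≤ : K ≤ ∣ S′ ∣
        K≤ = *-cancelˡ-≤ (suc e) (≤-trans (*-monoʳ-≤ (suc e) (m≤n*m K 2)) (≤-trans small (≤-trans (ε-bound reg)
          (≤-≡ many (cong (suc e *_) (sym (length-filterᵇ (elements S) rest)))))))
    branching-part (suc k) {η} e low S reg small {s₀} s₀∈ rest ¬rest =
      [ inj₁ , (λ many → inj₂ (part (prune-witness k S′ small′ (reg S′ S′⊆S
          (subst (λ m → suc m ≥[ η · ∣ S ∣ ]) (sym (length-filterᵇ (elements S) rest)) many))))) ]′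
      (<·-dichotomy η (count (elements S) rest) ∣ S ∣ {{∈⇒nonZero s₀∈}})
      where
      S′ : FinSet (Point N d)
      S′ = record
        { elements = s₀ ∷ filterᵇ rest (elements S)
        ; unique = All.tabulate (λ { {z} z∈ refl → contradiction (trans (sym ¬rest) (proj₂ (∈-filterᵇ⁻ rest {elements S} z∈))) λ () })
                     ∷ filterᵇ-unique rest (unique S) }
      S′⊆S : S′ ⊆ S
      S′⊆S (here refl) = s₀∈
      S′⊆S (there z∈) = proj₁ (∈-filterᵇ⁻ rest z∈)
      small′ : 2 * loss k * K ≤ E₀
      small′ = ≤-trans (*-monoˡ-≤ K (*-monoʳ-≤ 2 (loss-mono k))) (≤-trans (m≤n*m (2 * loss (suc k) * K) (suc e)) small)
      in-rest : ∀ {z} → z ∈ s₀ ∷ filterᵇ rest (elements S) → rest z ≡ true ⊎ z ≡ s₀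
      in-rest (here refl) = inj₂ refl
      in-rest (there z∈) = inj₁ (proj₂ (∈-filterᵇ⁻ rest {elements S} z∈))
      part : ∃[ T ] (Branching (suc (suc k)) T × Unique T × (∀ {z} → z ∈ T → z ∈ elements S′) × ∣ S ∣ ≤ loss (suc k) * length T) →
          BranchingPart (suc k) e S rest s₀
      part (T , br , uniq , T⊆ , T-large) = T , br , uniq , (λ z∈ → S′⊆S (T⊆ z∈)) , (λ z∈ → in-rest (T⊆ z∈)) ,
        ≤-trans T-large (*-monoˡ-≤ (length T) (m≤n*m (loss (suc k)) (suc e)))

-- Exhausting a set in boundedly many rounds

module Exhaustion {A : Set} (_≟_ : DecidableEquality A) (S : List A) (S-unique : Unique S)
  (Closed : (A → Set) → Set) (Enough : ℕ → Set) (g h : ℕ) (h-positive : 0 < h) where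

  open Fibres _≟_
  open DecMembership _≟_ using (_∈?_)

  Forces : List A → (A → Bool) → Set₁
  Forces G rest = ∀ {V} → Closed V → (∀ {x} → x ∈ G → V x) → ∀ {x} → x ∈ S → rest x ≡ false → V x

  -- The part may contain `s₀`, which is captured already. Having at least four elements, it keeps
  -- at least two, so that ignoring `s₀` costs at most a factor 2.
  record Part (s₀ : A) (rest : A → Bool) : Set₁ where
    field
      {part generators} : List A
      {kept} : A → Bool
      part-unique : Unique part
      part⊆S : ∀ {x} → x ∈ part → x ∈ S
      part⊆rest : ∀ {x} → x ∈ part → rest x ≡ true ⊎ x ≡ s₀
      part-large : length S ≤ h * length part
      at-least-four : 4 ≤ length part
      generators-few : length generators ≤ g
      forced : ∀ {V} → Closed V → (∀ {x} → x ∈ generators → V x) → ∀ {x} → x ∈ part → kept x ≡ true → V x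
      kept-half : length part ≤ 2 * count part kept

  -- One generator for `s₀` and g for each of at most 4 h rounds.
  Result : Set₁
  Result = ∃[ G ] ∃[ rest ] (length G ≤ 1 + 4 * h * g × Forces G rest × Enough (count S rest))

  module _ {s₀ : A} (enough-0 : Enough 0)
    (step : ∀ rest → rest s₀ ≡ false → Enough (count S rest) ⊎ Part s₀ rest) where

    done : ∀ G rest → length G ≤ 1 + 4 * h * g → Forces G rest → Enough (count S rest) → Result
    done G rest short force enough = G , rest , short , (λ {V} → force {V}) , enough

    -- The counter j is the number of rounds left. Each round removes at least |S| / (4 h) points
    -- from the rest: the factor h comes from the size of the part, one 2 from keeping only half of
    -- it and another 2 from `s₀`.
    loop : ∀ j G rest → rest s₀ ≡ false → Forces G rest → length G + j * g ≤ 1 + 4 * h * g →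
        4 * h * count S rest ≤ j * length S → Result
    loop zero G rest _ force short none = done G rest (≡-≤ (sym (+-identityʳ (length G))) short) force
      (subst Enough (sym (n≤0⇒n≡0 (*-cancelˡ-≤ (4 * h) {{>-nonZero (*-mono-< {0} {4} z<s h-positive)}}
        (≤-≡ none (sym (*-zeroʳ (4 * h))))))) enough-0)
    loop (suc j) G rest ¬s₀ force short left = [ done G rest (≤-trans (m≤m+n (length G) (suc j * g)) short) force , continue ]′ (step rest ¬s₀)
      where
      continue : Part s₀ rest → Result
      continue P = loop j (generators ++ G) rest′ (cong (_∧ not (gone s₀)) ¬s₀) force′
          (≤-trans (+-monoˡ-≤ (j * g) (≡-≤ (length-++ generators) (+-monoˡ-≤ (length G) generators-few)))
            (≡-≤ (shuffle g (length G) (j * g)) short)) left′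
        where
        open Part P
        open ≤-Reasoning
        shuffle : ∀ x y v → x + y + v ≡ y + (x + v)
        shuffle = solve-∀
        gone rest′ : A → Bool
        gone x = does (x ∈? part) ∧ kept x
        rest′ x = rest x ∧ not (gone x)
        force′ : Forces (generators ++ G) rest′
        force′ {V} closed vanish {x} x∈ e = by-cases (rest x) refl
          where
          by-cases : ∀ b → rest x ≡ b → V x
          by-cases false eq = force closed (λ y∈ → vanish (∈-++⁺ʳ generators y∈)) x∈ eq
          by-cases true eq = forced closed (λ y∈ → vanish (∈-++⁺ˡ y∈))
            (holds (x ∈? part) (∧-left (does (x ∈? part)) is-gone)) (∧-right (does (x ∈? part)) is-gone)
            where
            is-gone : gone x ≡ true
            is-gone = not-false (trans (cong (_∧ not (gone x)) (sym eq)) e)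
        lost c : ℕ
        lost = count S (λ x → rest x ∧ gone x)
        c = count part kept
        c≤ : c ≤ count S gone
        c≤ = begin
          count part kept ≡⟨ length-filterᵇ part kept ⟨
          length (filterᵇ kept part) ≡⟨ ↭-length (same-elements⇒↭ (filterᵇ-unique kept part-unique) (filterᵇ-unique gone S-unique)
              (λ {x} x∈ → let (x∈part , k) = ∈-filterᵇ⁻ kept {part} x∈ in ∈-filterᵇ⁺ gone (part⊆S x∈part) (∧-intro (dec-true (x ∈? part) x∈part) k))
              (λ {x} x∈ → let e = proj₂ (∈-filterᵇ⁻ gone {S} x∈) in ∈-filterᵇ⁺ kept (holds (x ∈? part) (∧-left (does (x ∈? part)) e)) (∧-right (does (x ∈? part)) e))) ⟩
          length (filterᵇ gone S) ≡⟨ length-filterᵇ S gone ⟩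
          count S gone ∎
        one-point : ∀ {xs} → Unique xs → count xs (_== s₀) ≤ 1
        one-point [] = z≤n
        one-point {x ∷ xs} (x∉ ∷ uniq) with x == s₀ in eq
        ... | false = one-point uniq
        ... | true = s≤s (≤-reflexive (trans (∑-cong xs (λ {y} y∈ → cong (_⊙ 1) (dec-false (y ≟ s₀)
                        (λ y≡ → All.lookup x∉ y∈ (trans (holds (x ≟ s₀) eq) (sym y≡)))))) (∑-zero xs)))
        c≤lost+1 : c ≤ lost + 1
        c≤lost+1 = ≤-trans c≤ (≤-trans (∑-mono S (λ {x} _ → either x)) (≡-≤ (∑-+ S _ _) (+-monoʳ-≤ lost (one-point S-unique))))
          where
          either : ∀ x → gone x ⊙ 1 ≤ (rest x ∧ gone x) ⊙ 1 + (x == s₀) ⊙ 1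
          either x = ⊙-bound (gone x) λ e →
            [ (λ r → ≡-≤ (sym (cong (_⊙ 1) (∧-intro r e))) (m≤m+n _ _))
            , (λ x≡ → ≡-≤ (sym (cong (_⊙ 1) (dec-true (x ≟ s₀) x≡))) (m≤n+m _ _)) ]′
            (part⊆rest (holds (x ∈? part) (∧-left (does (x ∈? part)) e)))
        2≤c : 2 ≤ c
        2≤c = *-cancelˡ-≤ 2 (≤-trans at-least-four kept-half)
        c≤2lost : c ≤ 2 * lost
        c≤2lost = +-cancelʳ-≤ 2 _ _ (begin
          c + 2 ≤⟨ +-monoʳ-≤ c 2≤c ⟩
          c + c ≤⟨ +-mono-≤ c≤lost+1 c≤lost+1 ⟩
          lost + 1 + (lost + 1) ≡⟨ double lost ⟩
          2 * lost + 2 ∎)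
          where
          double : ∀ x → x + 1 + (x + 1) ≡ 2 * x + 2
          double = solve-∀
        S≤ : length S ≤ 4 * h * lost
        S≤ = begin
          length S ≤⟨ part-large ⟩
          h * length part ≤⟨ *-monoʳ-≤ h (≤-trans kept-half (*-monoʳ-≤ 2 c≤2lost)) ⟩
          h * (2 * (2 * lost)) ≡⟨ rearr h lost ⟩
          4 * h * lost ∎
          where
          rearr : ∀ x y → x * (2 * (2 * y)) ≡ 4 * x * y
          rearr = solve-∀
        left′ : 4 * h * count S rest′ ≤ j * length S
        left′ = +-cancelˡ-≤ (length S) _ _ (begin
          length S + 4 * h * count S rest′ ≤⟨ +-monoˡ-≤ _ S≤ ⟩
          4 * h * lost + 4 * h * count S rest′ ≡⟨ *-distribˡ-+ (4 * h) lost _ ⟨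
          4 * h * (lost + count S rest′) ≡⟨ cong (4 * h *_) (trans (∑-cong S (λ {x} _ → ⊙-split (rest x) (gone x) 1)) (∑-+ S _ _)) ⟨
          4 * h * count S rest ≤⟨ left ⟩
          length S + j * length S ∎)

    exhaust : Result
    exhaust = loop (4 * h) (s₀ ∷ []) (λ x → not (x == s₀)) (cong not (==-refl s₀))
      (λ {V} _ vanish {x} _ e → subst V (sym (holds (x ≟ s₀) (not-false e))) (vanish (here refl)))
      ≤-refl (*-monoʳ-≤ (4 * h) (count≤length S _))

-- The polynomial

Conclusion : ∀ {N d} → ℕ → ℝ → FinSet (Point N d) → ℕ → Set
Conclusion {N} {d} k η S C = Σ[ f ∈ Polynomial d ]
  (Nontrivial k f × DegreeAtMost C f × CoefficientsAtMost (N ^ C) f × ∣ zerosIn S f ∣ >[ 1ℚ ⊖ η · ∣ S ∣ ])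

module _ {N d : ℕ} {η : ℝ} (S : FinSet (Point N d)) where

  many-zeros : ∀ f (rest : Point N d → Bool) →
    (∀ {s} → s ∈ elements S → rest s ≡ false → eval f (Vec.map (λ a → + toℕ a) s) ≡ 0ℤ) →
    count (elements S) rest <[ η · ∣ S ∣ ] → ∣ zerosIn S f ∣ >[ 1ℚ ⊖ η · ∣ S ∣ ]
  many-zeros f rest vanish few =
    >·-complement η {∣ zerosIn S f ∣} {∣ S ∣ ∸ ∣ zerosIn S f ∣} {∣ S ∣} (m+[n∸m]≡n (length-filter zero? (elements S)))
      (<·-antimono η {count (elements S) rest} {∣ S ∣ ∸ ∣ zerosIn S f ∣} {∣ S ∣} (m≤n+o⇒m∸n≤o ∣ S ∣ ∣ zerosIn S f ∣ (begin
    ∣ S ∣ ≡⟨ length-∑ (elements S) ⟩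
    ∑ (elements S) (λ _ → 1) ≤⟨ ∑-mono (elements S) (λ {s} s∈ → pointwise s s∈ (rest s) refl) ⟩
    ∑ (elements S) (λ s → does (zero? s) ⊙ 1 + rest s ⊙ 1) ≡⟨ ∑-+ (elements S) _ _ ⟩
    count (elements S) (λ s → does (zero? s)) + count (elements S) rest ≡⟨ cong (_+ count (elements S) rest) (length-filter? zero? (elements S)) ⟨
    ∣ zerosIn S f ∣ + count (elements S) rest ∎)) few)
    where
    open ≤-Reasoning
    zero? : ∀ s → Dec (eval f (Vec.map (λ a → + toℕ a) s) ≡ 0ℤ)
    zero? s = eval f (Vec.map (λ a → + toℕ a) s) ℤ.≟ 0ℤ
    pointwise : ∀ s → s ∈ elements S → ∀ b → rest s ≡ b → 1 ≤ does (zero? s) ⊙ 1 + b ⊙ 1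
    pointwise s s∈ true _ = m≤n+m 1 _
    pointwise s s∈ false eq = ≡-≤ (sym (cong (_⊙ 1) (dec-true (zero? s) (vanish s∈ eq)))) (m≤m+n _ 0)

  open Siegel N d

  from-interpolant : ∀ {k C m D H zs} (I : Interpolant m D H zs) → m * D ≤ C → H ≤ N ^ C → (rest : Point N d → Bool) →
    (∀ {s} → s ∈ elements S → rest s ≡ false → Interpolant.Zero I s) →
    count (elements S) rest <[ η · ∣ S ∣ ] → Conclusion k η S C
  from-interpolant I deg≤ H≤ rest vanish few = f , (λ _ → nonzero) , (λ e ne → ≤-trans (degree e ne) deg≤) ,
    (λ e → ≤-trans (coefficients e) H≤) , many-zeros f rest (λ {s} s∈ eq → zero-value s (vanish s∈ eq)) few
    where open Interpolant I

  zero-polynomial : ∀ {k} C → k ≡ d → 0 <[ η · ∣ S ∣ ] → Conclusion k η S C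
  zero-polynomial C k≡d few = f , (λ k≢d → contradiction k≡d k≢d) , (λ _ ne → contradiction refl ne) , (λ _ → z≤n) ,
    many-zeros f (λ _ → false) (λ _ _ → refl) (subst (_<[ η · ∣ S ∣ ]) (sym (∑-zero (elements S))) few)
    where
    f : Polynomial d
    f = record { coeff = λ _ → 0ℤ ; support = record { elements = [] ; unique = [] } ; supported = λ _ ne → contradiction refl ne }

-- Constants move into the exponent because U < 2 ^ U ≤ N ^ U. At N = 1 this fails, and that case is
-- treated separately.
power-bound : ∀ {N} U E {C} → 2 ≤ N → U + E ≤ C → U * N ^ E ≤ N ^ C
power-bound {N@(suc _)} U E {C} 2≤N le = begin
  U * N ^ E ≤⟨ *-monoˡ-≤ (N ^ E) (≤-trans (<⇒≤ (n<2^n U)) (^-monoˡ-≤ U 2≤N)) ⟩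
  N ^ U * N ^ E ≡⟨ ^-distribˡ-+-* N U E ⟨
  N ^ (U + E) ≤⟨ ^-monoʳ-≤ N le ⟩
  N ^ C ∎
  where open ≤-Reasoning

module SmallRange {n d′ : ℕ} where
  private
    N d : ℕ
    N = suc n
    d = suc d′
  open Siegel N d

  -- The diagonal realises every value of the first coordinate, so a polynomial in the first
  -- variable that vanishes on it vanishes on the whole grid.
  line : List (Point N d)
  line = map (replicate d) (allFin (suc N))

  line-length : length line ≡ suc N
  line-length = trans (length-map (replicate d) (allFin (suc N))) (length-tabulate id)

  line-vanishing : ∀ {D H} (I : Interpolant 1 D H line) s → Interpolant.Zero I s
  line-vanishing I s = Interpolant.local I {s} {replicate d (lookup s Fin.zero)} first
    (Interpolant.vanishes I (∈-map⁺ (replicate d) (∈-allFin (lookup s Fin.zero))))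
    where
    first : ∀ i → toℕ i < 1 → lookup s i ≡ lookup (replicate d (lookup s Fin.zero)) i
    first Fin.zero _ = refl
    first (Fin.suc i) (s≤s ())

  small : ∀ {k η} {S : FinSet (Point N d)} D {C} → 2 * suc N ≤ D → suc D + D ≤ C → 5 ≤ C → 0 <[ η · ∣ S ∣ ] → Conclusion k η S C
  small {k} {η} {S} D {C} N≤D D≤C 5≤C few = by-cases n refl
    where
    few′ : count (elements S) (λ _ → false) <[ η · ∣ S ∣ ]
    few′ = subst (_<[ η · ∣ S ∣ ]) (sym (∑-zero (elements S))) few
    by-cases : ∀ n′ → n ≡ n′ → Conclusion k η S C
    -- At N = 1 the coefficients must be at most 1 in absolute value. Degree 5 is the least for
    -- which the pigeonhole count succeeds with coefficients 0 and 1: 7 ^ 2 < 2 ^ 6.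
    by-cases zero n≡0 = from-interpolant {η = η} S {k} {C} I 5≤C (≤-reflexive (sym (trans (cong (_^ C) N≡1) (^-zeroˡ C)))) (λ _ → false)
        (λ {s} _ _ → line-vanishing I s) few′
      where
      N≡1 : N ≡ 1
      N≡1 = cong suc n≡0
      I : Interpolant 1 5 1 line
      I = siegel 1 5 1 line (subst₂ (λ u l → suc (u * (1 * N ^ 5)) ^ l < 2 ^ u) (sym (exponents-length {d} {1} 5 (s≤s z≤n))) (sym line-length)
        (subst (λ N → suc (6 * (1 * N ^ 5)) ^ suc N < 2 ^ 6) (sym N≡1) (toWitness {a? = 49 <? 64} _)))
    by-cases (suc _) n≡ = from-interpolant {η = η} S {k} {C} I (≡-≤ (*-identityˡ D) (≤-trans (m≤n+m D (suc D)) D≤C))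
        (≡-≤ (cong₂ (λ u e → u * N ^ e) (*-identityʳ (suc D)) (*-identityˡ D))
          (power-bound (suc D) D (s≤s (≤-≡ (s≤s z≤n) (sym n≡))) D≤C)) (λ _ → false)
        (λ {s} _ _ → line-vanishing I s) few′
      where
      I : Interpolant 1 D (suc D ^ 1 * N ^ (1 * D)) line
      I = interpolate 1 D line (s≤s z≤n) (≤-≡ (s≤s (≡-≤ (cong (2 *_) line-length) N≤D)) (sym (*-identityʳ (suc D))))

-- The weights lg p and u p stand for log p and, up to the factor Π, for log p / p.
module PrimeRange (N σ B P₀ h₀ : ℕ)
  (σ-positive : 0 < σ) (h₀-positive : 0 < h₀) (P₀-small : 16 * P₀ ≤ h₀) (lg-upper : lg N < 2 * B * suc h₀) where

  n ℓ Π′ Π τ₀ : ℕ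
  n = 2 ^ suc h₀
  ℓ = suc (lg N)
  -- Every prime up to n divides n !, so the division in `u′` is exact on the primes considered.
  Π′ = n !
  -- The factor σ makes the total weight exactly σ `τ₀`.
  Π = σ * Π′

  𝒫 : List ℕ
  𝒫 = primesBetween P₀ n

  u′ u : ℕ → ℕ
  u′ zero = 0
  u′ p@(suc _) = Π′ * lg p / p
  u p = σ * u′ p

  τ₀ = ∑ 𝒫 u′

  in-range : ∀ {p} → p ∈ 𝒫 → p ∈ primesUpTo n × P₀ ≤ p
  in-range {p} p∈ = let (p∈′ , e) = ∈-filterᵇ⁻ (λ p → does (P₀ ≤? p)) {primesUpTo n} p∈ in p∈′ , holds (P₀ ≤? p) e

  𝒫-prime : ∀ {p} → p ∈ 𝒫 → Prime p
  𝒫-prime p∈ = All.lookup (primesUpTo-prime n) (proj₁ (in-range p∈))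

  𝒫-unique : Unique 𝒫
  𝒫-unique = filterᵇ-unique _ (primesUpTo-unique n)

  𝒫-≤ : ∀ {p} → p ∈ 𝒫 → p ≤ n
  𝒫-≤ p∈ = primesUpTo-≤ n (proj₁ (in-range p∈))

  N<2^ℓ : N < 2 ^ ℓ
  N<2^ℓ = <2^[1+lg] N

  Π′-positive : 0 < Π′
  Π′-positive = n!>0 n
    where
    n!>0 : ∀ n → 0 < n !
    n!>0 zero = z<s
    n!>0 (suc n) = *-mono-< {0} {suc n} z<s (n!>0 n)

  scale′ : ∀ {p} → p ∈ primesUpTo n → p * u′ p ≡ Π′ * lg p
  scale′ {zero} p∈ = contradiction (prime≥2 (All.lookup (primesUpTo-prime n) p∈)) λ ()
  scale′ {suc q} p∈ = m*[n/m]≡n (∣m⇒∣m*n (lg (suc q)) (∣-trans (m∣m*n (q !)) (m≤n⇒m!∣n! (primesUpTo-≤ n p∈))))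

  scale : ∀ {p} → p ∈ 𝒫 → p * u p ≡ Π * lg p
  scale {p} p∈ = begin
    p * (σ * u′ p) ≡⟨ *-swap p σ (u′ p) ⟩
    σ * (p * u′ p) ≡⟨ cong (σ *_) (scale′ (proj₁ (in-range p∈))) ⟩
    σ * (Π′ * lg p) ≡⟨ *-assoc σ Π′ (lg p) ⟨
    σ * Π′ * lg p ∎
    where
    open ≡-Reasoning

  total : ∑ 𝒫 u ≡ σ * τ₀
  total = sym (∑-*ˡ 𝒫 σ u′)

  -- The constant 8 from `mertens` doubles, because the primes below `P₀` use up at most half of the
  -- bound when 16 `P₀` ≤ `h₀`.
  Π′h₀≤16τ₀ : Π′ * h₀ ≤ 16 * τ₀
  Π′h₀≤16τ₀ = +-cancelʳ-≤ (Π′ * h₀) _ _ (begin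
    Π′ * h₀ + Π′ * h₀ ≤⟨ +-mono-≤ (mertens h₀ Π′ u′ scale′) (mertens h₀ Π′ u′ scale′) ⟩
    8 * s + 8 * s ≤⟨ +-mono-≤ (*-monoʳ-≤ 8 s≤) (*-monoʳ-≤ 8 s≤) ⟩
    8 * (τ₀ + P₀ * Π′) + 8 * (τ₀ + P₀ * Π′) ≡⟨ lemma τ₀ P₀ Π′ ⟩
    16 * τ₀ + Π′ * (16 * P₀) ≤⟨ +-monoʳ-≤ (16 * τ₀) (*-monoʳ-≤ Π′ P₀-small) ⟩
    16 * τ₀ + Π′ * h₀ ∎)
    where
    open ≤-Reasoning
    s = ∑ (primesUpTo n) u′
    s≤ : s ≤ τ₀ + P₀ * Π′
    s≤ = ∑-primesBetween P₀ n Π′ u′ scale′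
    lemma : ∀ t p q → 8 * (t + p * q) + 8 * (t + p * q) ≡ 16 * t + q * (16 * p)
    lemma = solve-∀

  τ₀-positive : 0 < τ₀
  τ₀-positive = positiveʳ 16 (≤-trans (*-mono-< Π′-positive h₀-positive) Π′h₀≤16τ₀)

  -- Origin of δ: ℓ ≤ 4 B `h₀`, and `h₀` costs a further factor 16.
  Πℓ≤ : Π * ℓ ≤ 64 * σ * B * τ₀
  Πℓ≤ = begin
    σ * Π′ * ℓ ≤⟨ *-monoʳ-≤ (σ * Π′) (≤-trans lg-upper (*-monoʳ-≤ (2 * B) (+-monoˡ-≤ h₀ h₀-positive))) ⟩
    σ * Π′ * (2 * B * (h₀ + h₀)) ≡⟨ lemma σ Π′ B h₀ ⟩
    4 * σ * B * (Π′ * h₀) ≤⟨ *-monoʳ-≤ (4 * σ * B) Π′h₀≤16τ₀ ⟩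
    4 * σ * B * (16 * τ₀) ≡⟨ lemma′ σ B τ₀ ⟩
    64 * σ * B * τ₀ ∎
    where
    open ≤-Reasoning
    lemma : ∀ s q b h → s * q * (2 * b * (h + h)) ≡ 4 * s * b * (q * h)
    lemma = solve-∀
    lemma′ : ∀ s b t → 4 * s * b * (16 * t) ≡ 64 * s * b * t
    lemma′ = solve-∀

  W≤ : ∀ {K} → h₀ ≤ lg N → 4 * 2 ^ h₀ ≤ K → ∑ 𝒫 lg ≤ K * ℓ
  W≤ {K} h₀≤ K-large = begin
    ∑ 𝒫 lg ≤⟨ ∑-≤-const 𝒫 ℓ (λ p∈ → ≤-trans (lg-bound (≤-<-trans (𝒫-≤ p∈) (^-monoʳ-< 2 (s≤s (s≤s z≤n)) (n<1+n (suc h₀))))) (s≤s h₀≤)) ⟩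
    length 𝒫 * ℓ ≤⟨ *-monoˡ-≤ ℓ (≤-trans (length-filter _ (primesUpTo n)) (≤-≡ (length-filter prime? (upTo (suc n))) (length-upTo (suc n)))) ⟩
    suc n * ℓ ≤⟨ *-monoˡ-≤ ℓ (≤-trans (≤-≡ (+-monoˡ-≤ n (m^n>0 2 (suc h₀))) (lemma (2 ^ h₀))) K-large) ⟩
    K * ℓ ∎
    where
    open ≤-Reasoning
    lemma : ∀ x → 2 * x + 2 * x ≡ 4 * x
    lemma = solve-∀

module LargeRange (j e r a B P₀ z σ δ Λ M h₀ : ℕ) (B-positive : 0 < B)
  (z≡ : z ≡ 6 * suc j) (σ≡ : σ ≡ 2 * 3 ^ suc j) (δ≡ : δ ≡ 64 * σ * B) (Λ≡ : Λ ≡ 2 * suc j * δ)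
  (M-positive : 0 < M) (P₀≡ : P₀ ≡ 2 * (M * δ)) (h₀-positive : 0 < h₀) (P₀-small : 16 * P₀ ≤ h₀)
  {N d : ℕ} (h₀≤ : h₀ ≤ lg N) (lg-upper : lg N < 2 * B * suc h₀)
  where
  open Constants z σ δ Λ
  open Loss r

  z-positive : 0 < z
  z-positive = ≤-≡ z<s (sym z≡)
  σ-positive : 0 < σ
  σ-positive = ≤-≡ (*-mono-< {0} {2} z<s (m^n>0 3 (suc j))) (sym σ≡)
  δ-positive : 0 < δ
  δ-positive = ≤-≡ (*-mono-< (*-mono-< {0} {64} z<s σ-positive) B-positive) (sym δ≡)
  Λ-positive : 0 < Λ
  Λ-positive = ≤-≡ (*-mono-< {0} {2 * suc j} z<s δ-positive) (sym Λ≡)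

  c h X K : ℕ
  c = cst (suc j) (suc a)
  h = suc e * loss j
  X = 2 ^ h₀
  -- The primes reach up to 2 X. The summand c gives c p ≤ K, and the 2 gives 4 X ≤ K, which bounds
  -- the number of primes.
  K = 2 * (c + 2) * X

  open PrimeRange N σ B P₀ h₀ σ-positive h₀-positive P₀-small lg-upper
  open Points N d

  X-positive : 0 < X
  X-positive = m^n>0 2 h₀

  4X≤K : 4 * X ≤ K
  4X≤K = *-monoˡ-≤ X (*-monoʳ-≤ 2 {2} (m≤n+m 2 c))

  4≤K : 4 ≤ K
  4≤K = ≤-trans (*-monoʳ-≤ 4 X-positive) 4X≤K

  K-large : ∀ {p} → p ∈ 𝒫 → c * p ≤ K
  K-large p∈ = ≤-trans (*-monoʳ-≤ c (𝒫-≤ p∈)) (≡-≤ (lemma c X) (*-monoˡ-≤ X (*-monoʳ-≤ 2 (m≤m+n c 2))))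
    where
    lemma : ∀ x y → x * (2 * y) ≡ 2 * x * y
    lemma = solve-∀

  open Trees _≟ₚ_ _≟ᵣ_ class K using (Branching; node; ∈-fibre⁺)

  ClosedSet : (Point N d → Set) → Set
  ClosedSet = Closed class 𝒫 lg (M * ℓ)

  capture : ∀ {T} → Branching (suc j) T → (Ω : ℕ → List (Point N d)) →
    (∀ {p} → p ∈ 𝒫 → length (Ω p) ≤ suc a * p ^ suc j) →
    (∀ {p s} → p ∈ 𝒫 → s ∈ T → ∃[ t ] (t ∈ Ω p × class p t ≡ class p s)) →
    ∃[ G ] ∃[ keep ] (length G ≤ c * (M + 1) ^ suc j ×
      (∀ {V} → ClosedSet V → (∀ {x} → x ∈ G → V x) → ∀ {x} → x ∈ T → keep x ≡ true → V x) ×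
      length T ≤ 2 * count T keep)
  capture br Ω Ω-few Ω-covers = Sieve.Capture.capture-half
    _≟ₚ_ _≟ᵣ_ class 𝒫 lg u Π ℓ K (λ p∈ → ≤-trans z<s (prime≥2 (𝒫-prime p∈))) scale
    (separated N<2^ℓ 𝒫-unique (All.tabulate 𝒫-prime)) (W≤ h₀≤ 4X≤K) Λ
    z σ δ M τ₀ z-positive σ-positive δ-positive M-positive τ₀-positive Λ-positive z<s
    (*-mono-< σ-positive Π′-positive) (≤-reflexive total) (≤-≡ Πℓ≤ (cong (_* τ₀) (sym δ≡)))
    (λ p∈ → ≡-≤ (sym P₀≡) (proj₂ (in-range p∈)))
    br (suc a) z<s Ω z≡ Λ≡ (≤-reflexive (trans (cong (_* τ₀) (sym σ≡)) (sym total))) Ω-few Ω-covers K-large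

  K-positive : 0 < K
  K-positive = ≤-trans z<s 4≤K

  branching-large : ∀ {k T s} → Branching (suc k) T → s ∈ T → K ≤ length T
  branching-large {T = T} (node ψ _ light _) s∈ = ≤-trans (m≤m*n K _ {{∈⇒nonZero (∈-fibre⁺ ψ s∈)}}) (light (ψ _))

  -- At a point agreeing with zeros of f modulo many primes, the value is divisible by all of them.
  -- A nonzero value would be at least 2 ^ (M ℓ), beyond the bound for values of f.
  zero-set-closed : ∀ {m D H zs} (I : Siegel.Interpolant N d m D H zs) → m ≤ d →
    suc D ^ m * (H * N ^ (m * D)) < 2 ^ (M * ℓ) → ClosedSet (λ s → Siegel.Interpolant.Zero I s)
  zero-set-closed {m} {D} {H} I m≤d small {s} e witness large = decide (plus s ≟ minus s)
    where
    open Siegel.Interpolant I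
    open ≤-Reasoning
    decide : Dec (plus s ≡ minus s) → plus s ≡ minus s
    decide (yes eq) = eq
    decide (no ne) = contradiction small (≤⇒≯ (begin
      2 ^ (M * ℓ) ≤⟨ ^-monoʳ-≤ 2 large ⟩
      2 ^ ∑ 𝒫 (λ p → e p ⊙ lg p) ≤⟨ common-prime-divisors e 𝒫-unique (All.tabulate 𝒫-prime)
          (λ {p} p∈ ep → let (t , t-zero , eq) = witness p∈ ep in periodic {p} {s} {t} (sym eq) t-zero)
          {{≢-nonZero (λ eq → ne (∣m-n∣≡0⇒m≡n eq))}} ⟩
      ∣ plus s - minus s ∣ ≤⟨ bounded s ⟩
      length (exponents d m D) * (H * N ^ (m * D)) ≡⟨ cong (_* (H * N ^ (m * D))) (exponents-length D m≤d) ⟩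
      suc D ^ m * (H * N ^ (m * D)) ∎))

  module _ {η ε ρ α : ℝ} (η-low : Lower η (+ 1 ℚ./ suc e)) (Few-0 : ∀ {n} → 0 < n → 0 <[ η · n ])
    (ε-bound : ∀ {m} → m ≥[ N ^ ε ] → X * X ≤ m)
    (ρ-bound : ∀ {m n} → m ≥[ ρ · n ] → n ≤ suc r * m)
    (α-bound : ∀ {m n} → m <[ α · n ] → m ≤ suc a * n)
    (h₀-large : suc e * (2 * loss j) * (2 * (c + 2)) ≤ h₀)
    (S : FinSet (Point N d)) (reg : Regular (suc j) η ε ρ S)
    (few-residues : (p : ℕ) (prime : Prime p) → ∣ residues p {{prime⇒nonZero prime}} S ∣ <[ α · p ^ suc j ])
    where
    module R = RegularSets {N} {d} ε ρ (X * X) r ε-bound ρ-bound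

    X-large : ∀ {x} → x ≤ h₀ → x ≤ X
    X-large x≤ = ≤-trans x≤ (<⇒≤ (n<2^n h₀))

    K-small : suc e * (2 * loss j * K) ≤ X * X
    K-small = ≡-≤ (lemma (suc e) (2 * loss j) (2 * (c + 2)) X) (*-monoˡ-≤ X (X-large h₀-large))
      where
      lemma : ∀ x y v w → x * (y * (v * w)) ≡ x * y * v * w
      lemma = solve-∀

    -- The bound on residue classes is given at primes only; elsewhere the list is empty by default.
    reps : ∀ p → Dec (Prime p) → List (Point N d)
    reps p (yes pr) = proj₁ (residue-representatives p {{prime⇒nonZero pr}} S)
    reps p (no _) = []

    Ω : ℕ → List (Point N d)
    Ω p = reps p (prime? p)

    Ω-few : ∀ {p} → p ∈ 𝒫 → length (Ω p) ≤ suc a * p ^ suc j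
    Ω-few {p} p∈ = go (prime? p)
      where
      go : ∀ pr? → length (reps p pr?) ≤ suc a * p ^ suc j
      go (no _) = z≤n
      go (yes pr) = ≡-≤ (proj₁ (proj₂ (residue-representatives p {{prime⇒nonZero pr}} S))) (α-bound (few-residues p pr))

    Ω-covers : ∀ {p s} → p ∈ 𝒫 → s ∈ elements S → ∃[ t ] (t ∈ Ω p × class p t ≡ class p s)
    Ω-covers {p} {s} p∈ s∈ = go (prime? p)
      where
      go : ∀ pr? → ∃[ t ] (t ∈ reps p pr? × class p t ≡ class p s)
      go (no ¬pr) = contradiction (𝒫-prime p∈) ¬pr
      go (yes pr) = proj₂ (proj₂ (residue-representatives p {{prime⇒nonZero pr}} S)) s∈

    h-positive : 0 < h
    h-positive = *-mono-< {0} {suc e} z<s (loss-positive j)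

    module Ex = Exhaustion _≟ₚ_ (elements S) (unique S) ClosedSet (λ m → m <[ η · ∣ S ∣ ]) (c * (M + 1) ^ suc j) h h-positive

    module _ {s₀ : Point N d} (s₀∈ : s₀ ∈ elements S) where

      to-part : ∀ rest → R.BranchingPart K K-positive j e S rest s₀ → Ex.Part s₀ rest
      to-part rest (T , br , T-unique , T⊆S , T⊆rest , T-large) =
        let (gens , keep , gens-few , forced , half) = capture br Ω Ω-few (λ p∈ s∈ → Ω-covers p∈ (T⊆S s∈))
        in record
          { part = T ; generators = gens ; kept = keep
          ; part-unique = T-unique ; part⊆S = T⊆S ; part⊆rest = T⊆rest ; part-large = T-large
          ; at-least-four = ≤-trans 4≤K (T-long T refl) ; generators-few = gens-few ; forced = forced ; kept-half = half }
        where
        T-long : ∀ xs → T ≡ xs → K ≤ length T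
        T-long (x ∷ _) eq = branching-large br (subst (x ∈_) (sym eq) (here refl))
        T-long [] eq = contradiction (≤-trans (>-nonZero⁻¹ ∣ S ∣ {{∈⇒nonZero s₀∈}}) (≤-≡ T-large
          (trans (cong (λ xs → h * length xs) eq) (*-zeroʳ h)))) λ ()

      capturing : Ex.Result
      capturing = Ex.exhaust {s₀} (Few-0 (>-nonZero⁻¹ ∣ S ∣ {{∈⇒nonZero s₀∈}}))
        (λ rest ¬s₀ → Sum.map₂ (to-part rest) (R.branching-part K K-positive j e η-low S reg K-small s₀∈ rest ¬s₀))

      few-variables : ∀ {D C} .{{_ : NonZero N}} → suc j < d → 2 ≤ N →
        (let m = suc (suc j); U = suc D ^ m) →
        2 * (1 + 4 * h * (c * (M + 1) ^ suc j)) < U → U * (U * N ^ (m * D) * N ^ (m * D)) < 2 ^ (M * suc (lg N)) →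
        m * D ≤ C → U + m * D ≤ C → Conclusion (suc j) η S C
      few-variables {D} {C} k<d 2≤N enough values-small degree exponent =
        let (G , rest , G-few , forces , few) = capturing
            I = Siegel.interpolate N d (suc (suc j)) D G k<d (≤-<-trans (*-monoʳ-≤ 2 G-few) enough)
        in from-interpolant {η = η} S {suc j} {C} I degree (power-bound (suc D ^ suc (suc j)) (suc (suc j) * D) 2≤N exponent) rest
            (forces (zero-set-closed I k<d values-small) (Siegel.Interpolant.vanishes I)) few

-- Cases according to the size of N and the order of k and d

module Main (j e b r a z σ δ Λ M P₀ D D₀ threshold C : ℕ)
  (z≡ : z ≡ 6 * suc j) (σ≡ : σ ≡ 2 * 3 ^ suc j) (δ≡ : δ ≡ 64 * σ * suc b) (Λ≡ : Λ ≡ 2 * suc j * δ)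
  (M≡ : M ≡ 2 * (suc (suc j) * D) + 2) (P₀≡ : P₀ ≡ 2 * (M * δ)) (2≤D : 2 ≤ D)
  (enough-coefficients : 2 * (1 + 4 * (suc e * Loss.loss r j) * (Constants.cst z σ δ Λ (suc j) (suc a) * (M + 1) ^ suc j))
      < suc D ^ suc (suc j))
  (P₀-threshold : 16 * P₀ ≤ threshold) (U²-threshold : suc D ^ suc (suc j) * suc D ^ suc (suc j) ≤ threshold)
  (threshold-positive : 0 < threshold)
  (loss-threshold : suc e * (2 * Loss.loss r j) * (2 * (Constants.cst z σ δ Λ (suc j) (suc a) + 2)) ≤ threshold)
  (D₀-large : 2 * suc (2 ^ (2 * suc b * threshold)) ≤ D₀)
  (main-degree : suc (suc j) * D ≤ C) (main-exponent : suc D ^ suc (suc j) + suc (suc j) * D ≤ C) (point-exponent : suc D + D ≤ C)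
  (small-exponent : suc D₀ + D₀ ≤ C) (5≤C : 5 ≤ C)
  where
  open Loss r

  k m B c U : ℕ
  k = suc j
  m = suc k
  B = suc b
  c = Constants.cst z σ δ Λ k (suc a)
  U = suc D ^ m

  module Threshold (N : ℕ) (N-large : 2 * B * threshold ≤ lg N) where

    -- 2 ^ `h₀` is about N ^ (1 / (2 B)). As 1 / B < ε, regularity provides at least (2 ^ `h₀`) ^ 2
    -- labels: one factor pays for primes up to 2 ^ (`h₀` + 1), the other for the constants.
    h₀ : ℕ
    h₀ = lg N / (2 * B)

    h₀-lower : 2 * B * h₀ ≤ lg N
    h₀-lower = ≡-≤ (*-comm (2 * B) h₀) (m/n*n≤m (lg N) (2 * B))

    h₀-upper : lg N < 2 * B * suc h₀
    h₀-upper = begin-strict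
      lg N ≡⟨ m≡m%n+[m/n]*n (lg N) (2 * B) ⟩
      lg N % (2 * B) + h₀ * (2 * B) <⟨ +-monoˡ-< (h₀ * (2 * B)) (m%n<n (lg N) (2 * B)) ⟩
      2 * B + h₀ * (2 * B) ≡⟨ *-comm (suc h₀) (2 * B) ⟩
      2 * B * suc h₀ ∎
      where open ≤-Reasoning

    threshold≤h₀ : threshold ≤ h₀
    threshold≤h₀ = s≤s⁻¹ (*-cancelˡ-< (2 * B) threshold (suc h₀) (≤-<-trans N-large h₀-upper))

    h₀≤ : h₀ ≤ lg N
    h₀≤ = ≤-trans (m≤n*m h₀ (2 * B)) h₀-lower

    h₀-positive : 0 < h₀
    h₀-positive = ≤-trans threshold-positive threshold≤h₀

    P₀-small : 16 * P₀ ≤ h₀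
    P₀-small = ≤-trans P₀-threshold threshold≤h₀

    loss-small : suc e * (2 * loss j) * (2 * (c + 2)) ≤ h₀
    loss-small = ≤-trans loss-threshold threshold≤h₀

    U²-small : U * U ≤ h₀
    U²-small = ≤-trans U²-threshold threshold≤h₀

    2≤N : 2 ≤ N
    2≤N = go N (≤-trans h₀-positive h₀≤)
      where
      go : ∀ N → 0 < lg N → 2 ≤ N
      go (suc (suc _)) _ = s≤s (s≤s z≤n)
      go (suc zero) ()

    X²-bound : .{{_ : NonZero N}} → ∀ {x} → N ≤ x ^ B → 2 ^ h₀ * 2 ^ h₀ ≤ x
    X²-bound {x} N≤ = ≮⇒≥ λ x< → <⇒≱ (begin-strict
      x ^ B <⟨ ^-monoˡ-< B x< ⟩
      (2 ^ h₀ * 2 ^ h₀) ^ B ≡⟨ cong (_^ B) (^-distribˡ-+-* 2 h₀ h₀) ⟨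
      (2 ^ (h₀ + h₀)) ^ B ≡⟨ ^-*-assoc 2 (h₀ + h₀) B ⟩
      2 ^ ((h₀ + h₀) * B) ≤⟨ ^-monoʳ-≤ 2 (≡-≤ (lemma h₀ B) h₀-lower) ⟩
      2 ^ lg N ≤⟨ 2^lg≤ N ⟩
      N ∎) N≤
      where
      open ≤-Reasoning
      lemma : ∀ x y → (x + x) * y ≡ 2 * y * x
      lemma = solve-∀

    -- Origin of M: values are at most U ^ 2 N ^ (2 m D). Here U ^ 2 costs one ℓ in the exponent, N
    -- ^ (2 m D) costs 2 m D of them, and one more makes the inequality strict.
    values-small : .{{_ : NonZero N}} → U * (U * N ^ (m * D) * N ^ (m * D)) < 2 ^ (M * suc (lg N))
    values-small = begin-strict
      U * (U * Y * Y) ≡⟨ lemma U Y ⟩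
      U * U * (Y * Y) ≤⟨ *-mono-≤ (≤-trans U²-small (≤-trans h₀≤ (<⇒≤ (≤-<-trans (n≤1+n _) (n<2^n ℓ))))) (*-mono-≤ Y≤ Y≤) ⟩
      2 ^ ℓ * (2 ^ (ℓ * E) * 2 ^ (ℓ * E)) ≡⟨ cong (2 ^ ℓ *_) (^-distribˡ-+-* 2 (ℓ * E) (ℓ * E)) ⟨
      2 ^ ℓ * 2 ^ (ℓ * E + ℓ * E) ≡⟨ ^-distribˡ-+-* 2 ℓ (ℓ * E + ℓ * E) ⟨
      2 ^ (ℓ + (ℓ * E + ℓ * E)) <⟨ ^-monoʳ-< 2 (s≤s (s≤s z≤n)) (≤-≡ (+-monoˡ-≤ (ℓ + (ℓ * E + ℓ * E)) {1} {ℓ} (s≤s z≤n)) (trans (lemma′ ℓ E) (cong (_* ℓ) (sym M≡)))) ⟩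
      2 ^ (M * ℓ) ∎
      where
      open ≤-Reasoning
      E ℓ Y : ℕ
      E = m * D
      ℓ = suc (lg N)
      Y = N ^ E
      Y≤ : Y ≤ 2 ^ (ℓ * E)
      Y≤ = ≤-≡ (^-monoˡ-≤ E (<⇒≤ (<2^[1+lg] N))) (^-*-assoc 2 ℓ E)
      lemma : ∀ u y → u * (u * y * y) ≡ u * u * (y * y)
      lemma = solve-∀
      lemma′ : ∀ l e → l + (l + (l * e + l * e)) ≡ (2 * e + 2) * l
      lemma′ = solve-∀

  module _ {η ε α ρ : ℝ} (η-low : Lower η (+ 1 ℚ./ suc e)) (ε-low : Lower ε (+ 1 ℚ./ suc b)) (ρ-low : Lower ρ (+ 1 ℚ./ suc r))
    (α-bound : ∀ {m n} → m <[ α · n ] → m ≤ suc a * n) where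

    few-0 : ∀ {n} → 0 < n → 0 <[ η · n ]
    few-0 {n} 0<n = [ id , (λ n≤ → contradiction (≤-trans 0<n (≤-≡ n≤ (*-zeroʳ (suc e)))) λ ()) ]′
      (<·-or-≤ η e η-low 0 n)

    conclusion : (d : ℕ) .{{_ : NonZero d}} (N : ℕ) .{{_ : NonZero N}} (S : FinSet (Point N d)) →
      Regular k η ε ρ S →
      ((p : ℕ) (prime : Prime p) → ∣ residues p {{prime⇒nonZero prime}} S ∣ <[ α · p ^ k ]) →
      Conclusion k η S C
    conclusion zero {{()}}
    conclusion (suc d′) zero {{()}}
    conclusion d@(suc d′) N@(suc n′) S reg few-residues = by-size (2 * B * threshold ≤? lg N)
      where
      ε-bound : ∀ {x} → x ≥[ N ^ ε ] → N ≤ x ^ B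
      ε-bound = ≥^⇒≤ ε b ε-low

      ρ-bound : ∀ {x y} → x ≥[ ρ · y ] → y ≤ suc r * x
      ρ-bound = ≥·⇒≤ ρ r ρ-low

      one-bound : ∀ {x} → x ≥[ N ^ ε ] → 1 ≤ x
      one-bound {zero} h = contradiction (ε-bound {0} h) λ ()
      one-bound {suc _} _ = s≤s z≤n

      point : ∃[ s ] s ∈ elements S
      point = RegularSets.nonempty ε ρ 1 r one-bound ρ-bound ≤-refl j S reg

      s₀ = proj₁ point
      s₀∈ = proj₂ point

      S-positive : 0 < ∣ S ∣
      S-positive = >-nonZero⁻¹ ∣ S ∣ {{∈⇒nonZero s₀∈}}

      module _ (N-large : 2 * B * threshold ≤ lg N) where
        open Threshold N N-large
        open Points N d
        open Siegel N d
        open Fibres _≟ₚ_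

        X² : ℕ
        X² = 2 ^ h₀ * 2 ^ h₀

        2≤X² : 2 ≤ X²
        2≤X² = ≤-trans (≤-trans (s≤s (h₀-positive)) (n<2^n (h₀))) (m≤m*n (2 ^ h₀) (2 ^ h₀) {{>-nonZero (m^n>0 2 (h₀))}})

        X²-large : ∀ {x} → x ≥[ N ^ ε ] → X² ≤ x
        X²-large h = X²-bound (ε-bound h)

        few-variables : k < d → Conclusion k η S C
        few-variables k<d = LargeRange.few-variables j e r a B P₀ z σ δ Λ M h₀ z<s z≡ σ≡ δ≡ Λ≡
          (≤-trans (s≤s z≤n) (≤-≡ (m≤n+m 2 (2 * (m * D))) (sym M≡))) P₀≡
          h₀-positive P₀-small {N} {d} h₀≤ h₀-upper {η} {ε} {ρ} {α} η-low few-0 X²-large ρ-bound α-bound loss-small S reg few-residues s₀∈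
          {D} {C} k<d 2≤N enough-coefficients values-small main-degree main-exponent

        -- If all points but one are fewer than η |S|, a zero at `s₀` is enough. Otherwise |S| ≥ η
        -- |S|, so S is admissible as its own `S′`, and its k levels would use up more than d
        -- coordinates.
        many-variables : d < k → Conclusion k η S C
        many-variables d<k = [ single , (λ large → contradiction (RegularSets.coordinates-bound ε ρ X² r X²-large ρ-bound 2≤X² j S reg
            (subst (_≥[ η · ∣ S ∣ ]) (suc-pred ∣ S ∣ {{∈⇒nonZero s₀∈}}) large)) (<⇒≱ d<k)) ]′
          (<·-dichotomy η (pred ∣ S ∣) ∣ S ∣ {{∈⇒nonZero s₀∈}})
          where
          other : Point N d → Bool
          other s = not (s == s₀)
          I : Interpolant 1 D (suc D ^ 1 * N ^ (1 * D)) (s₀ ∷ [])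
          I = interpolate 1 D (s₀ ∷ []) (s≤s z≤n) (≤-≡ (s≤s 2≤D) (sym (*-identityʳ (suc D))))
          fewer : count (elements S) other ≤ pred ∣ S ∣
          fewer = s≤s⁻¹ (begin
            suc (count (elements S) other) ≤⟨ +-monoˡ-≤ (count (elements S) other)
                (≡-≤ (sym (cong (_⊙ 1) (==-refl s₀))) (∑-member (λ s → (s == s₀) ⊙ 1) s₀∈)) ⟩
            count (elements S) (_== s₀) + count (elements S) other ≡⟨ ∑-+ (elements S) _ _ ⟨
            ∑ (elements S) (λ s → (s == s₀) ⊙ 1 + other s ⊙ 1) ≡⟨ ∑-cong (elements S) (λ {s} _ → ⊙-split true (s == s₀) 1) ⟨
            ∑ (elements S) (λ _ → 1) ≡⟨ length-∑ (elements S) ⟨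
            ∣ S ∣ ≡⟨ suc-pred ∣ S ∣ {{∈⇒nonZero s₀∈}} ⟨
            suc (pred ∣ S ∣) ∎)
            where open ≤-Reasoning
          single : pred ∣ S ∣ <[ η · ∣ S ∣ ] → Conclusion k η S C
          single few = from-interpolant {η = η} S {k} {C} I (≡-≤ (*-identityˡ D) (≤-trans (m≤n+m D (suc D)) point-exponent))
            (≡-≤ (cong₂ (λ u v → u * N ^ v) (*-identityʳ (suc D)) (*-identityˡ D))
              (power-bound (suc D) D (2≤N) point-exponent)) other
            (λ {s} _ eq → subst (λ v → Interpolant.Zero I v) (sym (holds (s ≟ₚ s₀) (not-false eq))) (Interpolant.vanishes I (here refl)))
            (<·-antimono η {pred ∣ S ∣} {count (elements S) other} {∣ S ∣} fewer few)

        by-dimension : Tri (k < d) (k ≡ d) (d < k) → Conclusion k η S C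
        by-dimension (tri< k<d _ _) = few-variables k<d
        by-dimension (tri≈ _ k≡d _) = zero-polynomial {η = η} S {k} C k≡d (few-0 {∣ S ∣} S-positive)
        by-dimension (tri> _ _ d<k) = many-variables d<k

      by-size : Dec (2 * B * threshold ≤ lg N) → Conclusion k η S C
      by-size (yes N-large) = by-dimension N-large (<-cmp k d)
      by-size (no ¬large) = SmallRange.small {n′} {d′} {k} {η} {S} D₀ (≤-trans (*-monoʳ-≤ 2 (s≤s (<⇒≤ (≤-trans (<2^[1+lg] N)
        (^-monoʳ-≤ 2 (≰⇒> ¬large)))))) D₀-large) small-exponent 5≤C (few-0 {∣ S ∣} S-positive)

-- The choice of the constants

module Choice (j e b r a : ℕ) where
  open Loss r

  k m B z σ δ Λ c h J D U M P₀ threshold N₀ D₀ C : ℕ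
  k = suc j
  m = suc k
  B = suc b
  z = 6 * k
  σ = 2 * 3 ^ k
  δ = 64 * σ * B
  Λ = 2 * k * δ
  c = Constants.cst z σ δ Λ k (suc a)
  h = suc e * loss j
  J = 4 * h
  -- As M + 1 ≤ (2 m + 3) (D + 1) and c does not involve M, twice the number of points is at most D
  -- (D + 1) ^ k, which is less than U.
  D = 2 * (1 + J * (c * (2 * m + 3) ^ k))
  U = suc D ^ m
  M = 2 * (m * D) + 2
  P₀ = 2 * (M * δ)
  threshold = suc (16 * P₀ + suc e * (2 * loss j) * (2 * (c + 2)) + U * U)
  N₀ = 2 ^ (2 * B * threshold)
  D₀ = 2 * suc N₀
  C = m * D + U + (suc D + D) + (suc D₀ + D₀) + 5

  -- The number of points to interpolate grows like M ^ k, the number of coefficients like D ^ (k + 1).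
  enough-coefficients : 2 * (1 + J * (c * (M + 1) ^ k)) < U
  enough-coefficients = begin-strict
    2 * (1 + J * (c * (M + 1) ^ k)) ≤⟨ *-monoʳ-≤ 2 (+-mono-≤ (m^n>0 (suc D) k) (*-monoʳ-≤ J (*-monoʳ-≤ c
        (≤-≡ (^-monoˡ-≤ k M+1≤) (^-distribʳ-* k (2 * m + 3) (suc D)))))) ⟩
    2 * (V + J * (c * ((2 * m + 3) ^ k * V))) ≡⟨ lemma J c ((2 * m + 3) ^ k) V ⟩
    D * V <⟨ *-monoˡ-< V {{>-nonZero (m^n>0 (suc D) k)}} (n<1+n D) ⟩
    U ∎
    where
    open ≤-Reasoning
    V = suc D ^ k
    lemma : ∀ x c q v → 2 * (v + x * (c * (q * v))) ≡ 2 * (1 + x * (c * q)) * v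
    lemma = solve-∀
    ^-distribʳ-* : ∀ n x y → (x * y) ^ n ≡ x ^ n * y ^ n
    ^-distribʳ-* zero x y = refl
    ^-distribʳ-* (suc n) x y = trans (cong (x * y *_) (^-distribʳ-* n x y)) (*-interchange x y (x ^ n) (y ^ n))
    M+1≤ : M + 1 ≤ (2 * m + 3) * suc D
    M+1≤ = ≤-≡ (m≤m+n (M + 1) (2 * m + 3 * D)) (expand m D)
      where
      expand : ∀ m D → 2 * (m * D) + 2 + 1 + (2 * m + 3 * D) ≡ (2 * m + 3) * suc D
      expand = solve-∀

  2≤D : 2 ≤ D
  2≤D = *-monoʳ-≤ 2 {1} (m≤m+n 1 (J * (c * (2 * m + 3) ^ k)))

  M-positive : 0 < M
  M-positive = ≤-trans (s≤s z≤n) (m≤n+m 2 (2 * (m * D)))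

  main-degree : m * D ≤ C
  main-degree = ≤-trans (m≤m+n (m * D) U) (≤-trans (m≤m+n (m * D + U) (suc D + D)) (≤-trans (m≤m+n _ (suc D₀ + D₀)) (m≤m+n _ 5)))
  main-exponent : U + m * D ≤ C
  main-exponent = ≡-≤ (+-comm U (m * D)) (≤-trans (m≤m+n (m * D + U) (suc D + D)) (≤-trans (m≤m+n _ (suc D₀ + D₀)) (m≤m+n _ 5)))
  point-exponent : suc D + D ≤ C
  point-exponent = ≤-trans (m≤n+m (suc D + D) (m * D + U)) (≤-trans (m≤m+n _ (suc D₀ + D₀)) (m≤m+n _ 5))
  small-exponent : suc D₀ + D₀ ≤ C
  small-exponent = ≤-trans (m≤n+m (suc D₀ + D₀) (m * D + U + (suc D + D))) (m≤m+n _ 5)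
  5≤C : 5 ≤ C
  5≤C = m≤n+m 5 (m * D + U + (suc D + D) + (suc D₀ + D₀))

  P₀-threshold : 16 * P₀ ≤ threshold
  P₀-threshold = ≤-trans (≤-trans (m≤m+n (16 * P₀) _) (m≤m+n _ (U * U))) (n≤1+n _)
  loss-threshold : suc e * (2 * loss j) * (2 * (c + 2)) ≤ threshold
  loss-threshold = ≤-trans (≤-trans (m≤n+m _ (16 * P₀)) (m≤m+n _ (U * U))) (n≤1+n _)
  U²-threshold : U * U ≤ threshold
  U²-threshold = ≤-trans (m≤n+m (U * U) (16 * P₀ + suc e * (2 * loss j) * (2 * (c + 2)))) (n≤1+n _)

with-choice : ∀ j e b r a {η ε α ρ : ℝ} → Lower η (+ 1 ℚ./ suc e) → Lower ε (+ 1 ℚ./ suc b) → Lower ρ (+ 1 ℚ./ suc r) →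
  (∀ {m n} → m <[ α · n ] → m ≤ suc a * n) → (d : ℕ) .{{_ : NonZero d}} (N : ℕ) .{{_ : NonZero N}} (S : FinSet (Point N d)) →
  Regular (suc j) η ε ρ S →
  ((p : ℕ) (prime : Prime p) → ∣ residues p {{prime⇒nonZero prime}} S ∣ <[ α · p ^ suc j ]) →
  Conclusion (suc j) η S (Choice.C j e b r a)
with-choice j e b r a {η} {ε} {α} {ρ} = Main.conclusion j e b r a z σ δ Λ M P₀ D D₀ threshold C refl refl refl refl refl refl 2≤D
  enough-coefficients P₀-threshold U²-threshold z<s loss-threshold ≤-refl main-degree main-exponent point-exponent small-exponent 5≤C
  {η} {ε} {α} {ρ}
  where open Choice j e b r a

theorem6p1 : (k : ℕ) .{{_ : NonZero k}} (η ε α ρ : ℝ) →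
    Positive η → Positive ε → Positive α → Positive ρ →
    Σ[ C ∈ ℕ ]
    ((d : ℕ) .{{_ : NonZero d}} (N : ℕ) .{{_ : NonZero N}} (S : FinSet (Point N d)) →
    Regular k η ε ρ S →
    ((p : ℕ) (prime : Prime p) → ∣ residues p {{prime⇒nonZero prime}} S ∣ <[ α · p ^ k ]) →
    Σ[ f ∈ Polynomial d ]
    (Nontrivial k f ×
    DegreeAtMost C f ×
    CoefficientsAtMost (N ^ C) f ×
    ∣ zerosIn S f ∣ >[ (1ℚ ⊖ η) · ∣ S ∣ ]))
theorem6p1 zero {{()}}
theorem6p1 (suc j) η ε α ρ η>0 ε>0 α>0 ρ>0 =
  let (e , η-low) = positive-fraction η η>0
      (b , ε-low) = positive-fraction ε ε>0
      (r , ρ-low) = positive-fraction ρ ρ>0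
      (a , α-bound) = natural-upper-bound α
  in Choice.C j e b r a , with-choice j e b r a {η} {ε} {α} {ρ} η-low ε-low ρ-low α-bound
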